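{- Consider normalised instances with parameter $\rho$ and scalar values ($d_v=1$, $|v_i|\le1$). (i) For every such instance and every fixed $q$ with $\|q\|\le\rho$ there is a signing $\sigma\in\{\pm1\}^n$, computable in $O(n)$ time from the weights $e^{q^\top k_i}v_i$ (so in $O(nd_k)$ time in all), with $|\sum_i\sigma_ie^{q^\top k_i}v_i|\le e^{\rho}$; and for every $\varepsilon\in(0,1]$ there is a subset $S\subseteq[n]$ with $|S|\le24e^{\rho}/\varepsilon+3$ and $|\mathrm{Attn}_S(q)-\mathrm{Attn}(q)|\le\varepsilon$. (ii) For every $r\ge2$, every $d_k\ge r$ and every $0<\rho\le\sqrt r$ there is a centred instance of $r$ keys in $\mathbb{R}^{d_k}$ with values $v_i\equiv1$ such that every signing $\sigma\in\{\pm1\}^r$ satisfies $\sup_{\|q\|\le\rho}|\sum_i\sigma_ie^{q^\top k_i}|\ge\rho\sqrt r/e$. In particular, at $\rho=1$, one signing for the whole ball costs $\Omega(\sqrt{d_k})$ (there are instances on which every signing has $\sup_{\|q\|\le1}|\sum_i\sigma_ie^{q^\top k_i}|=\Omega(\sqrt{d_k})$) where each single query costs $O(1)$.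
   Context: Normalised instance with parameter $\rho$: keys $k_1,\dots,k_n\in\mathbb{R}^{d_k}$ and values $v_1,\dots,v_n\in\mathbb{R}$ with $\frac1n\sum_i k_i=0$ (centred), $\|k_i\|\le1$, $|v_i|\le1$; queries are the $q\in\mathbb{R}^{d_k}$ with $\|q\|\le\rho$. For nonempty $S\subseteq[n]$ put $\mathrm{Attn}_S(q)=\dfrac{\sum_{i\in S}e^{q^\top k_i}v_i}{\sum_{i\in S}e^{q^\top k_i}}$ and $\mathrm{Attn}=\mathrm{Attn}_{[n]}$. -}

module Defs where

open import Algebra.Bundles using (CommutativeRing; Semiring)
open import Algebra.Structures using (IsCommutativeRing)
import Algebra.Construct.NaturalChoice.Max as Max
import Algebra.Definitions.RawSemiring as RawSemiringDefs
import Algebra.Properties.Ring as RingProperties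
open import Axiom.ExcludedMiddle using (ExcludedMiddle)
open import Data.Bool.Base using (if_then_else_)
open import Data.Fin.Base using (Fin; toℕ; fromℕ<)
open import Data.Fin.Subset using (Subset)
open import Data.List.Base using (List; []; _∷_; length)
open import Data.Maybe.Base using (Maybe; just; nothing)
open import Data.Nat.Base as ℕ using (ℕ; zero; suc; _!)
import Data.Nat.Properties as ℕₚ
open import Data.Product.Base using (Σ-syntax; _×_; _,_)
open import Data.Sign.Base using (Sign)
open import Data.Sum.Base using (_⊎_; inj₁; inj₂)
import Data.Vec.Base as Vec
open import Data.Vec.Functional using (Vector; concat)
open import Level using (0ℓ)
open import Relation.Binary.Bundles using (DecTotalOrder)
open import Relation.Binary.Core using (Rel)
import Relation.Binary.Construct.NonStrictToStrict as ToStrict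
open import Relation.Binary.Structures using (IsDecTotalOrder)
open import Relation.Nullary.Decidable.Core using (Dec; yes; no; ⌊_⌋)
open import Relation.Nullary.Negation.Core using (¬_; contradiction)

------------------------------------------------------------------------
-- The real numbers, as a Dedekind-complete totally ordered field.  Such
-- a field is unique up to isomorphism, so results about every RealField
-- are results about ℝ.

record RealField : Set₁ where
  infix  8 _⁻¹ -_
  infixl 7 _*_
  infixl 6 _+_
  infix  4 _≈_ _≤_

  field
    Carrier           : Set
    _≈_ _≤_           : Rel Carrier 0ℓ
    _+_ _*_           : Carrier → Carrier → Carrier
    -_ _⁻¹            : Carrier → Carrier
    0# 1#             : Carrier
    isCommutativeRing : IsCommutativeRing _≈_ _+_ _*_ -_ 0# 1#
    isDecTotalOrder   : IsDecTotalOrder _≈_ _≤_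
    0≉1               : ¬ (0# ≈ 1#)
    -- The inverse is total, with an unspecified value at 0#.
    ⁻¹-cong           : ∀ {x y} → x ≈ y → x ⁻¹ ≈ y ⁻¹
    ⁻¹-inverseʳ       : ∀ {x} → ¬ (x ≈ 0#) → x * x ⁻¹ ≈ 1#
    +-monoˡ-≤         : ∀ {x y} z → x ≤ y → x + z ≤ y + z
    *-nonneg          : ∀ {x y} → 0# ≤ x → 0# ≤ y → 0# ≤ x * y

  open ToStrict _≈_ _≤_ public using (_<_)

  -- "s is the supremum of P" in its ε-form: s is an upper bound of P, and
  -- every y < s is exceeded by a member of P.
  IsSup : (Carrier → Set) → Carrier → Set
  IsSup P s = (∀ x → P x → x ≤ s)
            × (∀ y → y < s → Σ[ x ∈ Carrier ] (P x × y < x))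

  field
    complete : (P : Carrier → Set) → Σ[ x ∈ Carrier ] P x →
               Σ[ b ∈ Carrier ] (∀ x → P x → x ≤ b) →
               Σ[ s ∈ Carrier ] IsSup P s

  commutativeRing : CommutativeRing 0ℓ 0ℓ
  commutativeRing = record { isCommutativeRing = isCommutativeRing }

  decTotalOrder : DecTotalOrder 0ℓ 0ℓ 0ℓ
  decTotalOrder = record { isDecTotalOrder = isDecTotalOrder }

  open IsDecTotalOrder isDecTotalOrder public
    using (_≤?_; _≟_; total; antisym; ≤-respˡ-≈; ≤-respʳ-≈)
    renaming (refl to ≤-refl; reflexive to ≤-reflexive; trans to ≤-trans)

------------------------------------------------------------------------

module Analysis (R : RealField) where
  open RealField R public
  open CommutativeRing commutativeRing public
    using (ring; semiring; _-_)
  open RawSemiringDefs (Semiring.rawSemiring semiring) public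
    using (_^_; sum) renaming (_×_ to _·ₙ_)
  open Max (DecTotalOrder.totalOrder decTotalOrder) public using (_⊔_)

  private
    module C = CommutativeRing commutativeRing

    0≤1 : 0# ≤ 1#
    0≤1 with total 0# 1#
    ... | inj₁ 0≤1  = 0≤1
    ... | inj₂ 1≤0  = ≤-respʳ-≈ [-1][-1]≈1 (*-nonneg 0≤-1 0≤-1)
      where
      open RingProperties ring using (-1*x≈-x; -‿involutive)
      0≤-1 : 0# ≤ - 1#
      0≤-1 = ≤-respˡ-≈ (C.-‿inverseʳ 1#)
               (≤-respʳ-≈ (C.+-identityˡ (- 1#)) (+-monoˡ-≤ (- 1#) 1≤0))
      [-1][-1]≈1 : - 1# * - 1# ≈ 1#
      [-1][-1]≈1 = C.trans (-1*x≈-x (- 1#)) (-‿involutive 1#)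

  -- Completeness makes the logic classical: inspect the supremum of
  -- {0} ∪ {1 ∣ A}.
  em : ExcludedMiddle 0ℓ
  em {A} = decide (complete P (0# , inj₁ C.refl) (1# , bound))
    where
    P : Carrier → Set
    P x = (x ≈ 0#) ⊎ ((x ≈ 1#) × A)

    bound : ∀ x → P x → x ≤ 1#
    bound x (inj₁ x≈0)       = ≤-trans (≤-reflexive x≈0) 0≤1
    bound x (inj₂ (x≈1 , _)) = ≤-reflexive x≈1

    decide : Σ[ s ∈ Carrier ] IsSup P s → Dec A
    decide (s , ub , approx) with s ≤? 0#
    ... | yes s≤0 = no λ a →
          0≉1 (antisym 0≤1 (≤-trans (ub 1# (inj₂ (C.refl , a))) s≤0))
    ... | no  s≰0 with approx 0# ( ub 0# (inj₁ C.refl)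
                                 , λ 0≈s → s≰0 (≤-reflexive (C.sym 0≈s)))
    ...   | x , inj₁ x≈0     , (_ , 0≉x) = contradiction (C.sym x≈0) 0≉x
    ...   | x , inj₂ (_ , a) , _         = yes a

  infixl 7 _/_
  _/_ : Carrier → Carrier → Carrier
  x / y = x * y ⁻¹

  fromℕ : ℕ → Carrier
  fromℕ n = n ·ₙ 1#

  ∣_∣ : Carrier → Carrier
  ∣ x ∣ = x ⊔ - x

  -- The nonnegative square root; 0# at negative arguments.
  √ : Carrier → Carrier
  √ x with em {Σ[ y ∈ Carrier ] (0# ≤ y × y * y ≈ x)}
  ... | yes (y , _) = y
  ... | no  _       = 0#

  ConvergesTo : (ℕ → Carrier) → Carrier → Set
  ConvergesTo s l = ∀ ε → 0# < ε →
    Σ[ N ∈ ℕ ] (∀ n → N ℕ.≤ n → ∣ s n - l ∣ < ε)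

  -- The limit of a sequence; 0# if the sequence diverges.
  lim : (ℕ → Carrier) → Carrier
  lim s with em {Σ[ l ∈ Carrier ] ConvergesTo s l}
  ... | yes (l , _) = l
  ... | no  _       = 0#

  exp : Carrier → Carrier
  exp x = lim λ n → sum {n} λ i → x ^ toℕ i / fromℕ (toℕ i !)

  infix 8 _∙_
  _∙_ : ∀ {d} → Vector Carrier d → Vector Carrier d → Carrier
  x ∙ y = sum λ j → x j * y j

  ‖_‖ : ∀ {d} → Vector Carrier d → Carrier
  ‖ x ‖ = √ (x ∙ x)

  BallImage : ∀ {d} → Carrier → (Vector Carrier d → Carrier) → Carrier → Set
  BallImage {d} ρ f y = Σ[ q ∈ Vector Carrier d ] (‖ q ‖ ≤ ρ × y ≈ f q)

------------------------------------------------------------------------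
-- Real-RAM programs.  There are unboundedly many index registers holding
-- naturals, real registers, and arrays of reals (all named by naturals).
-- Every instruction has unit cost.  Index registers can only be cleared,
-- incremented and compared, so that no work can be hidden in arithmetic
-- on large integers.  Exponentiation is available only in programs over
-- the basis `withExp`.

data Basis : Set where
  arithmetic withExp : Basis

data Instr : Basis → Set where
  clear   : ∀ {b} (i : ℕ) → Instr b
  incr    : ∀ {b} (i : ℕ) → Instr b
  load    : ∀ {b} (x a i : ℕ) → Instr b
  store   : ∀ {b} (a i x : ℕ) → Instr b
  zeroᵣ   : ∀ {b} (x : ℕ) → Instr b
  oneᵣ    : ∀ {b} (x : ℕ) → Instr b
  add     : ∀ {b} (x y z : ℕ) → Instr b
  sub     : ∀ {b} (x y z : ℕ) → Instr b
  mul     : ∀ {b} (x y z : ℕ) → Instr b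
  expᵣ    : (x y : ℕ) → Instr withExp
  jump    : ∀ {b} (l : ℕ) → Instr b
  jumpLt  : ∀ {b} (i j l : ℕ) → Instr b
  jumpLe  : ∀ {b} (x y l : ℕ) → Instr b

Program : Basis → Set
Program b = List (Instr b)

fetch : ∀ {b} → Program b → ℕ → Maybe (Instr b)
fetch []       _       = nothing
fetch (c ∷ _)  zero    = just c
fetch (_ ∷ cs) (suc l) = fetch cs l

infixl 9 _[_≔_]
_[_≔_] : {A : Set} → (ℕ → A) → ℕ → A → ℕ → A
(f [ i ≔ a ]) j = if j ℕ.≡ᵇ i then a else f j

module RealRAM (R : RealField) where
  open Analysis R

  record State : Set where
    constructor state
    field
      pc  : ℕ
      idx : ℕ → ℕ
      reg : ℕ → Carrier
      arr : ℕ → ℕ → Carrier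

  open State public

  exec : ∀ {b} → Instr b → State → State
  exec (clear i)       (state l I X A) = state (suc l) (I [ i ≔ 0 ]) X A
  exec (incr i)        (state l I X A) = state (suc l) (I [ i ≔ suc (I i) ]) X A
  exec (load x a i)    (state l I X A) = state (suc l) I (X [ x ≔ A a (I i) ]) A
  exec (store a i x)   (state l I X A) = state (suc l) I X (A [ a ≔ A a [ I i ≔ X x ] ])
  exec (zeroᵣ x)       (state l I X A) = state (suc l) I (X [ x ≔ 0# ]) A
  exec (oneᵣ x)        (state l I X A) = state (suc l) I (X [ x ≔ 1# ]) A
  exec (add x y z)     (state l I X A) = state (suc l) I (X [ x ≔ X y + X z ]) A
  exec (sub x y z)     (state l I X A) = state (suc l) I (X [ x ≔ X y - X z ]) A
  exec (mul x y z)     (state l I X A) = state (suc l) I (X [ x ≔ X y * X z ]) A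
  exec (expᵣ x y)      (state l I X A) = state (suc l) I (X [ x ≔ exp (X y) ]) A
  exec (jump m)        (state l I X A) = state m I X A
  exec (jumpLt i j m)  (state l I X A) =
    state (if I i ℕ.<ᵇ I j then m else suc l) I X A
  exec (jumpLe x y m)  (state l I X A) =
    state (if ⌊ X x ≤? X y ⌋ then m else suc l) I X A

  step : ∀ {b} → Program b → State → State
  step p s with fetch p (pc s)
  ... | just c  = exec c s
  ... | nothing = s

  run : ∀ {b} → Program b → ℕ → State → State
  run p zero    s = s
  run p (suc t) s = run p t (step p s)

  Halted : ∀ {b} → Program b → State → Set
  Halted p s = length p ℕ.≤ pc s

  sgn : Sign → Carrier
  sgn Sign.+ = 1#
  sgn Sign.- = - 1#

  -- Within t steps from s, p halts with σ written to array 0.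
  OutputsWithin : ∀ {b n} → Program b → State → ℕ → (Fin n → Sign) → Set
  OutputsWithin p s t σ =
    Halted p s′ × (∀ i → arr s′ 0 (toℕ i) ≈ sgn (σ i))
    where s′ = run p t s

  pad : ∀ {n} → Vector Carrier n → ℕ → Carrier
  pad {n} v i with i ℕₚ.<? n
  ... | yes i<n = v (fromℕ< i<n)
  ... | no  _   = 0#

------------------------------------------------------------------------

module Attention (R : RealField) where
  open Analysis R public
  open RealRAM R public

  record Instance (n d : ℕ) : Set where
    field
      1≤n       : 1 ℕ.≤ n
      1≤d       : 1 ℕ.≤ d
      key       : Fin n → Vector Carrier d
      value     : Vector Carrier n
      centred   : ∀ j → 1# / fromℕ n * sum (λ i → key i j) ≈ 0#
      ‖key‖≤1   : ∀ i → ‖ key i ‖ ≤ 1#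
      ∣value∣≤1 : ∀ i → ∣ value i ∣ ≤ 1#

  open Instance public

  kernel : ∀ {n d} → Instance n d → Vector Carrier d → Vector Carrier n
  kernel I q i = exp (q ∙ key I i)

  weight : ∀ {n d} → Instance n d → Vector Carrier d → Vector Carrier n
  weight I q i = kernel I q i * value I i

  sumOver : ∀ {n} → Subset n → Vector Carrier n → Carrier
  sumOver S f = sum λ i → if Vec.lookup S i then f i else 0#

  Attn : ∀ {n d} → Instance n d → Subset n → Vector Carrier d → Carrier
  Attn I S q = sumOver S (weight I q) / sumOver S (kernel I q)

  signedSum : ∀ {n} → (Fin n → Sign) → Vector Carrier n → Carrier
  signedSum σ w = sum λ i → sgn (σ i) * w i

  -- Initial states.  Unless set below, registers and array cells hold 0.
  blank : State
  blank = state 0 (λ _ → 0) (λ _ → 0#) (λ _ _ → 0#)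

  -- Index register 0 holds n, and array 1 the weights.
  weightsInput : ∀ {n d} → Instance n d → Vector Carrier d → State
  weightsInput {n} I q = record blank
    { idx = idx blank [ 0 ≔ n ]
    ; arr = arr blank [ 1 ≔ pad (weight I q) ]
    }

  -- Index registers 0 and 1 hold n and d; arrays 1, 2 and 3 hold the
  -- query, the keys in row-major order, and the values.
  instanceInput : ∀ {n d} → Instance n d → Vector Carrier d → State
  instanceInput {n} {d} I q = record blank
    { idx = idx blank [ 0 ≔ n ] [ 1 ≔ d ]
    ; arr = arr blank [ 1 ≔ pad q ] [ 2 ≔ pad (concat (key I)) ]
                      [ 3 ≔ pad (value I) ]
    }

{-# OPTIONS --safe #-}
module Submission where

-- Signing: Cauchy–Schwarz gives q·kᵢ ≤ ρ, so every weight is at most e^ρ in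
-- absolute value.  Choosing each sign opposite to the running sum keeps that
-- sum within e^ρ; this greedy choice is a single pass over the weights.
--
-- Subset: let μ = Attn(q), κᵢ = e^{q·kᵢ} and uᵢ = κᵢ (vᵢ - μ), so Σ u = 0 and
-- |uᵢ| ≤ 2e^ρ.  Indices can be removed one at a time with the sum of u over
-- the rest staying within 2e^ρ, hence any block of consecutively removed
-- indices has |Σ u| ≤ 4e^ρ.  Since the keys are centred and e^x ≥ 1 + x, the
-- total of κ is at least n, so among blocks of m ≈ 4e^ρ/ε indices one has
-- Σ κ ≥ m; on it the average of v with weights κ is within ε of μ.
--
-- Whole ball: take kᵢ = eᵢ - (1/r) Σ eⱼ and q = ±(ρ/√r) σ, with the sign making
-- the mean of ±σ nonnegative.  Then q·kᵢ = (ρ/√r)(±σᵢ - mean), and e^x ≥ 1 + x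
-- bounds the signed sum below by r (ρ/√r) / 2 ≥ ρ√r / e.
--
-- Analytically only e^x e^{-x} = 1, e^x ≥ 1 + x and monotonicity in |x| are
-- used; the first two come from the power series via its truncated products.

open import Algebra.Bundles using (CommutativeRing)
import Algebra.Construct.NaturalChoice.Max as Max
import Algebra.Properties.Ring as RingProperties
import Algebra.Solver.Ring
open import Algebra.Solver.Ring.AlmostCommutativeRing
  using (fromCommutativeRing; _-Raw-AlmostCommutative⟶_)
open import Data.Bool.Base using (Bool; true; false; if_then_else_; T)
open import Data.Fin.Base using (Fin; zero; suc; toℕ; fromℕ<; combine)
import Data.Fin.Properties as Finₚ
open import Data.Fin.Subset using (Subset; Nonempty; ⊤; _∈_; _⊆_; _─_) renaming (∣_∣ to card)
open import Data.Fin.Subset.Properties using (drop-∷-⊆; _∈?_)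
open import Data.Integer.Base as ℤ using (ℤ; +_; -[1+_]; _◃_)
import Data.Integer.Properties as ℤₚ
open import Data.List.Base using ([]; _∷_; length)
open import Data.Maybe.Base using (Maybe; just; nothing)
open import Data.Nat.Base as ℕ using (ℕ; zero; suc; _!)
import Data.Nat.Properties as ℕₚ
open import Data.Nat.Solver using (module +-*-Solver)
open import Data.Product.Base using (Σ-syntax; _×_; _,_; proj₁; proj₂)
open import Data.Sign.Base as Sign using (Sign)
open import Data.Sum.Base using (_⊎_; inj₁; inj₂; [_,_]′)
open import Data.Vec.Base as Vec using ([]; _∷_; here; there)
open import Data.Vec.Functional using (Vector; concat)
open import Relation.Binary.Bundles using (DecTotalOrder)
open import Relation.Binary.PropositionalEquality.Core as ≡ using (_≡_)
open import Relation.Nullary.Decidable using (_×-dec_)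
open import Relation.Nullary.Decidable.Core using (Dec; yes; no; ⌊_⌋; does)
open import Relation.Nullary.Negation.Core using (¬_; contradiction)
open import Defs

-- Peeling controls Σ u on a block but not its kernel mass, and a kernel can be as small as e^(-ρ);
-- bounding the mass through the smallest kernel would give size of order e^(2ρ)/ε. The induction
-- over blocks therefore carries the inequality mass ≥ cardinality: a light block can be thrown
-- away, because what is left still satisfies it, and a final set too small to be peeled again is
-- heavy by the invariant alone. A block has at most 2m members with m ≤ 4e^ρ/ε + 1, so 8e^ρ/ε + 2
-- would do and the constant 24 leaves slack.
--
-- `√` and `lim` are choices by excluded middle with default `0#`, so roots and convergence are
-- first derived from suprema. The identity e^x e^(-x) = 1 is reached without double series: e^x
-- Σ_(k≤m) (-x)^k/k! differs from 1 by (-1)^m ∫₀ˣ s^m/m! e^s ds, and finite truncations of these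
-- integrals obey an exact recursion in m.
--
-- Both programs share one loop, parametric in the code that produces the next weight; running times
-- are exact step counts, rounded up at the end.

-- A ring solver whose coefficients are integers, so that numerals compute.
module IntegerCoefficients {c ℓ} (R : CommutativeRing c ℓ) where
  open CommutativeRing R
  open import Algebra.Properties.Ring ring
  open import Algebra.Properties.AbelianGroup +-abelianGroup using (⁻¹-∙-comm)
  open import Algebra.Properties.Monoid.Mult.TCOptimised +-monoid
    using (×-homo-+) renaming (_×_ to _·_; 1+× to 1+·)
  open import Algebra.Properties.Semiring.Mult.TCOptimised semiring using (×1-homo-*)
  open import Relation.Binary.Reasoning.Setoid setoid

  private
    ⟦_⟧ : ℤ → Carrier
    ⟦ + n ⟧      = n · 1#
    ⟦ -[1+ n ] ⟧ = - (suc n · 1#)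

    ⊖-homo : ∀ m n → ⟦ m ℤ.⊖ n ⟧ ≈ m · 1# - n · 1#
    ⊖-homo zero    zero    = sym (-‿inverseʳ 0#)
    ⊖-homo zero    (suc n) = sym (+-identityˡ _)
    ⊖-homo (suc m) zero    = sym (trans (+-congˡ -0#≈0#) (+-identityʳ _))
    ⊖-homo (suc m) (suc n) = begin
      ⟦ suc m ℤ.⊖ suc n ⟧                  ≡⟨ ≡.cong ⟦_⟧ (ℤₚ.[1+m]⊖[1+n]≡m⊖n m n) ⟩
      ⟦ m ℤ.⊖ n ⟧                          ≈⟨ ⊖-homo m n ⟩
      m · 1# - n · 1#                      ≈⟨ +-congʳ (+-identityʳ _) ⟨
      (m · 1# + 0#) - n · 1#               ≈⟨ +-congʳ (+-congˡ (-‿inverseʳ 1#)) ⟨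
      (m · 1# + (1# - 1#)) - n · 1#        ≈⟨ +-congʳ (+-assoc _ _ _) ⟨
      (m · 1# + 1# - 1#) - n · 1#          ≈⟨ +-congʳ (+-congʳ (+-comm _ _)) ⟩
      (1# + m · 1# - 1#) - n · 1#          ≈⟨ +-assoc _ _ _ ⟩
      (1# + m · 1#) + (- 1# - n · 1#)      ≈⟨ +-congˡ (⁻¹-∙-comm _ _) ⟩
      (1# + m · 1#) - (1# + n · 1#)        ≈⟨ +-cong (1+· m 1#) (-‿cong (1+· n 1#)) ⟨
      suc m · 1# - suc n · 1#              ∎

    +-homo : ∀ i j → ⟦ i ℤ.+ j ⟧ ≈ ⟦ i ⟧ + ⟦ j ⟧
    +-homo (+ m)      (+ n)      = ×-homo-+ 1# m n
    +-homo (+ m)      -[1+ n ]   = ⊖-homo m (suc n)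
    +-homo -[1+ m ]   (+ n)      = trans (⊖-homo n (suc m)) (+-comm _ _)
    +-homo -[1+ m ]   -[1+ n ]   = begin
      - (suc (suc (m ℕ.+ n)) · 1#)          ≡⟨ ≡.cong (λ k → - (k · 1#)) (ℕₚ.+-suc (suc m) n) ⟨
      - ((suc m ℕ.+ suc n) · 1#)            ≈⟨ -‿cong (×-homo-+ 1# (suc m) (suc n)) ⟩
      - (suc m · 1# + suc n · 1#)           ≈⟨ ⁻¹-∙-comm _ _ ⟨
      - (suc m · 1#) - (suc n · 1#)         ∎

    -‿homo : ∀ i → ⟦ ℤ.- i ⟧ ≈ - ⟦ i ⟧
    -‿homo (+ zero)   = sym -0#≈0#
    -‿homo (+ suc n)  = refl
    -‿homo -[1+ n ]   = sym (-‿involutive _)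

    ◃+-homo : ∀ n → ⟦ Sign.+ ◃ n ⟧ ≈ n · 1#
    ◃+-homo zero    = refl
    ◃+-homo (suc n) = refl

    ◃-‿homo : ∀ n → ⟦ Sign.- ◃ n ⟧ ≈ - (n · 1#)
    ◃-‿homo zero    = sym -0#≈0#
    ◃-‿homo (suc n) = refl

    *-homo : ∀ i j → ⟦ i ℤ.* j ⟧ ≈ ⟦ i ⟧ * ⟦ j ⟧
    *-homo (+ m)      (+ n)      = trans (◃+-homo (m ℕ.* n)) (×1-homo-* m n)
    *-homo (+ m)      -[1+ n ]   = trans (◃-‿homo (m ℕ.* suc n))
      (trans (-‿cong (×1-homo-* m (suc n))) (-‿distribʳ-* _ _))
    *-homo -[1+ m ]   (+ n)      = trans (◃-‿homo (suc m ℕ.* n))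
      (trans (-‿cong (×1-homo-* (suc m) n)) (-‿distribˡ-* _ _))
    *-homo -[1+ m ]   -[1+ n ]   = begin
      (suc m ℕ.* suc n) · 1#                ≈⟨ ×1-homo-* (suc m) (suc n) ⟩
      suc m · 1# * suc n · 1#               ≈⟨ -‿involutive _ ⟨
      - - (suc m · 1# * suc n · 1#)         ≈⟨ -‿cong (-‿distribʳ-* _ _) ⟩
      - (suc m · 1# * - (suc n · 1#))       ≈⟨ -‿distribˡ-* _ _ ⟩
      - (suc m · 1#) * - (suc n · 1#)       ∎

    almost = fromCommutativeRing R

    morphism : ℤ.+-*-rawRing -Raw-AlmostCommutative⟶ almost
    morphism = record
      { ⟦_⟧ = ⟦_⟧ ; +-homo = +-homo ; *-homo = *-homo ; -‿homo = -‿homo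
      ; 0-homo = refl ; 1-homo = refl }

    _coeff≟_ : ∀ i j → Maybe (⟦ i ⟧ ≈ ⟦ j ⟧)
    i coeff≟ j with i ℤₚ.≟ j
    ... | yes i≡j = just (reflexive (≡.cong ⟦_⟧ i≡j))
    ... | no  _   = nothing

  open Algebra.Solver.Ring ℤ.+-*-rawRing almost morphism _coeff≟_ public


-- Ordered-field arithmetic, absolute values, the Archimedean property and finite sums.

module OrderedField (R : RealField) where
  open Attention R public
  open CommutativeRing commutativeRing public
    using (refl; sym; trans; reflexive; setoid; +-cong; +-congˡ; +-congʳ; *-cong; *-congˡ; *-congʳ;
           -‿cong; +-identityˡ; +-identityʳ; *-identityˡ; *-identityʳ; +-comm; *-comm;
           +-assoc; *-assoc; zeroˡ; zeroʳ; -‿inverseʳ; -‿inverseˡ; distribˡ; distribʳ)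
  open import Relation.Binary.Properties.DecTotalOrder decTotalOrder public
    using (<⇒≱; ≰⇒>)
  open import Relation.Binary.Reasoning.PartialOrder
    (DecTotalOrder.poset decTotalOrder) public
  open IntegerCoefficients commutativeRing public
    using (solve; con; _:=_; _:+_; _:*_; _:-_; :-_)
  open import Algebra.Properties.Semiring.Mult semiring using (×1-homo-*; ×-homo-+)
  open import Algebra.Properties.Semiring.Sum semiring public
    using (sum-cong-≋; ∑-distrib-+; *-distribˡ-sum; *-distribʳ-sum; ∑-comm)
  open Max (DecTotalOrder.totalOrder decTotalOrder) using (⊔-cong; ⊔-lub; ⊔-sel; x≤x⊔y; x≤y⊔x)

  infix 4 _≉_
  _≉_ : Carrier → Carrier → Set
  x ≉ y = ¬ (x ≈ y)

  <⇒≤ : ∀ {x y} → x < y → x ≤ y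
  <⇒≤ = proj₁

  0<⇒≉0 : ∀ {x} → 0# < x → x ≉ 0#
  0<⇒≉0 (_ , 0≉x) x≈0 = 0≉x (sym x≈0)

  <-≤-trans : ∀ {x y z} → x < y → y ≤ z → x < z
  <-≤-trans (x≤y , x≉y) y≤z =
    ≤-trans x≤y y≤z , λ x≈z → x≉y (antisym x≤y (≤-trans y≤z (≤-reflexive (sym x≈z))))

  ≤-<-trans : ∀ {x y z} → x ≤ y → y < z → x < z
  ≤-<-trans x≤y (y≤z , y≉z) =
    ≤-trans x≤y y≤z , λ x≈z → y≉z (antisym y≤z (≤-trans (≤-reflexive (sym x≈z)) x≤y))

  ≤-resp : ∀ {x x′ y y′} → x ≈ x′ → y ≈ y′ → x ≤ y → x′ ≤ y′
  ≤-resp x≈x′ y≈y′ x≤y = ≤-respˡ-≈ x≈x′ (≤-respʳ-≈ y≈y′ x≤y)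

  +-mono-≤ : ∀ {x y u v} → x ≤ y → u ≤ v → x + u ≤ y + v
  +-mono-≤ {x} {y} {u} {v} x≤y u≤v =
    ≤-trans (+-monoˡ-≤ u x≤y) (≤-resp (+-comm u y) (+-comm v y) (+-monoˡ-≤ y u≤v))

  x≤y⇒0≤y-x : ∀ {x y} → x ≤ y → 0# ≤ y - x
  x≤y⇒0≤y-x {x} x≤y = ≤-respˡ-≈ (-‿inverseʳ x) (+-monoˡ-≤ (- x) x≤y)

  ≤-by-difference : ∀ {x y c} → 0# ≤ c → y ≈ x + c → x ≤ y
  ≤-by-difference {x} 0≤c y≈x+c = ≤-resp (+-identityʳ x) (sym y≈x+c) (+-mono-≤ ≤-refl 0≤c)

  0≤y-x⇒x≤y : ∀ {x y} → 0# ≤ y - x → x ≤ y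
  0≤y-x⇒x≤y {x} {y} 0≤y-x =
    ≤-by-difference 0≤y-x (solve 2 (λ x y → y := x :+ (y :- x)) refl x y)

  x<y⇒0<y-x : ∀ {x y} → x < y → 0# < y - x
  x<y⇒0<y-x {x} {y} (x≤y , x≉y) = x≤y⇒0≤y-x x≤y , λ 0≈y-x → x≉y (begin-equality
    x              ≈⟨ +-identityʳ x ⟨
    x + 0#         ≈⟨ +-congˡ 0≈y-x ⟩
    x + (y - x)    ≈⟨ solve 2 (λ x y → x :+ (y :- x) := y) refl x y ⟩
    y              ∎)

  -‿antimono : ∀ {x y} → x ≤ y → - y ≤ - x
  -‿antimono {x} {y} x≤y = 0≤y-x⇒x≤y
    (≤-respʳ-≈ (solve 2 (λ x y → y :- x := :- x :- (:- y)) refl x y) (x≤y⇒0≤y-x x≤y))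

  x≤0⇒0≤-x : ∀ {x} → x ≤ 0# → 0# ≤ - x
  x≤0⇒0≤-x {x} x≤0 = ≤-respˡ-≈ (solve 0 (:- con (+ 0) := con (+ 0)) refl) (-‿antimono x≤0)

  0≤-x⇒x≤0 : ∀ {x} → 0# ≤ - x → x ≤ 0#
  0≤-x⇒x≤0 {x} 0≤-x = ≤-by-difference 0≤-x (solve 1 (λ x → con (+ 0) := x :- x) refl x)

  0≤x+y : ∀ {x y} → 0# ≤ x → 0# ≤ y → 0# ≤ x + y
  0≤x+y 0≤x 0≤y = ≤-respˡ-≈ (+-identityʳ 0#) (+-mono-≤ 0≤x 0≤y)

  *-monoˡ-≤ : ∀ {x y z} → 0# ≤ z → x ≤ y → x * z ≤ y * z
  *-monoˡ-≤ {x} {y} {z} 0≤z x≤y = ≤-by-difference (*-nonneg (x≤y⇒0≤y-x x≤y) 0≤z)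
    (solve 3 (λ x y z → y :* z := x :* z :+ (y :- x) :* z) refl x y z)

  *-monoʳ-≤ : ∀ {x y z} → 0# ≤ z → x ≤ y → z * x ≤ z * y
  *-monoʳ-≤ {x} {y} {z} 0≤z x≤y = ≤-resp (*-comm x z) (*-comm y z) (*-monoˡ-≤ 0≤z x≤y)

  *-mono-≤ : ∀ {x y u v} → 0# ≤ u → 0# ≤ y → x ≤ y → u ≤ v → x * u ≤ y * v
  *-mono-≤ 0≤u 0≤y x≤y u≤v = ≤-trans (*-monoˡ-≤ 0≤u x≤y) (*-monoʳ-≤ 0≤y u≤v)

  0≤x*x : ∀ x → 0# ≤ x * x
  0≤x*x x = [ (λ 0≤x → *-nonneg 0≤x 0≤x)
            , (λ x≤0 → ≤-respʳ-≈ (solve 1 (λ x → :- x :* :- x := x :* x) refl x)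
                         (*-nonneg (x≤0⇒0≤-x x≤0) (x≤0⇒0≤-x x≤0))) ]′ (total 0# x)

  0≤1 : 0# ≤ 1#
  0≤1 = ≤-respʳ-≈ (*-identityʳ 1#) (0≤x*x 1#)

  0<1 : 0# < 1#
  0<1 = 0≤1 , 0≉1

  x≤x+1 : ∀ x → x ≤ x + 1#
  x≤x+1 x = ≤-by-difference 0≤1 refl

  0<x*y : ∀ {x y} → 0# < x → 0# < y → 0# < x * y
  0<x*y {x} {y} (0≤x , 0≉x) (0≤y , 0≉y) = *-nonneg 0≤x 0≤y , λ 0≈xy → 0≉y (begin-equality
    0#                ≈⟨ zeroˡ _ ⟨
    0# * x ⁻¹         ≈⟨ *-congʳ 0≈xy ⟩
    (x * y) * x ⁻¹    ≈⟨ solve 3 (λ x y i → x :* y :* i := x :* i :* y) refl x y (x ⁻¹) ⟩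
    (x * x ⁻¹) * y    ≈⟨ *-congʳ (⁻¹-inverseʳ (λ x≈0 → 0≉x (sym x≈0))) ⟩
    1# * y            ≈⟨ *-identityˡ y ⟩
    y                 ∎)

  0<x⇒0≤x⁻¹ : ∀ {x} → 0# < x → 0# ≤ x ⁻¹
  0<x⇒0≤x⁻¹ {x} 0<x = ≤-respʳ-≈ (begin-equality
    x * (x ⁻¹ * x ⁻¹)   ≈⟨ *-assoc _ _ _ ⟨
    x * x ⁻¹ * x ⁻¹     ≈⟨ *-congʳ (⁻¹-inverseʳ (0<⇒≉0 0<x)) ⟩
    1# * x ⁻¹           ≈⟨ *-identityˡ _ ⟩
    x ⁻¹                ∎) (*-nonneg (<⇒≤ 0<x) (0≤x*x (x ⁻¹)))

  x/y*y≈x : ∀ x {y} → y ≉ 0# → x / y * y ≈ x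
  x/y*y≈x x {y} y≉0 = begin-equality
    x * y ⁻¹ * y     ≈⟨ solve 3 (λ x y i → x :* i :* y := x :* (y :* i)) refl x y (y ⁻¹) ⟩
    x * (y * y ⁻¹)   ≈⟨ *-congˡ (⁻¹-inverseʳ y≉0) ⟩
    x * 1#           ≈⟨ *-identityʳ x ⟩
    x                ∎

  x*y/y≈x : ∀ x {y} → y ≉ 0# → x * y / y ≈ x
  x*y/y≈x x y≉0 = trans (*-assoc _ _ _) (trans (*-congˡ (⁻¹-inverseʳ y≉0)) (*-identityʳ x))

  *-cancelʳ-≈ : ∀ {x y z} → z ≉ 0# → x * z ≈ y * z → x ≈ y
  *-cancelʳ-≈ {x} {y} z≉0 xz≈yz = trans (sym (x*y/y≈x x z≉0)) (trans (*-congʳ xz≈yz) (x*y/y≈x y z≉0))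

  *-cancelʳ-≤ : ∀ {x y z} → 0# < z → x * z ≤ y * z → x ≤ y
  *-cancelʳ-≤ {x} {y} 0<z xz≤yz =
    ≤-resp (x*y/y≈x x (0<⇒≉0 0<z)) (x*y/y≈x y (0<⇒≉0 0<z)) (*-monoˡ-≤ (0<x⇒0≤x⁻¹ 0<z) xz≤yz)

  x≤y*z⇒x/z≤y : ∀ {x y z} → 0# < z → x ≤ y * z → x / z ≤ y
  x≤y*z⇒x/z≤y 0<z x≤yz = *-cancelʳ-≤ 0<z (≤-respˡ-≈ (sym (x/y*y≈x _ (0<⇒≉0 0<z))) x≤yz)

  0<x⇒0<x⁻¹ : ∀ {x} → 0# < x → 0# < x ⁻¹
  0<x⇒0<x⁻¹ {x} 0<x = 0<x⇒0≤x⁻¹ 0<x , λ 0≈x⁻¹ → 0≉1 (begin-equality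
    0#         ≈⟨ zeroʳ x ⟨
    x * 0#     ≈⟨ *-congˡ 0≈x⁻¹ ⟩
    x * x ⁻¹   ≈⟨ ⁻¹-inverseʳ (0<⇒≉0 0<x) ⟩
    1#         ∎)

  square-cancel-≤ : ∀ {x y} → 0# ≤ y → x * x ≤ y * y → x ≤ y
  square-cancel-≤ {x} {y} 0≤y xx≤yy with x ≤? y
  ... | yes x≤y = x≤y
  ... | no  x≰y = ≤-reflexive (*-cancelʳ-≈ x≉0
    (antisym (≤-trans xx≤yy (*-monoʳ-≤ 0≤y (<⇒≤ y<x))) (*-monoˡ-≤ (≤-trans 0≤y (<⇒≤ y<x)) (<⇒≤ y<x))))
    where
    y<x = ≰⇒> x≰y
    x≉0 = 0<⇒≉0 (≤-<-trans 0≤y y<x)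

  ∣x∣≤y : ∀ {x y} → x ≤ y → - x ≤ y → ∣ x ∣ ≤ y
  ∣x∣≤y = ⊔-lub

  x≤∣x∣ : ∀ x → x ≤ ∣ x ∣
  x≤∣x∣ x = x≤x⊔y x (- x)

  -x≤∣x∣ : ∀ x → - x ≤ ∣ x ∣
  -x≤∣x∣ x = x≤y⊔x x (- x)

  ∣∣-cong : ∀ {x y} → x ≈ y → ∣ x ∣ ≈ ∣ y ∣
  ∣∣-cong x≈y = ⊔-cong x≈y (-‿cong x≈y)

  0≤∣x∣ : ∀ x → 0# ≤ ∣ x ∣
  0≤∣x∣ x = [ (λ 0≤x → ≤-trans 0≤x (x≤∣x∣ x))
            , (λ x≤0 → ≤-trans (x≤0⇒0≤-x x≤0) (-x≤∣x∣ x)) ]′ (total 0# x)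

  0≤x⇒∣x∣≈x : ∀ {x} → 0# ≤ x → ∣ x ∣ ≈ x
  0≤x⇒∣x∣≈x {x} 0≤x = antisym (∣x∣≤y ≤-refl (≤-trans -x≤0 0≤x)) (x≤∣x∣ x)
    where -x≤0 = 0≤-x⇒x≤0 (≤-respʳ-≈ (solve 1 (λ x → x := :- (:- x)) refl x) 0≤x)

  ∣x∣*∣x∣≈x*x : ∀ x → ∣ x ∣ * ∣ x ∣ ≈ x * x
  ∣x∣*∣x∣≈x*x x = [ (λ e → *-cong e e)
                  , (λ e → trans (*-cong e e) (solve 1 (λ x → :- x :* :- x := x :* x) refl x)) ]′
                  (⊔-sel x (- x))

  ∣x+y∣≤∣x∣+∣y∣ : ∀ x y → ∣ x + y ∣ ≤ ∣ x ∣ + ∣ y ∣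
  ∣x+y∣≤∣x∣+∣y∣ x y = ∣x∣≤y (+-mono-≤ (x≤∣x∣ x) (x≤∣x∣ y))
    (≤-respˡ-≈ (solve 2 (λ x y → :- x :+ (:- y) := :- (x :+ y)) refl x y)
      (+-mono-≤ (-x≤∣x∣ x) (-x≤∣x∣ y)))

  ∣-x∣≈∣x∣ : ∀ x → ∣ - x ∣ ≈ ∣ x ∣
  ∣-x∣≈∣x∣ x = antisym
    (∣x∣≤y (-x≤∣x∣ x) (≤-respˡ-≈ (solve 1 (λ x → x := :- (:- x)) refl x) (x≤∣x∣ x)))
    (∣x∣≤y (≤-respˡ-≈ (solve 1 (λ x → :- (:- x) := x) refl x) (-x≤∣x∣ (- x))) (x≤∣x∣ (- x)))

  ∣x*y∣≤∣x∣*∣y∣ : ∀ x y → ∣ x * y ∣ ≤ ∣ x ∣ * ∣ y ∣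
  -- Comparing squares avoids the four sign cases.
  ∣x*y∣≤∣x∣*∣y∣ x y = square-cancel-≤ (*-nonneg (0≤∣x∣ x) (0≤∣x∣ y)) (≤-reflexive (begin-equality
    ∣ x * y ∣ * ∣ x * y ∣             ≈⟨ ∣x∣*∣x∣≈x*x (x * y) ⟩
    x * y * (x * y)                   ≈⟨ swap x y ⟩
    (x * x) * (y * y)                 ≈⟨ *-cong (∣x∣*∣x∣≈x*x x) (∣x∣*∣x∣≈x*x y) ⟨
    ∣ x ∣ * ∣ x ∣ * (∣ y ∣ * ∣ y ∣)   ≈⟨ swap ∣ x ∣ ∣ y ∣ ⟨
    ∣ x ∣ * ∣ y ∣ * (∣ x ∣ * ∣ y ∣)   ∎))
    where
    swap : ∀ x y → x * y * (x * y) ≈ (x * x) * (y * y)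
    swap = solve 2 (λ x y → x :* y :* (x :* y) := (x :* x) :* (y :* y)) refl

  0≤fromℕ : ∀ n → 0# ≤ fromℕ n
  0≤fromℕ zero    = ≤-refl
  0≤fromℕ (suc n) = 0≤x+y 0≤1 (0≤fromℕ n)

  fromℕ-mono : ∀ {m n} → m ℕ.≤ n → fromℕ m ≤ fromℕ n
  fromℕ-mono {n = n} ℕ.z≤n   = 0≤fromℕ n
  fromℕ-mono (ℕ.s≤s m≤n)     = +-mono-≤ ≤-refl (fromℕ-mono m≤n)

  0<fromℕ : ∀ {n} → 1 ℕ.≤ n → 0# < fromℕ n
  0<fromℕ 1≤n = <-≤-trans 0<1 (≤-respˡ-≈ (+-identityʳ 1#) (fromℕ-mono 1≤n))

  0<fromℕ-suc : ∀ n → 0# < fromℕ (suc n)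
  0<fromℕ-suc n = 0<fromℕ (ℕ.s≤s (ℕ.z≤n {n}))

  fromℕ-+ : ∀ m n → fromℕ (m ℕ.+ n) ≈ fromℕ m + fromℕ n
  fromℕ-+ = ×-homo-+ 1#

  fromℕ-* : ∀ m n → fromℕ (m ℕ.* n) ≈ fromℕ m * fromℕ n
  fromℕ-* = ×1-homo-*

  -- The Archimedean property, from completeness: let s be the supremum of the naturals up to x.
  -- Some such n exceeds s - 1, so n + 1 exceeds s and cannot lie below x, while n ≤ x bounds n + 1
  -- by x + 1.
  ceiling : ∀ {x} → 0# ≤ x → Σ[ n ∈ ℕ ] (x ≤ fromℕ n × fromℕ n ≤ x + 1#)
  ceiling {x} 0≤x = above (complete P (0# , 0 , refl , 0≤x) (x , bounded))
    where
    P : Carrier → Set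
    P y = Σ[ n ∈ ℕ ] (y ≈ fromℕ n × fromℕ n ≤ x)

    bounded : ∀ y → P y → y ≤ x
    bounded y (n , y≈n , n≤x) = ≤-respˡ-≈ (sym y≈n) n≤x

    above : Σ[ s ∈ Carrier ] IsSup P s → Σ[ n ∈ ℕ ] (x ≤ fromℕ n × fromℕ n ≤ x + 1#)
    above (s , upper , approx) = pick (approx (s - 1#) s-1<s)
      where
      s-1<s : s - 1# < s
      s-1<s = ≤-by-difference 0≤1 (solve 1 (λ s → s := s :- con (+ 1) :+ con (+ 1)) refl s) , λ e →
        0≉1 (begin-equality
          0#              ≈⟨ -‿inverseʳ s ⟨
          s - s           ≈⟨ +-congˡ (-‿cong e) ⟨
          s - (s - 1#)    ≈⟨ solve 1 (λ s → s :- (s :- con (+ 1)) := con (+ 1)) refl s ⟩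
          1#              ∎)

      pick : Σ[ y ∈ Carrier ] (P y × s - 1# < y) → Σ[ n ∈ ℕ ] (x ≤ fromℕ n × fromℕ n ≤ x + 1#)
      pick (y , (n , y≈n , n≤x) , s-1<y) = suc n , x≤1+n , ≤-respʳ-≈ (+-comm _ _) (+-mono-≤ ≤-refl n≤x)
        where
        s<1+n : s < fromℕ (suc n)
        s<1+n = ≰⇒> λ 1+n≤s → <⇒≱ s-1<y (≤-respˡ-≈ (sym y≈n)
          (≤-resp (solve 1 (λ n → con (+ 1) :+ n :- con (+ 1) := n) refl (fromℕ n)) refl
            (+-monoˡ-≤ (- 1#) 1+n≤s)))

        x≤1+n : x ≤ fromℕ (suc n)
        x≤1+n with x ≤? fromℕ (suc n)
        ... | yes p = p
        ... | no ¬p = contradiction (upper _ (suc n , refl , <⇒≤ (≰⇒> ¬p))) (<⇒≱ s<1+n)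

  sum-mono-≤ : ∀ {n} {f g : Vector Carrier n} → (∀ i → f i ≤ g i) → sum f ≤ sum g
  sum-mono-≤ {zero}  f≤g = ≤-refl
  sum-mono-≤ {suc n} f≤g = +-mono-≤ (f≤g zero) (sum-mono-≤ (λ i → f≤g (suc i)))

  sum-cong : ∀ {n} {f g : Vector Carrier n} → (∀ i → f i ≈ g i) → sum f ≈ sum g
  sum-cong = sum-cong-≋

  sum-const : ∀ n x → sum {n} (λ _ → x) ≈ fromℕ n * x
  sum-const zero    x = sym (zeroˡ x)
  sum-const (suc n) x = trans (+-congˡ (sum-const n x))
    (solve 2 (λ n x → x :+ n :* x := (con (+ 1) :+ n) :* x) refl (fromℕ n) x)

  0≤sum : ∀ {n} {f : Vector Carrier n} → (∀ i → 0# ≤ f i) → 0# ≤ sum f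
  0≤sum {n} {f} 0≤f = ≤-respˡ-≈ (trans (sum-const n 0#) (zeroʳ _)) (sum-mono-≤ 0≤f)

  sum-‿- : ∀ {n} (f g : Vector Carrier n) → sum (λ i → f i - g i) ≈ sum f - sum g
  sum-‿- f g = begin-equality
    sum (λ i → f i - g i)            ≈⟨ ∑-distrib-+ f (λ i → - g i) ⟩
    sum f + sum (λ i → - g i)        ≈⟨ +-congˡ (sum-cong (λ i → sym (-1*x≈-x (g i)))) ⟩
    sum f + sum (λ i → - 1# * g i)   ≈⟨ +-congˡ (*-distribˡ-sum (- 1#) g) ⟨
    sum f + - 1# * sum g             ≈⟨ +-congˡ (-1*x≈-x (sum g)) ⟩
    sum f - sum g                    ∎
    where open RingProperties ring using (-1*x≈-x)

  ∣sum∣≤sum∣∣ : ∀ {n} (f : Vector Carrier n) → ∣ sum f ∣ ≤ sum (λ i → ∣ f i ∣)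
  ∣sum∣≤sum∣∣ {zero}  f = ∣x∣≤y ≤-refl (≤-reflexive (solve 0 (:- con (+ 0) := con (+ 0)) refl))
  ∣sum∣≤sum∣∣ {suc n} f = ≤-trans (∣x+y∣≤∣x∣+∣y∣ _ _) (+-mono-≤ ≤-refl (∣sum∣≤sum∣∣ (λ i → f (suc i))))

  -- Grows at the end, whereas `sum` splits off its first summand; this is the shape needed for
  -- series and for loops that treat index n last.
  partialSum : (ℕ → Carrier) → ℕ → Carrier
  partialSum f zero    = 0#
  partialSum f (suc n) = partialSum f n + f n

  partialSum-cong : ∀ {f g} → (∀ i → f i ≈ g i) → ∀ n → partialSum f n ≈ partialSum g n
  partialSum-cong f≈g zero    = refl
  partialSum-cong f≈g (suc n) = +-cong (partialSum-cong f≈g n) (f≈g n)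

  partialSum-head : ∀ f n → partialSum f (suc n) ≈ f 0 + partialSum (λ i → f (suc i)) n
  partialSum-head f zero    = trans (+-identityˡ _) (sym (+-identityʳ _))
  partialSum-head f (suc n) = trans (+-congʳ (partialSum-head f n)) (+-assoc _ _ _)

  sum≈partialSum : ∀ f n → sum {n} (λ i → f (toℕ i)) ≈ partialSum f n
  sum≈partialSum f zero    = refl
  sum≈partialSum f (suc n) =
    trans (+-congˡ (sum≈partialSum (λ i → f (suc i)) n)) (sym (partialSum-head f n))

-- Square roots, norms and the Cauchy-Schwarz inequality.

module SquareRoot (R : RealField) where
  open OrderedField R public

  private
    -- The root is the supremum s of the y ≥ 0 with y² ≤ x. If s² < x, a slightly larger number
    -- still belongs to the set. If s² > x, the Newton iterate t lies below s but has t² ≥ x, so it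
    -- already bounds the set.
    exists-√ : ∀ {x} → 0# ≤ x → Σ[ y ∈ Carrier ] (0# ≤ y × y * y ≈ x)
    exists-√ {x} 0≤x = s , 0≤s , ss≈x
      where
      P : Carrier → Set
      P y = 0# ≤ y × y * y ≤ x

      bounded : ∀ y → P y → y ≤ x + 1#
      bounded y (0≤y , yy≤x) = square-cancel-≤ (0≤x+y 0≤x 0≤1) (≤-trans yy≤x
        (≤-by-difference (0≤x+y (0≤x+y 0≤x (0≤x*x x)) 0≤1)
          (solve 1 (λ x → (x :+ con (+ 1)) :* (x :+ con (+ 1)) := x :+ (x :+ x :* x :+ con (+ 1)))
            refl x)))

      supremum = complete P
        (0# , ≤-refl , ≤-respˡ-≈ (sym (zeroˡ 0#)) 0≤x) (x + 1# , bounded)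
      s = proj₁ supremum
      upper = proj₁ (proj₂ supremum)
      approx = proj₂ (proj₂ supremum)

      0≤s : 0# ≤ s
      0≤s = upper 0# (≤-refl , ≤-respˡ-≈ (sym (zeroˡ 0#)) 0≤x)

      x≤ss : x ≤ s * s
      x≤ss with x ≤? s * s
      ... | yes p = p
      ... | no ¬p = contradiction (upper (s + h) (0≤x+y 0≤s 0≤h , [s+h]²≤x)) λ s+h≤s →
              <⇒≱ 0<h (≤-resp (solve 2 (λ s h → :- s :+ (s :+ h) := h) refl s h) (-‿inverseˡ s)
                (+-mono-≤ ≤-refl s+h≤s))
        where
        δ = x - s * s
        0<δ : 0# < δ
        0<δ = x<y⇒0<y-x (≰⇒> ¬p)
        -- The summand δ forces h ≤ 1, hence h² ≤ h, and then (s + h)² ≤ s² + h (2s + 1) ≤ s² + h m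
        -- = x.
        m = s + s + 1# + δ
        0<m : 0# < m
        0<m = <-≤-trans 0<δ (≤-by-difference (0≤x+y (0≤x+y 0≤s 0≤s) 0≤1) (+-comm _ _))
        h = δ / m
        0<h : 0# < h
        0<h = 0<x*y 0<δ (0<x⇒0<x⁻¹ 0<m)
        0≤h = <⇒≤ 0<h
        hm≈δ : h * m ≈ δ
        hm≈δ = x/y*y≈x δ (0<⇒≉0 0<m)
        h≤1 : h ≤ 1#
        h≤1 = x≤y*z⇒x/z≤y 0<m (≤-by-difference (0≤x+y (0≤x+y 0≤s 0≤s) 0≤1)
          (solve 2 (λ s d → con (+ 1) :* (s :+ s :+ con (+ 1) :+ d) := d :+ (s :+ s :+ con (+ 1))) refl s δ))
        [s+h]²≤x : (s + h) * (s + h) ≤ x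
        [s+h]²≤x = begin
          (s + h) * (s + h)
            ≈⟨ solve 2 (λ s h → (s :+ h) :* (s :+ h) := s :* s :+ (h :* (s :+ s) :+ h :* h)) refl s h ⟩
          s * s + (h * (s + s) + h * h)
            ≤⟨ +-mono-≤ ≤-refl (+-mono-≤ ≤-refl (*-monoʳ-≤ 0≤h h≤1)) ⟩
          s * s + (h * (s + s) + h * 1#)
            ≤⟨ ≤-by-difference (*-nonneg 0≤h (<⇒≤ 0<δ))
                 (solve 3 (λ s h d → s :* s :+ h :* (s :+ s :+ con (+ 1) :+ d)
                    := s :* s :+ (h :* (s :+ s) :+ h :* con (+ 1)) :+ h :* d) refl s h δ) ⟩
          s * s + h * m
            ≈⟨ +-congˡ hm≈δ ⟩
          s * s + (x - s * s)
            ≈⟨ solve 2 (λ a x → a :+ (x :- a) := x) refl (s * s) x ⟩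
          x ∎

      ss≤x : s * s ≤ x
      ss≤x with s * s ≤? x
      ... | yes p = p
      ... | no ¬p = contradiction y≤t (<⇒≱ t<y)
        where
        0<s : 0# < s
        0<s = 0≤s , λ 0≈s → ¬p (≤-respˡ-≈ (trans (sym (zeroˡ s)) (*-congʳ 0≈s)) 0≤x)
        0<2s : 0# < s + s
        0<2s = <-≤-trans 0<s (≤-by-difference 0≤s refl)
        -- One Newton step from s.
        t = (s * s + x) / (s + s)
        t2s : t * (s + s) ≈ s * s + x
        t2s = x/y*y≈x _ (0<⇒≉0 0<2s)
        0≤t : 0# ≤ t
        0≤t = *-nonneg (0≤x+y (0≤x*x s) 0≤x) (0<x⇒0≤x⁻¹ 0<2s)
        t<s : t < s
        t<s = ≰⇒> λ s≤t → ¬p (≤-resp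
          (solve 1 (λ s → s :* (s :+ s) :- s :* s := s :* s) refl s)
          (trans (+-congʳ t2s) (solve 2 (λ a x → a :+ x :- a := x) refl (s * s) x))
          (+-monoˡ-≤ (- (s * s)) (*-monoˡ-≤ (<⇒≤ 0<2s) s≤t)))
        x≤tt : x ≤ t * t
        x≤tt = ≤-by-difference (0≤x*x (s - t)) (begin-equality
          t * t                               ≈⟨ solve 3 (λ s t x → t :* t := x :+ (t :* t :+ (s :* s :- (s :* s :+ x)))) refl s t x ⟩
          x + (t * t + (s * s - (s * s + x))) ≈⟨ +-congˡ (+-congˡ (+-congˡ (-‿cong t2s))) ⟨
          x + (t * t + (s * s - t * (s + s))) ≈⟨ solve 3 (λ s t x → x :+ (t :* t :+ (s :* s :- t :* (s :+ s))) := x :+ (s :- t) :* (s :- t)) refl s t x ⟩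
          x + (s - t) * (s - t)               ∎)
        larger = approx t t<s
        y = proj₁ larger
        t<y = proj₂ (proj₂ larger)
        y≤t : y ≤ t
        y≤t = square-cancel-≤ 0≤t (≤-trans (proj₂ (proj₁ (proj₂ larger))) x≤tt)

      ss≈x : s * s ≈ x
      ss≈x = antisym ss≤x x≤ss

    √-spec : ∀ {x} → 0# ≤ x → 0# ≤ √ x × √ x * √ x ≈ x
    √-spec {x} 0≤x with em {Σ[ y ∈ Carrier ] (0# ≤ y × y * y ≈ x)}
    ... | yes (y , spec) = spec
    ... | no ¬∃          = contradiction (exists-√ 0≤x) ¬∃

  0≤√ : ∀ {x} → 0# ≤ x → 0# ≤ √ x
  0≤√ 0≤x = proj₁ (√-spec 0≤x)

  √x*√x≈x : ∀ {x} → 0# ≤ x → √ x * √ x ≈ x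
  √x*√x≈x 0≤x = proj₂ (√-spec 0≤x)

  √x≤y : ∀ {x y} → 0# ≤ x → 0# ≤ y → x ≤ y * y → √ x ≤ y
  √x≤y 0≤x 0≤y x≤yy = square-cancel-≤ 0≤y (≤-respˡ-≈ (sym (√x*√x≈x 0≤x)) x≤yy)

  1≤√ : ∀ {x} → 1# ≤ x → 1# ≤ √ x
  1≤√ 1≤x = square-cancel-≤ (0≤√ 0≤x) (≤-resp (sym (*-identityˡ 1#)) (sym (√x*√x≈x 0≤x)) 1≤x)
    where 0≤x = ≤-trans 0≤1 1≤x

  0≤x∙x : ∀ {d} (x : Vector Carrier d) → 0# ≤ x ∙ x
  0≤x∙x x = 0≤sum (λ j → 0≤x*x (x j))

  0≤‖x‖ : ∀ {d} (x : Vector Carrier d) → 0# ≤ ‖ x ‖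
  0≤‖x‖ x = 0≤√ (0≤x∙x x)

  ‖x‖≤ρ⇒x∙x≤ρ² : ∀ {d} (x : Vector Carrier d) {ρ} → ‖ x ‖ ≤ ρ → x ∙ x ≤ ρ * ρ
  ‖x‖≤ρ⇒x∙x≤ρ² x {ρ} ‖x‖≤ρ = ≤-respˡ-≈ (√x*√x≈x (0≤x∙x x))
    (*-mono-≤ (0≤‖x‖ x) (≤-trans (0≤‖x‖ x) ‖x‖≤ρ) ‖x‖≤ρ ‖x‖≤ρ)

  -- Expands 0 ≤ ‖x - b y‖² with b = x ∙ y. The hypothesis ‖y‖ ≤ 1 makes this b good enough, so
  -- there is no division by y ∙ y and no separate case y = 0.
  ∣x∙y∣≤ρ : ∀ {d} (x y : Vector Carrier d) {ρ} → ‖ x ‖ ≤ ρ → ‖ y ‖ ≤ 1# → ∣ x ∙ y ∣ ≤ ρ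
  ∣x∙y∣≤ρ x y {ρ} ‖x‖≤ρ ‖y‖≤1 =
    square-cancel-≤ (≤-trans (0≤‖x‖ x) ‖x‖≤ρ) (≤-respˡ-≈ (sym (∣x∣*∣x∣≈x*x b)) bb≤ρρ)
    where
    b = x ∙ y

    expand : sum (λ j → (x j - b * y j) * (x j - b * y j)) ≈ (x ∙ x - (b + b) * b) + (b * b) * (y ∙ y)
    expand = begin-equality
      sum (λ j → (x j - b * y j) * (x j - b * y j))
        ≈⟨ sum-cong (λ j → solve 3 (λ x y b → (x :- b :* y) :* (x :- b :* y)
             := (x :* x :- (b :+ b) :* (x :* y)) :+ (b :* b) :* (y :* y)) refl (x j) (y j) b) ⟩
      sum (λ j → (x j * x j - (b + b) * (x j * y j)) + (b * b) * (y j * y j))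
        ≈⟨ ∑-distrib-+ (λ j → x j * x j - (b + b) * (x j * y j)) (λ j → (b * b) * (y j * y j)) ⟩
      sum (λ j → x j * x j - (b + b) * (x j * y j)) + sum (λ j → (b * b) * (y j * y j))
        ≈⟨ +-cong (sum-‿- (λ j → x j * x j) (λ j → (b + b) * (x j * y j)))
             (sym (*-distribˡ-sum (b * b) (λ j → y j * y j))) ⟩
      (x ∙ x - sum (λ j → (b + b) * (x j * y j))) + (b * b) * (y ∙ y)
        ≈⟨ +-congʳ (+-congˡ (-‿cong (*-distribˡ-sum (b + b) (λ j → x j * y j)))) ⟨
      (x ∙ x - (b + b) * b) + (b * b) * (y ∙ y) ∎

    y∙y≤1 : y ∙ y ≤ 1#
    y∙y≤1 = ≤-respʳ-≈ (*-identityʳ 1#) (‖x‖≤ρ⇒x∙x≤ρ² y ‖y‖≤1)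

    bb≤ρρ : b * b ≤ ρ * ρ
    bb≤ρρ = 0≤y-x⇒x≤y (begin
      0#
        ≤⟨ 0≤sum (λ j → 0≤x*x (x j - b * y j)) ⟩
      sum (λ j → (x j - b * y j) * (x j - b * y j))
        ≈⟨ expand ⟩
      (x ∙ x - (b + b) * b) + (b * b) * (y ∙ y)
        ≤⟨ +-mono-≤ (+-mono-≤ (‖x‖≤ρ⇒x∙x≤ρ² x ‖x‖≤ρ) ≤-refl) (*-monoʳ-≤ (0≤x*x b) y∙y≤1) ⟩
      (ρ * ρ - (b + b) * b) + (b * b) * 1#
        ≈⟨ solve 2 (λ ρ b → (ρ :* ρ :- (b :+ b) :* b) :+ (b :* b) :* con (+ 1) := ρ :* ρ :- b :* b) refl ρ b ⟩
      ρ * ρ - b * b ∎)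

-- Limits of sequences.

module Limits (R : RealField) where
  open SquareRoot R public

  half : Carrier → Carrier
  half x = x / (1# + 1#)

  0<2 : 0# < 1# + 1#
  0<2 = <-≤-trans 0<1 (x≤x+1 1#)

  half+half : ∀ x → half x + half x ≈ x
  half+half x = trans
    (solve 2 (λ x i → x :* i :+ x :* i := x :* i :* (con (+ 1) :+ con (+ 1))) refl x ((1# + 1#) ⁻¹))
    (x/y*y≈x x (0<⇒≉0 0<2))

  0<half : ∀ {x} → 0# < x → 0# < half x
  0<half 0<x = 0<x*y 0<x (0<x⇒0<x⁻¹ 0<2)

  +-mono-< : ∀ {x y u v} → x < y → u < v → x + u < y + v
  +-mono-< {x} {y} {u} {v} x<y u<v = from-difference (<-≤-trans (x<y⇒0<y-x x<y)
    (≤-by-difference (<⇒≤ (x<y⇒0<y-x u<v)) refl))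
    where
    from-difference : 0# < (y - x) + (v - u) → x + u < y + v
    from-difference (0≤d , 0≉d) =
      ≤-by-difference 0≤d (solve 4 (λ x y u v → y :+ v := x :+ u :+ ((y :- x) :+ (v :- u))) refl x y u v)
      , λ e → 0≉d (begin-equality
        0#                   ≈⟨ -‿inverseʳ (x + u) ⟨
        x + u - (x + u)      ≈⟨ +-congʳ e ⟩
        y + v - (x + u)      ≈⟨ solve 4 (λ x y u v → y :+ v :- (x :+ u) := (y :- x) :+ (v :- u)) refl x y u v ⟩
        (y - x) + (v - u)    ∎)

  converges-cong : ∀ {s t l} → (∀ n → s n ≈ t n) → ConvergesTo s l → ConvergesTo t l
  converges-cong s≈t s→l ε 0<ε = proj₁ (s→l ε 0<ε) , λ n N≤n →
    ≤-<-trans (≤-reflexive (∣∣-cong (+-congʳ (sym (s≈t n))))) (proj₂ (s→l ε 0<ε) n N≤n)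

  converges-limit-cong : ∀ {s l m} → l ≈ m → ConvergesTo s l → ConvergesTo s m
  converges-limit-cong l≈m s→l ε 0<ε = proj₁ (s→l ε 0<ε) , λ n N≤n →
    ≤-<-trans (≤-reflexive (∣∣-cong (+-congˡ (-‿cong (sym l≈m))))) (proj₂ (s→l ε 0<ε) n N≤n)

  converges-const : ∀ l → ConvergesTo (λ _ → l) l
  converges-const l ε 0<ε = 0 , λ n _ → ≤-<-trans
    (≤-reflexive (trans (0≤x⇒∣x∣≈x (≤-reflexive (sym (-‿inverseʳ l)))) (-‿inverseʳ l))) 0<ε

  converges-subsequence : ∀ {s l} (k : ℕ → ℕ) → (∀ n → n ℕ.≤ k n) →
                          ConvergesTo s l → ConvergesTo (λ n → s (k n)) l
  converges-subsequence k n≤k s→l ε 0<ε = proj₁ (s→l ε 0<ε) , λ n N≤n →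
    proj₂ (s→l ε 0<ε) (k n) (ℕₚ.≤-trans N≤n (n≤k n))

  converges-+ : ∀ {s t l m} → ConvergesTo s l → ConvergesTo t m →
                ConvergesTo (λ n → s n + t n) (l + m)
  converges-+ {s} {t} {l} {m} s→l t→m ε 0<ε = N₁ ℕ.⊔ N₂ , λ n N≤n → ≤-<-trans
    (≤-trans
      (≤-reflexive (∣∣-cong (solve 4 (λ s t l m → s :+ t :- (l :+ m) := (s :- l) :+ (t :- m)) refl
        (s n) (t n) l m)))
      (∣x+y∣≤∣x∣+∣y∣ (s n - l) (t n - m)))
    (<-≤-trans
      (+-mono-< (proj₂ s-close n (ℕₚ.≤-trans (ℕₚ.m≤m⊔n N₁ N₂) N≤n))
                (proj₂ t-close n (ℕₚ.≤-trans (ℕₚ.m≤n⊔m N₁ N₂) N≤n)))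
      (≤-reflexive (half+half ε)))
    where
    s-close = s→l (half ε) (0<half 0<ε)
    t-close = t→m (half ε) (0<half 0<ε)
    N₁ = proj₁ s-close
    N₂ = proj₁ t-close

  converges-* : ∀ {s l} c → ConvergesTo s l → ConvergesTo (λ n → c * s n) (c * l)
  converges-* {s} {l} c s→l ε 0<ε = proj₁ close , λ n N≤n → ≤-<-trans
    (begin
      ∣ c * s n - c * l ∣
        ≈⟨ ∣∣-cong (solve 3 (λ c s l → c :* s :- c :* l := c :* (s :- l)) refl c (s n) l) ⟩
      ∣ c * (s n - l) ∣
        ≤⟨ ∣x*y∣≤∣x∣*∣y∣ c (s n - l) ⟩
      ∣ c ∣ * ∣ s n - l ∣
        ≤⟨ *-monoʳ-≤ (0≤∣x∣ c) (<⇒≤ (proj₂ close n N≤n)) ⟩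
      ∣ c ∣ * δ
        ≈⟨ +-identityʳ _ ⟨
      ∣ c ∣ * δ + 0# ∎)
    (<-≤-trans (≤-<-+ 0<δ) (≤-reflexive (trans
      (solve 2 (λ c d → c :* d :+ d := d :* (c :+ con (+ 1))) refl ∣ c ∣ δ)
      (x/y*y≈x ε (0<⇒≉0 0<m)))))
    where
    -- The added `1#` keeps the divisor positive when c is zero and makes ∣c∣ δ strictly smaller
    -- than ε.
    m = ∣ c ∣ + 1#
    0<m : 0# < m
    0<m = <-≤-trans 0<1 (≤-by-difference (0≤∣x∣ c) (+-comm _ _))
    δ = ε / m
    0<δ : 0# < δ
    0<δ = 0<x*y 0<ε (0<x⇒0<x⁻¹ 0<m)
    close = s→l δ 0<δ
    ≤-<-+ : ∀ {x y} → 0# < y → x + 0# < x + y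
    ≤-<-+ {x} {y} 0<y = +-mono-≤ ≤-refl (<⇒≤ 0<y) , λ e → 0<⇒≉0 0<y (begin-equality
      y               ≈⟨ solve 2 (λ x y → y := x :+ y :- x) refl x y ⟩
      x + y - x       ≈⟨ +-congʳ e ⟨
      x + 0# - x      ≈⟨ solve 1 (λ x → x :+ con (+ 0) :- x := con (+ 0)) refl x ⟩
      0#              ∎)

  converges-‿- : ∀ {s t l m} → ConvergesTo s l → ConvergesTo t m →
                 ConvergesTo (λ n → s n - t n) (l - m)
  converges-‿- {l = l} {m} s→l t→m ε 0<ε = proj₁ close , λ n N≤n → ≤-<-trans
    (≤-reflexive (∣∣-cong (+-cong (+-congˡ (sym (-1*x≈-x _))) (-‿cong (+-congˡ (sym (-1*x≈-x m)))))))
    (proj₂ close n N≤n)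
    where
    open RingProperties ring using (-1*x≈-x)
    close = converges-+ s→l (converges-* (- 1#) t→m) ε 0<ε

  limit-nonneg : ∀ {s l} → (∀ n → 0# ≤ s n) → ConvergesTo s l → 0# ≤ l
  limit-nonneg {s} {l} 0≤s s→l with 0# ≤? l
  ... | yes 0≤l = 0≤l
  ... | no  0≰l = contradiction (begin
      - l             ≤⟨ ≤-by-difference (0≤s N) (+-comm _ _) ⟩
      s N - l         ≤⟨ x≤∣x∣ (s N - l) ⟩
      ∣ s N - l ∣     ∎) (<⇒≱ (proj₂ close N ℕₚ.≤-refl))
    where
    l<0 = ≰⇒> 0≰l
    0<-l : 0# < - l
    0<-l = <-≤-trans (x<y⇒0<y-x l<0) (≤-reflexive (+-identityˡ (- l)))
    close = s→l (- l) 0<-l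
    N = proj₁ close

  limit-mono : ∀ {s t l m} → (∀ n → s n ≤ t n) → ConvergesTo s l → ConvergesTo t m → l ≤ m
  limit-mono s≤t s→l t→m =
    0≤y-x⇒x≤y (limit-nonneg (λ n → x≤y⇒0≤y-x (s≤t n)) (converges-‿- t→m s→l))

  limit-unique : ∀ {s l m} → ConvergesTo s l → ConvergesTo s m → l ≈ m
  limit-unique s→l s→m =
    antisym (limit-mono (λ _ → ≤-refl) s→l s→m) (limit-mono (λ _ → ≤-refl) s→m s→l)

  -- Any known limit excludes the default branch of `lim`, so convergence has to be exhibited before
  -- `lim` says anything.
  converges-lim : ∀ {s l} → ConvergesTo s l → ConvergesTo s (lim s)
  converges-lim {s} {l} s→l with em {Σ[ l ∈ Carrier ] ConvergesTo s l}
  ... | yes (_ , s→m) = s→m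
  ... | no ¬converges = contradiction (l , s→l) ¬converges

  monotone-converges : ∀ {s b} → (∀ n → s n ≤ s (suc n)) → (∀ n → s n ≤ b) →
                       Σ[ l ∈ Carrier ] ConvergesTo s l
  monotone-converges {s} {b} s↑ s≤b = l , s→l
    where
    P : Carrier → Set
    P y = Σ[ n ∈ ℕ ] y ≈ s n

    supremum = complete P (s 0 , 0 , refl)
      (b , λ y (n , y≈sn) → ≤-respˡ-≈ (sym y≈sn) (s≤b n))
    l = proj₁ supremum

    s≤l : ∀ n → s n ≤ l
    s≤l n = proj₁ (proj₂ supremum) (s n) (n , refl)

    monotone : ∀ {m n} → m ℕ.≤′ n → s m ≤ s n
    monotone (ℕ.≤′-reflexive ≡.refl) = ≤-refl
    monotone (ℕ.≤′-step m≤n) = ≤-trans (monotone m≤n) (s↑ _)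

    s→l : ConvergesTo s l
    s→l ε 0<ε = N , λ n N≤n → ≤-<-trans
      (begin
        ∣ s n - l ∣   ≈⟨ ∣-x∣≈∣x∣ _ ⟨
        ∣ - (s n - l) ∣ ≈⟨ ∣∣-cong (solve 2 (λ s l → :- (s :- l) := l :- s) refl (s n) l) ⟩
        ∣ l - s n ∣   ≈⟨ 0≤x⇒∣x∣≈x (x≤y⇒0≤y-x (s≤l n)) ⟩
        l - s n       ∎)
      (≰⇒> λ ε≤l-sn → <⇒≱ l-ε<sN (≤-trans (monotone (ℕₚ.≤⇒≤′ N≤n))
        (0≤y-x⇒x≤y (≤-respʳ-≈ (solve 3 (λ l s e → l :- s :- e := l :- e :- s) refl l (s n) ε)
          (x≤y⇒0≤y-x ε≤l-sn)))))
      where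
      l-ε<l : l - ε < l
      l-ε<l = ≤-by-difference (<⇒≤ 0<ε) (solve 2 (λ l e → l := l :- e :+ e) refl l ε) , λ e →
        0<⇒≉0 0<ε (begin-equality
          ε               ≈⟨ solve 2 (λ l e → e := l :- (l :- e)) refl l ε ⟩
          l - (l - ε)     ≈⟨ +-congˡ (-‿cong e) ⟩
          l - l           ≈⟨ -‿inverseʳ l ⟩
          0#              ∎)

      exceeding = proj₂ (proj₂ supremum) (l - ε) l-ε<l
      N = proj₁ (proj₁ (proj₂ exceeding))
      l-ε<sN : l - ε < s N
      l-ε<sN = <-≤-trans (proj₂ (proj₂ exceeding)) (≤-reflexive (proj₂ (proj₁ (proj₂ exceeding))))

-- The exponential series: convergence, inverse and the tangent-line bound.

module Exponential (R : RealField) where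
  open Limits R public
  open import Algebra.Properties.Semiring.Exp semiring using (^-congˡ)

  term : Carrier → ℕ → Carrier
  term x n = x ^ n / fromℕ (n !)

  partialExp : Carrier → ℕ → Carrier
  partialExp x = partialSum (term x)

  0<n! : ∀ n → 0# < fromℕ (n !)
  0<n! n = 0<fromℕ (ℕₚ.1≤n! n)

  term-cong : ∀ {x y} → x ≈ y → ∀ n → term x n ≈ term y n
  term-cong x≈y n = *-congʳ (^-congˡ n x≈y)

  term-0 : ∀ x → term x 0 ≈ 1#
  term-0 x = begin-equality
    1# * (1# + 0#) ⁻¹           ≈⟨ *-congˡ (⁻¹-cong (+-identityʳ 1#)) ⟩
    1# * 1# ⁻¹                  ≈⟨ ⁻¹-inverseʳ (0<⇒≉0 0<1) ⟩
    1#                          ∎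

  -- The recurrence of the terms in division-free form; later identities between products of terms
  -- use it in place of factorials.
  term-suc : ∀ x n → term x (suc n) * fromℕ (suc n) ≈ x * term x n
  term-suc x n = *-cancelʳ-≈ (0<⇒≉0 (0<n! n)) (begin-equality
    term x (suc n) * fromℕ (suc n) * fromℕ (n !)     ≈⟨ *-assoc _ _ _ ⟩
    term x (suc n) * (fromℕ (suc n) * fromℕ (n !))   ≈⟨ *-congˡ (fromℕ-* (suc n) (n !)) ⟨
    term x (suc n) * fromℕ (suc n !)                 ≈⟨ x/y*y≈x _ (0<⇒≉0 (0<n! (suc n))) ⟩
    x * x ^ n                                        ≈⟨ *-congˡ (x/y*y≈x (x ^ n) (0<⇒≉0 (0<n! n))) ⟨
    x * (term x n * fromℕ (n !))                     ≈⟨ *-assoc _ _ _ ⟨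
    x * term x n * fromℕ (n !)                       ∎)

  term-1 : ∀ x → term x 1 ≈ x
  term-1 x = *-cancelʳ-≈ (0<⇒≉0 (0<fromℕ-suc 0)) (begin-equality
    term x 1 * fromℕ 1   ≈⟨ term-suc x 0 ⟩
    x * term x 0         ≈⟨ *-congˡ (term-0 x) ⟩
    x * 1#               ≈⟨ *-congˡ (+-identityʳ 1#) ⟨
    x * fromℕ 1          ∎)

  0≤^ : ∀ {x} → 0# ≤ x → ∀ n → 0# ≤ x ^ n
  0≤^ 0≤x zero    = 0≤1
  0≤^ 0≤x (suc n) = *-nonneg 0≤x (0≤^ 0≤x n)

  0≤term : ∀ {x} → 0# ≤ x → ∀ n → 0# ≤ term x n
  0≤term 0≤x n = *-nonneg (0≤^ 0≤x n) (0<x⇒0≤x⁻¹ (0<n! n))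

  ∣x^n∣≤y^n : ∀ {x y} → ∣ x ∣ ≤ y → ∀ n → ∣ x ^ n ∣ ≤ y ^ n
  ∣x^n∣≤y^n ∣x∣≤y zero = ≤-reflexive (0≤x⇒∣x∣≈x 0≤1)
  ∣x^n∣≤y^n {x} {y} ∣x∣≤y (suc n) = ≤-trans (∣x*y∣≤∣x∣*∣y∣ x (x ^ n))
    (*-mono-≤ (0≤∣x∣ (x ^ n)) (≤-trans (0≤∣x∣ x) ∣x∣≤y) ∣x∣≤y (∣x^n∣≤y^n ∣x∣≤y n))

  term-mono : ∀ {x y} → ∣ x ∣ ≤ y → ∀ n → term x n ≤ term y n
  term-mono ∣x∣≤y n = *-monoˡ-≤ (0<x⇒0≤x⁻¹ (0<n! n)) (≤-trans (x≤∣x∣ _) (∣x^n∣≤y^n ∣x∣≤y n))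

  -term-mono : ∀ {x y} → ∣ x ∣ ≤ y → ∀ n → - term x n ≤ term y n
  -term-mono {x} ∣x∣≤y n = ≤-respˡ-≈ (solve 2 (λ a i → :- a :* i := :- (a :* i)) refl (x ^ n) (fromℕ (n !) ⁻¹))
    (*-monoˡ-≤ (0<x⇒0≤x⁻¹ (0<n! n)) (≤-trans (-x≤∣x∣ _) (∣x^n∣≤y^n ∣x∣≤y n)))

  partialSum-mono : ∀ {f g} → (∀ i → f i ≤ g i) → ∀ n → partialSum f n ≤ partialSum g n
  partialSum-mono f≤g zero    = ≤-refl
  partialSum-mono f≤g (suc n) = +-mono-≤ (partialSum-mono f≤g n) (f≤g n)

  0≤partialSum : ∀ {f} → (∀ i → 0# ≤ f i) → ∀ n → 0# ≤ partialSum f n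
  0≤partialSum 0≤f zero    = ≤-refl
  0≤partialSum 0≤f (suc n) = 0≤x+y (0≤partialSum 0≤f n) (0≤f n)

  partialExp-increasing : ∀ {x} → 0# ≤ x → ∀ n → partialExp x n ≤ partialExp x (suc n)
  partialExp-increasing 0≤x n = ≤-by-difference (0≤term 0≤x n) refl

  -- Beyond K ≥ 2x the terms at least halve, so partialExp x n + 2 term x n decreases.
  partialExp-bounded : ∀ {x} → 0# ≤ x → Σ[ b ∈ Carrier ] (∀ n → partialExp x n ≤ b)
  partialExp-bounded {x} 0≤x = f 0 , bound
    where
    K-spec = ceiling (0≤x+y 0≤x 0≤x)
    K = proj₁ K-spec

    f : ℕ → Carrier
    f n = partialExp x (n ℕ.+ K) + (term x (n ℕ.+ K) + term x (n ℕ.+ K))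

    halving : ∀ n → term x (suc n ℕ.+ K) + term x (suc n ℕ.+ K) ≤ term x (n ℕ.+ K)
    halving n = *-cancelʳ-≤ (0<fromℕ-suc (n ℕ.+ K)) (begin
      (t + t) * N                 ≈⟨ solve 2 (λ t n → (t :+ t) :* n := t :* n :+ t :* n) refl t N ⟩
      t * N + t * N               ≈⟨ +-cong (term-suc x (n ℕ.+ K)) (term-suc x (n ℕ.+ K)) ⟩
      x * u + x * u               ≈⟨ solve 2 (λ x u → x :* u :+ x :* u := u :* (x :+ x)) refl x u ⟩
      u * (x + x)                 ≤⟨ *-monoʳ-≤ (0≤term 0≤x (n ℕ.+ K)) (≤-trans (proj₁ (proj₂ K-spec))
                                       (fromℕ-mono (ℕₚ.m≤n+m K (suc n)))) ⟩
      u * N                       ∎)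
      where
      t = term x (suc n ℕ.+ K)
      u = term x (n ℕ.+ K)
      N = fromℕ (suc n ℕ.+ K)

    f-decreasing : ∀ n → f n ≤ f 0
    f-decreasing zero    = ≤-refl
    f-decreasing (suc n) = ≤-trans
      (≤-respʳ-≈ (+-assoc _ _ _) (+-mono-≤ ≤-refl (halving n))) (f-decreasing n)

    monotone : ∀ n k → partialExp x n ≤ partialExp x (k ℕ.+ n)
    monotone n zero    = ≤-refl
    monotone n (suc k) = ≤-trans (monotone n k) (partialExp-increasing 0≤x (k ℕ.+ n))

    bound : ∀ n → partialExp x n ≤ f 0
    bound n = begin
      partialExp x n           ≤⟨ monotone n K ⟩
      partialExp x (K ℕ.+ n)   ≡⟨ ≡.cong (partialExp x) (ℕₚ.+-comm K n) ⟩
      partialExp x (n ℕ.+ K)   ≤⟨ ≤-by-difference (0≤x+y (0≤term 0≤x (n ℕ.+ K)) (0≤term 0≤x (n ℕ.+ K))) refl ⟩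
      f n                      ≤⟨ f-decreasing n ⟩
      f 0                      ∎

  private
    -- For x of either sign the partial sums are those at ∣x∣ minus a gap. Both sequences increase
    -- and are bounded, since each term at x is at most the term at ∣x∣ in absolute value; monotone
    -- convergence thus replaces a Cauchy criterion.
    partialExp-converges : ∀ x → Σ[ l ∈ Carrier ] ConvergesTo (partialExp x) l
    partialExp-converges x = proj₁ upper - proj₁ gap , converges-cong
      (λ n → solve 2 (λ u e → u :- (u :- e) := e) refl (partialExp a n) (partialExp x n))
      (converges-‿- (proj₂ upper) (proj₂ gap))
      where
      a = ∣ x ∣
      0≤a = 0≤∣x∣ x
      bound = proj₂ (partialExp-bounded 0≤a)
      upper = monotone-converges (partialExp-increasing 0≤a) bound
      gap = monotone-converges {λ n → partialExp a n - partialExp x n}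
        {proj₁ (partialExp-bounded 0≤a) + proj₁ (partialExp-bounded 0≤a)}
        (λ n → ≤-by-difference (x≤y⇒0≤y-x (term-mono {x} ≤-refl n))
          (solve 4 (λ u e s t → (u :+ s) :- (e :+ t) := u :- e :+ (s :- t)) refl _ _ _ _))
        (λ n → ≤-trans (≤-by-difference (negated n)
            (solve 2 (λ u e → u :+ u := u :- e :+ (u :- (:- e))) refl (partialExp a n) (partialExp x n)))
          (+-mono-≤ (bound n) (bound n)))
        where
        negated : ∀ n → 0# ≤ partialExp a n - (- partialExp x n)
        negated zero    = ≤-reflexive (solve 0 (con (+ 0) := con (+ 0) :- (:- con (+ 0))) refl)
        negated (suc n) = ≤-respʳ-≈
          (solve 4 (λ u e s t → (u :- (:- e)) :+ (s :- (:- t)) := (u :+ s) :- (:- (e :+ t))) refl _ _ _ _)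
          (0≤x+y (negated n) (x≤y⇒0≤y-x (-term-mono {x} ≤-refl n)))

  partialExp→exp : ∀ x → ConvergesTo (partialExp x) (exp x)
  partialExp→exp x = converges-cong (sum≈partialSum (term x))
    (converges-lim (converges-cong (λ n → sym (sum≈partialSum (term x) n)) (proj₂ (partialExp-converges x))))

  exp-cong : ∀ {x y} → x ≈ y → exp x ≈ exp y
  exp-cong {x} {y} x≈y = limit-unique
    (converges-cong (partialSum-cong (term-cong x≈y)) (partialExp→exp x)) (partialExp→exp y)

  -- Termwise comparison through x^n ≤ ∣x∣^n ≤ y^n. With Cauchy-Schwarz it turns ∣q ∙ k∣ ≤ ρ into
  -- the bound e^ρ on a kernel.
  ∣x∣≤y⇒exp[x]≤exp[y] : ∀ {x y} → ∣ x ∣ ≤ y → exp x ≤ exp y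
  ∣x∣≤y⇒exp[x]≤exp[y] {x} {y} ∣x∣≤y = limit-mono
    (partialSum-mono (term-mono ∣x∣≤y)) (partialExp→exp x) (partialExp→exp y)

  partialExp-2 : ∀ x → partialExp x 2 ≈ 1# + x
  partialExp-2 x = +-cong (trans (+-identityˡ _) (term-0 x)) (term-1 x)

  0≤x⇒1+x≤exp[x] : ∀ {x} → 0# ≤ x → 1# + x ≤ exp x
  0≤x⇒1+x≤exp[x] {x} 0≤x = limit-mono above (converges-const (1# + x))
    (converges-subsequence (ℕ._+ 2) (λ n → ℕₚ.m≤m+n n 2) (partialExp→exp x))
    where
    above : ∀ n → 1# + x ≤ partialExp x (n ℕ.+ 2)
    above zero    = ≤-reflexive (sym (partialExp-2 x))
    above (suc n) = ≤-trans (above n) (partialExp-increasing 0≤x (n ℕ.+ 2))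

  private
    alt : ℕ → Carrier
    alt n = (- 1#) ^ n

    alt-even : ∀ n → alt (n ℕ.+ n) ≈ 1#
    alt-even zero    = refl
    alt-even (suc n) = begin-equality
      - 1# * alt (n ℕ.+ suc n)     ≡⟨ ≡.cong (λ k → - 1# * alt k) (ℕₚ.+-suc n n) ⟩
      - 1# * (- 1# * alt (n ℕ.+ n)) ≈⟨ solve 1 (λ a → :- con (+ 1) :* (:- con (+ 1) :* a) := a) refl _ ⟩
      alt (n ℕ.+ n)                ≈⟨ alt-even n ⟩
      1#                           ∎

    term-neg : ∀ x n → term (- x) n ≈ alt n * term x n
    term-neg x n = trans (*-congʳ (power n)) (*-assoc _ _ _)
      where
      power : ∀ n → (- x) ^ n ≈ alt n * x ^ n
      power zero    = sym (*-identityˡ 1#)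
      power (suc n) = trans (*-congˡ (power n))
        (solve 3 (λ x a p → :- x :* (a :* p) := :- con (+ 1) :* a :* (x :* p)) refl x (alt n) (x ^ n))

  -- exp x · partialExp (- x) m lies above or below 1 according to the parity
  -- of m, because the truncated Cauchy product telescopes to a remainder of that sign.
  module AlternatingProduct {x : Carrier} (0≤x : 0# ≤ x) where
    private
      -- The i-th term x^(m+i+1) / (m! i! (m+i+1)) of ∫₀ˣ s^m/m! e^s ds, obtained by expanding e^s;
      -- `remainder` truncates this series.
      coefficient : ℕ → ℕ → Carrier
      coefficient m i = term x m * (x * term x i) / fromℕ (suc (i ℕ.+ m))

      0≤coefficient : ∀ m i → 0# ≤ coefficient m i
      0≤coefficient m i = *-nonneg (*-nonneg (0≤term 0≤x m) (*-nonneg 0≤x (0≤term 0≤x i)))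
        (0<x⇒0≤x⁻¹ (0<fromℕ-suc (i ℕ.+ m)))

      -- The product of the two series cut off at degree m in the series of -x and at total degree N
      -- + m. The triangular cut makes every degree from 1 to m cancel exactly.
      product : ℕ → ℕ → Carrier
      product zero    N = partialExp x (suc N)
      product (suc m) N = product m (suc N) + term (- x) (suc m) * partialExp x (suc N)

      remainder : ℕ → ℕ → Carrier
      remainder m = partialSum (coefficient m)

      coefficient-0 : ∀ i → coefficient 0 i ≈ term x (suc i)
      coefficient-0 i = *-cancelʳ-≈ (0<⇒≉0 (0<fromℕ-suc (i ℕ.+ 0))) (begin-equality
        coefficient 0 i * fromℕ (suc (i ℕ.+ 0))   ≈⟨ x/y*y≈x _ (0<⇒≉0 (0<fromℕ-suc (i ℕ.+ 0))) ⟩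
        term x 0 * (x * term x i)                 ≈⟨ *-congʳ (term-0 x) ⟩
        1# * (x * term x i)                       ≈⟨ *-identityˡ _ ⟩
        x * term x i                              ≈⟨ term-suc x i ⟨
        term x (suc i) * fromℕ (suc i)            ≡⟨ ≡.cong (λ k → term x (suc i) * fromℕ (suc k)) (ℕₚ.+-identityʳ i) ⟨
        term x (suc i) * fromℕ (suc (i ℕ.+ 0))    ∎)

      clear-denominator : ∀ m i → coefficient m i * fromℕ (suc (i ℕ.+ m)) ≈ term x m * (x * term x i)
      clear-denominator m i = x/y*y≈x _ (0<⇒≉0 (0<fromℕ-suc (i ℕ.+ m)))

      coefficient-head : ∀ m → coefficient m 0 ≈ term x (suc m) * term x 0
      coefficient-head m = *-cancelʳ-≈ (0<⇒≉0 (0<fromℕ-suc m)) (begin-equality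
        coefficient m 0 * fromℕ (suc m)           ≈⟨ clear-denominator m 0 ⟩
        term x m * (x * term x 0)                 ≈⟨ solve 3 (λ t x u → t :* (x :* u) := x :* t :* u) refl _ x _ ⟩
        x * term x m * term x 0                   ≈⟨ *-congʳ (term-suc x m) ⟨
        term x (suc m) * fromℕ (suc m) * term x 0 ≈⟨ solve 3 (λ t n u → t :* n :* u := t :* u :* n) refl _ _ _ ⟩
        term x (suc m) * term x 0 * fromℕ (suc m) ∎)

      -- The product rule for s^(m+1)/(m+1)! · s^(i+1)/(i+1)!, integrated from 0 to x.
      -- Algebraically, multiplying by m + i + 2 splits into the shares m + 1 and i + 1.
      coefficient-suc : ∀ m i →
        term x (suc m) * term x (suc i) ≈ coefficient m (suc i) + coefficient (suc m) i
      coefficient-suc m i = *-cancelʳ-≈ (0<⇒≉0 (0<fromℕ-suc (suc (i ℕ.+ m)))) (sym (begin-equality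
        (coefficient m (suc i) + coefficient (suc m) i) * N
          ≈⟨ distribʳ _ _ _ ⟩
        coefficient m (suc i) * N + coefficient (suc m) i * N
          ≈⟨ +-cong (clear-denominator m (suc i))
               (trans (*-congˡ (reflexive (≡.cong (λ k → fromℕ (suc k)) (≡.sym (ℕₚ.+-suc i m))))) (clear-denominator (suc m) i)) ⟩
        a * (x * b′) + a′ * (x * b)
          ≈⟨ +-cong (solve 3 (λ a x b → a :* (x :* b) := x :* a :* b) refl a x b′) (*-congˡ (sym (term-suc x i))) ⟩
        x * a * b′ + a′ * (b′ * fromℕ (suc i))
          ≈⟨ +-congʳ (*-congʳ (term-suc x m)) ⟨
        a′ * fromℕ (suc m) * b′ + a′ * (b′ * fromℕ (suc i))
          ≈⟨ solve 4 (λ a m b i → a :* m :* b :+ a :* (b :* i) := a :* b :* (i :+ m)) refl a′ _ b′ _ ⟩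
        a′ * b′ * (fromℕ (suc i) + fromℕ (suc m))
          ≈⟨ *-congˡ (fromℕ-+ (suc i) (suc m)) ⟨
        a′ * b′ * fromℕ (suc i ℕ.+ suc m)
          ≡⟨ ≡.cong (λ k → a′ * b′ * fromℕ (suc k)) (ℕₚ.+-suc i m) ⟩
        a′ * b′ * N ∎))
        where
        N = fromℕ (suc (suc (i ℕ.+ m)))
        a = term x m
        a′ = term x (suc m)
        b = term x i
        b′ = term x (suc i)

      -- Integration by parts for ∫₀ˣ s^(m+1)/(m+1)! e^s ds, with the truncations chosen so that
      -- both sides stop at degree m + N + 1.
      remainder-suc : ∀ m N →
        term x (suc m) * partialExp x (suc N) ≈ remainder m (suc N) + remainder (suc m) N
      remainder-suc m zero    = begin-equality
        term x (suc m) * (0# + term x 0)    ≈⟨ *-congˡ (+-identityˡ _) ⟩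
        term x (suc m) * term x 0           ≈⟨ coefficient-head m ⟨
        coefficient m 0                     ≈⟨ solve 1 (λ c → c := con (+ 0) :+ c :+ con (+ 0)) refl _ ⟩
        0# + coefficient m 0 + 0#           ∎
      remainder-suc m (suc N) = begin-equality
        term x (suc m) * (partialExp x (suc N) + term x (suc N))
          ≈⟨ distribˡ _ _ _ ⟩
        term x (suc m) * partialExp x (suc N) + term x (suc m) * term x (suc N)
          ≈⟨ +-cong (remainder-suc m N) (coefficient-suc m N) ⟩
        (remainder m (suc N) + remainder (suc m) N) + (coefficient m (suc N) + coefficient (suc m) N)
          ≈⟨ solve 4 (λ a b c d → (a :+ b) :+ (c :+ d) := (a :+ c) :+ (b :+ d)) refl _ _ _ _ ⟩
        remainder m (suc (suc N)) + remainder (suc m) (suc N) ∎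

      -- Raising m adds a term of the opposite sign which, by `remainder-suc`, cancels the old
      -- remainder and leaves the next one.
      product≈1±remainder : ∀ m N → product m N ≈ 1# + alt m * remainder m N
      product≈1±remainder zero    N = begin-equality
        partialExp x (suc N)
          ≈⟨ partialSum-head (term x) N ⟩
        term x 0 + partialSum (λ i → term x (suc i)) N
          ≈⟨ +-cong (term-0 x) (partialSum-cong (λ i → sym (coefficient-0 i)) N) ⟩
        1# + remainder 0 N
          ≈⟨ +-congˡ (*-identityˡ _) ⟨
        1# + 1# * remainder 0 N ∎
      product≈1±remainder (suc m) N = begin-equality
        product m (suc N) + term (- x) (suc m) * partialExp x (suc N)
          ≈⟨ +-cong (product≈1±remainder m (suc N))
               (trans (*-congʳ (term-neg x (suc m))) (*-assoc _ _ _)) ⟩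
        (1# + alt m * remainder m (suc N)) + (- 1# * alt m) * (term x (suc m) * partialExp x (suc N))
          ≈⟨ +-congˡ (*-congˡ (remainder-suc m N)) ⟩
        (1# + alt m * remainder m (suc N)) + (- 1# * alt m) * (remainder m (suc N) + remainder (suc m) N)
          ≈⟨ solve 3 (λ s r q → (con (+ 1) :+ s :* r) :+ (:- con (+ 1) :* s) :* (r :+ q)
               := con (+ 1) :+ :- con (+ 1) :* s :* q) refl (alt m) _ _ ⟩
        1# + alt (suc m) * remainder (suc m) N ∎

      -- Only N tends to infinity here. With m fixed the product is a finite linear combination of
      -- partial sums of exp x, so linearity of limits suffices.
      product→ : ∀ m → ConvergesTo (product m) (exp x * partialExp (- x) (suc m))
      product→ zero    = converges-limit-cong
        (sym (trans (*-congˡ (trans (+-identityˡ _) (term-0 (- x)))) (*-identityʳ (exp x))))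
        (converges-subsequence suc ℕₚ.n≤1+n (partialExp→exp x))
      product→ (suc m) = converges-limit-cong
        (solve 3 (λ e p t → e :* p :+ t :* e := e :* (p :+ t)) refl
          (exp x) (partialExp (- x) (suc m)) (term (- x) (suc m)))
        (converges-+ (converges-subsequence suc ℕₚ.n≤1+n (product→ m))
          (converges-* (term (- x) (suc m)) (converges-subsequence suc ℕₚ.n≤1+n (partialExp→exp x))))

    1≤product-odd : ∀ m → 1# ≤ exp x * partialExp (- x) (suc (m ℕ.+ m))
    1≤product-odd m = limit-mono
      (λ N → ≤-by-difference (0≤partialSum (0≤coefficient (m ℕ.+ m)) N)
        (trans (product≈1±remainder (m ℕ.+ m) N)
          (+-congˡ (trans (*-congʳ (alt-even m)) (*-identityˡ _)))))
      (converges-const 1#) (product→ (m ℕ.+ m))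

    product-even≤1 : ∀ m → exp x * partialExp (- x) (suc (suc (m ℕ.+ m))) ≤ 1#
    product-even≤1 m = limit-mono
      (λ N → ≤-by-difference (0≤partialSum (0≤coefficient (suc (m ℕ.+ m))) N)
        (sym (trans (+-congʳ (product≈1±remainder (suc (m ℕ.+ m)) N))
          (trans (+-congʳ (+-congˡ (*-congʳ (*-congˡ (alt-even m)))))
            (solve 1 (λ r → con (+ 1) :+ :- con (+ 1) :* con (+ 1) :* r :+ r := con (+ 1)) refl _)))))
      (product→ (suc (m ℕ.+ m))) (converges-const 1#)

  private
    -- Now m tends to infinity. Truncations of even and of odd length share the limit exp x · exp (-
    -- x); the former stay at most 1, the latter at least 1.
    exp-inverse-nonneg : ∀ {x} → 0# ≤ x → exp x * exp (- x) ≈ 1#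
    exp-inverse-nonneg {x} 0≤x = antisym
      (limit-mono product-even≤1
        (converges-subsequence (λ m → suc (suc (m ℕ.+ m)))
          (λ m → ℕₚ.m≤n⇒m≤1+n (ℕₚ.m≤n⇒m≤1+n (ℕₚ.m≤m+n m m))) products)
        (converges-const 1#))
      (limit-mono 1≤product-odd (converges-const 1#)
        (converges-subsequence (λ m → suc (m ℕ.+ m)) (λ m → ℕₚ.m≤n⇒m≤1+n (ℕₚ.m≤m+n m m)) products))
      where
      open AlternatingProduct 0≤x
      products : ConvergesTo (λ n → exp x * partialExp (- x) n) (exp x * exp (- x))
      products = converges-* (exp x) (partialExp→exp (- x))

    -‿involutive : ∀ x → - - x ≈ x
    -‿involutive = solve 1 (λ x → :- (:- x) := x) refl

  exp-inverse : ∀ x → exp x * exp (- x) ≈ 1#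
  exp-inverse x = [ exp-inverse-nonneg , (λ x≤0 → begin-equality
    exp x * exp (- x)         ≈⟨ *-comm _ _ ⟩
    exp (- x) * exp x         ≈⟨ *-congˡ (exp-cong (-‿involutive x)) ⟨
    exp (- x) * exp (- - x)   ≈⟨ exp-inverse-nonneg (x≤0⇒0≤-x x≤0) ⟩
    1#                        ∎) ]′ (total 0# x)

  0≤x⇒1≤exp[x] : ∀ {x} → 0# ≤ x → 1# ≤ exp x
  0≤x⇒1≤exp[x] 0≤x = ≤-trans (≤-by-difference 0≤x refl) (0≤x⇒1+x≤exp[x] 0≤x)

  0<exp : ∀ x → 0# < exp x
  0<exp x = [ (λ 0≤x → <-≤-trans 0<1 (0≤x⇒1≤exp[x] 0≤x)) , negative ]′ (total 0# x)
    where
    negative : x ≤ 0# → 0# < exp x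
    negative x≤0 = *-cancelʳ-≤ 0<exp[-x] (≤-resp (sym (zeroˡ _)) (sym (exp-inverse x)) 0≤1)
      , λ 0≈ → 0≉1 (trans (sym (zeroˡ _)) (trans (*-congʳ 0≈) (exp-inverse x)))
      where
      0<exp[-x] : 0# < exp (- x)
      0<exp[-x] = <-≤-trans 0<1 (0≤x⇒1≤exp[x] (x≤0⇒0≤-x x≤0))

  0≤x⇒exp[-x]≤1 : ∀ {x} → 0# ≤ x → exp (- x) ≤ 1#
  0≤x⇒exp[-x]≤1 {x} 0≤x = begin
    exp (- x)            ≈⟨ *-identityˡ _ ⟨
    1# * exp (- x)       ≤⟨ *-monoˡ-≤ (<⇒≤ (0<exp (- x))) (0≤x⇒1≤exp[x] 0≤x) ⟩
    exp x * exp (- x)    ≈⟨ exp-inverse x ⟩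
    1#                   ∎

  -- For x ≤ 0 the shortest even truncation at - x says exp (- x) (1 + x) ≤ 1, and dividing by exp
  -- (- x) gives the claim.
  1+x≤exp[x] : ∀ x → 1# + x ≤ exp x
  1+x≤exp[x] x = [ 0≤x⇒1+x≤exp[x] , negative ]′ (total 0# x)
    where
    negative : x ≤ 0# → 1# + x ≤ exp x
    negative x≤0 = *-cancelʳ-≤ (0<exp (- x)) (begin
      (1# + x) * exp (- x)                ≈⟨ *-comm _ _ ⟩
      exp (- x) * (1# + x)                ≈⟨ *-congˡ (+-congˡ (-‿involutive x)) ⟨
      exp (- x) * (1# + - - x)            ≈⟨ *-congˡ (partialExp-2 (- - x)) ⟨
      exp (- x) * partialExp (- - x) 2    ≤⟨ AlternatingProduct.product-even≤1 (x≤0⇒0≤-x x≤0) 0 ⟩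
      1#                                  ≈⟨ exp-inverse x ⟨
      exp x * exp (- x)                   ∎)

-- The greedy signing and the bound e^ρ on the weights.

module GreedySigning (R : RealField) where
  open Exponential R public

  pad-toℕ : ∀ {n} (v : Vector Carrier n) i → pad v (toℕ i) ≡ v i
  pad-toℕ {n} v i with toℕ i ℕₚ.<? n
  ... | yes i<n = ≡.cong v (Finₚ.fromℕ<-toℕ i i<n)
  ... | no  i≮n = contradiction (Finₚ.toℕ<n i) i≮n

  ∣pad∣≤ : ∀ {n} {v : Vector Carrier n} {b} → 0# ≤ b → (∀ i → ∣ v i ∣ ≤ b) → ∀ k → ∣ pad v k ∣ ≤ b
  ∣pad∣≤ {n} 0≤b v≤b k with k ℕₚ.<? n
  ... | yes k<n = v≤b (fromℕ< k<n)
  ... | no  _   = ≤-respˡ-≈ (sym (0≤x⇒∣x∣≈x ≤-refl)) 0≤b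

  -- Phrased as a single comparison of a product with `0#`, the very test the machine performs; a
  -- zero product yields `Sign.+`.
  choose : Carrier → Carrier → Sign
  choose s w = if ⌊ s * w ≤? 0# ⌋ then Sign.+ else Sign.-

  greedySum : (ℕ → Carrier) → ℕ → Carrier
  greedySum w zero    = 0#
  greedySum w (suc k) = greedySum w k + sgn (choose (greedySum w k) (w k)) * w k

  greedySign : (ℕ → Carrier) → ℕ → Sign
  greedySign w k = choose (greedySum w k) (w k)

  private
    ∣x+y∣≤b-opposite : ∀ {x y b} → ∣ x ∣ ≤ b → ∣ y ∣ ≤ b → 0# ≤ x → y ≤ 0# → ∣ x + y ∣ ≤ b
    ∣x+y∣≤b-opposite {x} {y} {b} ∣x∣≤b ∣y∣≤b 0≤x y≤0 = ∣x∣≤y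
      (begin
        x + y       ≤⟨ +-mono-≤ (x≤∣x∣ x) y≤0 ⟩
        ∣ x ∣ + 0#  ≈⟨ +-identityʳ _ ⟩
        ∣ x ∣       ≤⟨ ∣x∣≤b ⟩
        b           ∎)
      (begin
        - (x + y)   ≤⟨ ≤-by-difference 0≤x (solve 2 (λ x y → :- y := :- (x :+ y) :+ x) refl x y) ⟩
        - y         ≤⟨ -x≤∣x∣ y ⟩
        ∣ y ∣       ≤⟨ ∣y∣≤b ⟩
        b           ∎)

  -- Terms of opposite sign cancel in part, so the sum lies between them. The same fact drives the
  -- signing and, later, the removal of indices.
  ∣x+y∣≤b : ∀ {x y b} → ∣ x ∣ ≤ b → ∣ y ∣ ≤ b → x * y ≤ 0# → ∣ x + y ∣ ≤ b
  ∣x+y∣≤b {x} {y} {b} ∣x∣≤b ∣y∣≤b xy≤0 with 0# ≤? x | y ≤? 0#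
  ... | yes 0≤x | yes y≤0 = ∣x+y∣≤b-opposite ∣x∣≤b ∣y∣≤b 0≤x y≤0
  ... | yes 0≤x | no  y≰0 = ≤-respˡ-≈ (∣∣-cong (+-comm y x)) (∣x+y∣≤b-opposite ∣y∣≤b ∣x∣≤b (<⇒≤ (≰⇒> y≰0))
    (*-cancelʳ-≤ (≰⇒> y≰0) (≤-respʳ-≈ (sym (zeroˡ y)) xy≤0)))
  ... | no  0≰x | _       = ≤-respˡ-≈ (∣∣-cong (+-comm y x)) (∣x+y∣≤b-opposite ∣y∣≤b ∣x∣≤b 0≤y x≤0)
    where
    x≤0 = <⇒≤ (≰⇒> 0≰x)
    0≤y : 0# ≤ y
    0≤y = *-cancelʳ-≤ (≤-<-trans (≤-reflexive (sym (-‿inverseʳ x)))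
        (<-≤-trans (+-monoˡ-< (≰⇒> 0≰x)) (≤-reflexive (+-identityˡ (- x)))))
      (≤-resp (sym (zeroˡ _)) (solve 2 (λ x y → :- (x :* y) := y :* :- x) refl x y) (x≤0⇒0≤-x xy≤0))
      where
      +-monoˡ-< : ∀ {x y z} → x < y → x + z < y + z
      +-monoˡ-< {x} {y} {z} x<y = +-monoˡ-≤ z (<⇒≤ x<y) , λ e → proj₂ x<y
        (trans (sym (shift x)) (trans (+-congʳ e) (shift y)))
        where
        shift : ∀ x → x + z - z ≈ x
        shift x = solve 2 (λ x z → x :+ z :- z := x) refl x z

  ∣x+±y∣≤b : ∀ {x y b} → ∣ x ∣ ≤ b → ∣ y ∣ ≤ b → ∣ x + sgn (choose x y) * y ∣ ≤ b
  ∣x+±y∣≤b {x} {y} ∣x∣≤b ∣y∣≤b with x * y ≤? 0#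
  ... | yes xy≤0 = ≤-respˡ-≈ (∣∣-cong (+-congˡ (sym (*-identityˡ y)))) (∣x+y∣≤b ∣x∣≤b ∣y∣≤b xy≤0)
  ... | no  xy≰0 = ≤-respˡ-≈ (∣∣-cong (+-congˡ (solve 1 (λ y → :- y := :- con (+ 1) :* y) refl y)))
    (∣x+y∣≤b ∣x∣≤b (≤-respˡ-≈ (sym (∣-x∣≈∣x∣ y)) ∣y∣≤b)
      (0≤-x⇒x≤0 (≤-respʳ-≈ (solve 2 (λ x y → x :* y := :- (x :* :- y)) refl x y) (<⇒≤ (≰⇒> xy≰0)))))

  ∣greedySum∣≤ : ∀ {w b} → 0# ≤ b → (∀ k → ∣ w k ∣ ≤ b) → ∀ k → ∣ greedySum w k ∣ ≤ b
  ∣greedySum∣≤ 0≤b w≤b zero    = ≤-respˡ-≈ (sym (0≤x⇒∣x∣≈x ≤-refl)) 0≤b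
  ∣greedySum∣≤ 0≤b w≤b (suc k) = ∣x+±y∣≤b (∣greedySum∣≤ 0≤b w≤b k) (w≤b k)

  -- Read off the zero-padded sequence, so that signs depend on a natural number, as the round
  -- counter of a program does.
  signing : ∀ {n} → Vector Carrier n → Fin n → Sign
  signing v i = greedySign (pad v) (toℕ i)

  signedSum-signing : ∀ {n} (v : Vector Carrier n) → signedSum (signing v) v ≈ greedySum (pad v) n
  signedSum-signing {n} v = begin-equality
    signedSum (signing v) v
      ≈⟨ sum-cong (λ i → *-congˡ (reflexive (≡.sym (pad-toℕ v i)))) ⟩
    sum (λ i → increment (toℕ {n} i))
      ≈⟨ sum≈partialSum increment n ⟩
    partialSum increment n
      ≈⟨ partialSum≈greedySum n ⟩
    greedySum (pad v) n ∎
    where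
    increment : ℕ → Carrier
    increment k = sgn (greedySign (pad v) k) * pad v k

    partialSum≈greedySum : ∀ k → partialSum increment k ≈ greedySum (pad v) k
    partialSum≈greedySum zero    = refl
    partialSum≈greedySum (suc k) = +-congʳ (partialSum≈greedySum k)

  ∣signedSum∣≤ : ∀ {n} {v : Vector Carrier n} {b} → 0# ≤ b → (∀ i → ∣ v i ∣ ≤ b) →
                 ∣ signedSum (signing v) v ∣ ≤ b
  ∣signedSum∣≤ {n} {v} 0≤b v≤b =
    ≤-respˡ-≈ (∣∣-cong (sym (signedSum-signing v))) (∣greedySum∣≤ 0≤b (∣pad∣≤ 0≤b v≤b) n)

  module _ {n d} (I : Instance n d) {ρ} (q : Vector Carrier d) (‖q‖≤ρ : ‖ q ‖ ≤ ρ) where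

    kernel≤exp[ρ] : ∀ i → kernel I q i ≤ exp ρ
    kernel≤exp[ρ] i = ∣x∣≤y⇒exp[x]≤exp[y] (∣x∙y∣≤ρ q (key I i) ‖q‖≤ρ (‖key‖≤1 I i))

    ∣weight∣≤exp[ρ] : ∀ i → ∣ weight I q i ∣ ≤ exp ρ
    ∣weight∣≤exp[ρ] i = begin
      ∣ weight I q i ∣                  ≤⟨ ∣x*y∣≤∣x∣*∣y∣ (kernel I q i) (value I i) ⟩
      ∣ kernel I q i ∣ * ∣ value I i ∣  ≈⟨ *-congʳ (0≤x⇒∣x∣≈x 0≤kernel) ⟩
      kernel I q i * ∣ value I i ∣      ≤⟨ *-mono-≤ (0≤∣x∣ _) (<⇒≤ (0<exp ρ)) (kernel≤exp[ρ] i) (∣value∣≤1 I i) ⟩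
      exp ρ * 1#                        ≈⟨ *-identityʳ _ ⟩
      exp ρ                             ∎
      where
      0≤kernel : 0# ≤ kernel I q i
      0≤kernel = <⇒≤ (0<exp (q ∙ key I i))

    ∣signedSum-weight∣≤exp[ρ] : ∣ signedSum (signing (weight I q)) (weight I q) ∣ ≤ exp ρ
    ∣signedSum-weight∣≤exp[ρ] = ∣signedSum∣≤ (<⇒≤ (0<exp ρ)) ∣weight∣≤exp[ρ]

-- The greedy loop on the real RAM.

module Programs (R : RealField) where
  open GreedySigning R public

  ≔-same : ∀ {A : Set} (f : ℕ → A) {i} a {j} → j ≡ i → (f [ i ≔ a ]) j ≡ a
  ≔-same f {i} a {j} ≡.refl with j ℕ.≡ᵇ j in eq
  ... | true  = ≡.refl
  ... | false = contradiction (≡.subst T eq (ℕₚ.≡⇒≡ᵇ j j ≡.refl)) λ ()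

  ≔-other : ∀ {A : Set} (f : ℕ → A) {i} a {j} → ¬ (j ≡ i) → (f [ i ≔ a ]) j ≡ f j
  ≔-other f {i} a {j} j≢i with j ℕ.≡ᵇ i in eq
  ... | true  = contradiction (ℕₚ.≡ᵇ⇒≡ j i (≡.subst T (≡.sym eq) _)) j≢i
  ... | false = ≡.refl

  <⇒<ᵇ≡true : ∀ {m n} → m ℕ.< n → (m ℕ.<ᵇ n) ≡ true
  <⇒<ᵇ≡true {zero}  (ℕ.s≤s m<n) = ≡.refl
  <⇒<ᵇ≡true {suc m} (ℕ.s≤s m<n) = <⇒<ᵇ≡true m<n

  ≥⇒<ᵇ≡false : ∀ {m n} → n ℕ.≤ m → (m ℕ.<ᵇ n) ≡ false
  ≥⇒<ᵇ≡false ℕ.z≤n       = ≡.refl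
  ≥⇒<ᵇ≡false (ℕ.s≤s n≤m) = ≥⇒<ᵇ≡false n≤m

  module _ {b : Basis} where

    run-+ : ∀ (p : Program b) t u s → run p (t ℕ.+ u) s ≡ run p u (run p t s)
    run-+ p zero    u s = ≡.refl
    run-+ p (suc t) u s = run-+ p t u (step p s)

    fetch-beyond : ∀ (p : Program b) {l} → length p ℕ.≤ l → fetch p l ≡ nothing
    fetch-beyond []      _           = ≡.refl
    fetch-beyond (_ ∷ p) (ℕ.s≤s p≤l) = fetch-beyond p p≤l

    step-halted : ∀ (p : Program b) s → Halted p s → step p s ≡ s
    step-halted p s halted with fetch p (pc s) | fetch-beyond p halted
    ... | nothing | _ = ≡.refl

    run-halted : ∀ (p : Program b) t s → Halted p s → run p t s ≡ s
    run-halted p zero    s halted = ≡.refl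
    run-halted p (suc t) s halted =
      ≡.trans (≡.cong (run p t) (step-halted p s halted)) (run-halted p t s halted)

    run-idle : ∀ (p : Program b) {t u} s → t ℕ.≤ u → Halted p (run p t s) → run p u s ≡ run p t s
    run-idle p {t} {u} s t≤u halted = ≡.trans
      (≡.cong (λ v → run p v s) (≡.sym (ℕₚ.m+[n∸m]≡n t≤u)))
      (≡.trans (run-+ p t (u ℕ.∸ t) s) (run-halted p (u ℕ.∸ t) (run p t s) halted))

    -- The greedy signing as a program.  Index register 0 holds n and index
    -- register 2 the round; real register 0 holds the signed sum and 5 holds
    -- zero.  `weightCode`, entered at address 14, leaves the next weight in
    -- real register 1 and jumps to address 1.  The two branches of the
    -- comparison take equally many steps.
    greedy : Program b → Program b
    greedy weightCode =
        jump 14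
      ∷ mul 2 0 1
      ∷ oneᵣ 4
      ∷ jumpLe 2 5 6
      ∷ sub 4 5 4
      ∷ jump 8
      ∷ oneᵣ 4
      ∷ jump 8
      ∷ mul 3 4 1
      ∷ add 0 0 3
      ∷ store 0 2 4
      ∷ incr 2
      ∷ jumpLt 2 0 14
      -- Halts: the loop has 14 instructions, so address 40 is past the end for any weight code of
      -- at most 26.
      ∷ jump 40
      ∷ weightCode

  -- The loop invariant after k rounds. It speaks only of index registers 0 and 2, real registers 0
  -- and 5 and the first k cells of array 0, so the weight code may overwrite all other registers.
  record Rounds (w : ℕ → Carrier) (n k : ℕ) (s : State) : Set where
    field
      count   : idx s 0 ≡ n
      round   : idx s 2 ≡ k
      total   : reg s 0 ≈ greedySum w k
      zeroReg : reg s 5 ≈ 0#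
      output  : ∀ j → j ℕ.< k → arr s 0 j ≈ sgn (greedySign w j)

  module _ {b : Basis} (weightCode : Program b) (w : ℕ → Carrier) (n : ℕ) where
    open Rounds

    private
      p = greedy weightCode

      ≤?-cong : ∀ {x x′ y y′} → x ≈ x′ → y ≈ y′ → ⌊ x ≤? y ⌋ ≡ ⌊ x′ ≤? y′ ⌋
      ≤?-cong {x} {x′} {y} {y′} x≈ y≈ with x ≤? y | x′ ≤? y′
      ... | yes _   | yes _   = ≡.refl
      ... | yes x≤y | no  ¬q  = contradiction (≤-resp x≈ y≈ x≤y) ¬q
      ... | no  ¬q  | yes x≤y = contradiction (≤-resp (sym x≈) (sym y≈) x≤y) ¬q
      ... | no  _   | no  _   = ≡.refl

      signOf : Bool → Sign
      signOf positive = if positive then Sign.+ else Sign.-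

      updated : ∀ k I X A σ → Rounds w n k (state 1 I X A) → σ ≡ greedySign w k →
                ∀ {x l X′} → x ≈ sgn σ → X′ 5 ≈ 0# → X′ 0 ≈ greedySum w (suc k) →
                Rounds w n (suc k)
                  (state l (I [ 2 ≔ suc (I 2) ]) X′ (A [ 0 ≔ A 0 [ I 2 ≔ x ] ]))
      updated k I X A σ inv ≡.refl {x} x≈σ X′5≈0 X′0≈ = record
        { count = count inv ; round = ≡.cong suc (round inv)
        ; total = X′0≈ ; zeroReg = X′5≈0 ; output = output′ }
        where
        output′ : ∀ j → j ℕ.< suc k → (A 0 [ I 2 ≔ x ]) j ≈ sgn (greedySign w j)
        output′ j j<1+k with j ℕₚ.≟ k
        ... | yes ≡.refl = trans (reflexive (≔-same (A 0) x (≡.sym (round inv)))) x≈σ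
        ... | no  j≢k    = trans (reflexive (≔-other (A 0) x (λ j≡ → j≢k (≡.trans j≡ (round inv)))))
                             (output inv j (ℕₚ.≤∧≢⇒< (ℕₚ.≤-pred j<1+k) j≢k))

    addressOf : Bool → ℕ
    addressOf continue = if continue then 14 else 13

    nextAddress : ℕ → ℕ → ℕ
    nextAddress k n = addressOf (k ℕ.<ᵇ n)

    -- What the weight code may remember between rounds: index registers 1 and 4 and the input
    -- arrays. The loop writes to none of these, hence preserves every frame.
    Frame : Set₁
    Frame = ℕ → ℕ → ℕ → (ℕ → ℕ → Carrier) → Set

    framed : Frame → ℕ → State → Set
    framed F k s = F k (idx s 1) (idx s 4) (λ a → arr s (suc a))

    private
      -- Once the outcome of the comparison is a concrete Boolean, either branch runs through
      -- exactly seven instructions by computation.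
      round-finish : ∀ F k I X A → Rounds w n k (state 1 I X A) → framed F (suc k) (state 1 I X A) →
        X 1 ≈ w k → ∀ positive → signOf positive ≡ greedySign w k → X 4 ≈ 1# →
        let s = run p 7 (state (if positive then 6 else 4) I X A) in
        pc s ≡ nextAddress (suc k) n × Rounds w n (suc k) s × framed F (suc k) s
      round-finish F k I X A inv frame X1≈w true  σ≡ X4≈1 =
        ≡.cong₂ nextAddress (≡.cong suc (round inv)) (count inv)
        , updated k I X A Sign.+ inv σ≡ refl (zeroReg inv)
            (+-cong (total inv) (*-cong (reflexive (≡.cong sgn σ≡)) X1≈w))
        , frame
      round-finish F k I X A inv frame X1≈w false σ≡ X4≈1 =
        ≡.cong₂ nextAddress (≡.cong suc (round inv)) (count inv)
        , updated k I X A Sign.- inv σ≡ minus (zeroReg inv)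
            (+-cong (total inv) (*-cong (trans minus (reflexive (≡.cong sgn σ≡))) X1≈w))
        , frame
        where
        minus : X 5 - X 4 ≈ - 1#
        minus = trans (+-cong (zeroReg inv) (-‿cong X4≈1)) (+-identityˡ _)

    greedyRound : ∀ F k s → pc s ≡ 1 → Rounds w n k s → framed F (suc k) s → reg s 1 ≈ w k →
      let s′ = run p 10 s in
      pc s′ ≡ nextAddress (suc k) n × Rounds w n (suc k) s′ × framed F (suc k) s′
    -- With the address known, the first three instructions reduce; the run is stuck only on the
    -- comparison, whose Boolean is handed over. It agrees with `choose` because the registers hold
    -- the greedy sum and zero up to `≈`.
    greedyRound F k (state _ I X A) ≡.refl inv frame X1≈w =
      round-finish F k I (X [ 2 ≔ X 0 * X 1 ] [ 4 ≔ 1# ]) A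
        (record { count = count inv ; round = round inv ; total = total inv
                ; zeroReg = zeroReg inv ; output = output inv })
        frame X1≈w ⌊ X 0 * X 1 ≤? X 5 ⌋
        (≡.cong signOf (≤?-cong (*-cong (total inv) X1≈w) (zeroReg inv))) refl

    -- The contract for weight code. Since c is an exact step count, rounds can be concatenated with
    -- `run-+` and the total time is a closed formula.
    WeightRound : Frame → ℕ → Set
    WeightRound F c = ∀ k s → k ℕ.< n → pc s ≡ 14 → Rounds w n k s → framed F k s →
      let s′ = run p c s in
      pc s′ ≡ 1 × Rounds w n k s′ × framed F (suc k) s′ × reg s′ 1 ≈ w k

    module _ (F : Frame) (c : ℕ) (weightRound : WeightRound F c) where

      private
        oneRound : ∀ k s → k ℕ.< n → pc s ≡ 14 → Rounds w n k s → framed F k s →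
          let s′ = run p (c ℕ.+ 10) s in
          pc s′ ≡ nextAddress (suc k) n × Rounds w n (suc k) s′ × framed F (suc k) s′
        oneRound k s k<n at14 inv frame =
          let at1 , inv′ , frame′ , X1≈w = weightRound k s k<n at14 inv frame in
          ≡.subst (λ s′ → pc s′ ≡ nextAddress (suc k) n × Rounds w n (suc k) s′ × framed F (suc k) s′)
            (≡.sym (run-+ p c 10 s))
            (greedyRound F k (run p c s) at1 inv′ frame′ X1≈w)

        -- The test sits at the bottom of the loop, so a round is always executed first; the
        -- induction counts the remaining rounds as `suc m`.
        allRounds : ∀ m k s → k ℕ.+ suc m ≡ n → pc s ≡ 14 → Rounds w n k s → framed F k s →
          let s′ = run p (suc m ℕ.* (c ℕ.+ 10)) s in
          pc s′ ≡ 13 × Rounds w n n s′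
        allRounds zero    k s k+1≡n at14 inv frame =
          let k<n = ℕₚ.≤-reflexive (≡.trans (≡.sym (ℕₚ.+-comm k 1)) k+1≡n)
              at , inv′ , _ = oneRound k s k<n at14 inv frame in
          ≡.subst (λ t → pc (run p t s) ≡ 13 × Rounds w n n (run p t s)) (≡.sym (ℕₚ.+-identityʳ (c ℕ.+ 10)))
            ( ≡.trans at (≡.cong addressOf
                (≥⇒<ᵇ≡false (ℕₚ.≤-reflexive (≡.sym (≡.trans (≡.sym (ℕₚ.+-comm k 1)) k+1≡n)))))
            , ≡.subst (λ k → Rounds w n k (run p (c ℕ.+ 10) s)) (≡.trans (≡.sym (ℕₚ.+-comm k 1)) k+1≡n) inv′ )
        allRounds (suc m) k s k+≡n at14 inv frame =
          let k<n = ≡.subst (suc k ℕ.≤_) k+≡n (ℕₚ.m<m+n k (ℕ.s≤s ℕ.z≤n))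
              1+k+≡n = ≡.trans (≡.sym (ℕₚ.+-suc k (suc m))) k+≡n
              1+k<n = ≡.subst (suc (suc k) ℕ.≤_) 1+k+≡n (ℕₚ.m<m+n (suc k) (ℕ.s≤s ℕ.z≤n))
              at , inv′ , frame′ = oneRound k s k<n at14 inv frame in
          ≡.subst (λ s′ → pc s′ ≡ 13 × Rounds w n n s′)
            (≡.sym (run-+ p (c ℕ.+ 10) (suc m ℕ.* (c ℕ.+ 10)) s))
            (allRounds m (suc k) (run p (c ℕ.+ 10) s) 1+k+≡n
              (≡.trans at (≡.cong addressOf (<⇒<ᵇ≡true 1+k<n))) inv′ frame′)

        halt : ∀ s → pc s ≡ 13 → Rounds w n n s → pc (step p s) ≡ 40 × Rounds w n n (step p s)
        halt (state _ I X A) ≡.refl inv = ≡.refl , record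
          { count = count inv ; round = round inv ; total = total inv
          ; zeroReg = zeroReg inv ; output = output inv }

      greedy-outputs : length weightCode ℕ.≤ 26 → 1 ℕ.≤ n →
        ∀ s → pc s ≡ 14 → Rounds w n 0 s → framed F 0 s →
        let s′ = run p (n ℕ.* (c ℕ.+ 10) ℕ.+ 1) s in
        Halted p s′ × Rounds w n n s′
      greedy-outputs short 1≤n s at14 inv frame =
        ≡.subst (λ s′ → Halted p s′ × Rounds w n n s′) (≡.sym (run-+ p (n ℕ.* (c ℕ.+ 10)) 1 s)) (finish all)
        where
        all : let s′ = run p (n ℕ.* (c ℕ.+ 10)) s in pc s′ ≡ 13 × Rounds w n n s′
        all = ≡.subst (λ k → let s′ = run p (k ℕ.* (c ℕ.+ 10)) s in pc s′ ≡ 13 × Rounds w n n s′)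
          (ℕₚ.suc-pred n {{ℕ.>-nonZero 1≤n}})
          (allRounds (ℕ.pred n) 0 s (ℕₚ.suc-pred n {{ℕ.>-nonZero 1≤n}}) at14 inv frame)
        finish : pc (run p (n ℕ.* (c ℕ.+ 10)) s) ≡ 13 × Rounds w n n (run p (n ℕ.* (c ℕ.+ 10)) s) →
          let s′ = step p (run p (n ℕ.* (c ℕ.+ 10)) s) in Halted p s′ × Rounds w n n s′
        finish (at13 , inv′) =
          let at40 , inv″ = halt _ at13 inv′ in
          ≡.subst (length p ℕ.≤_) (≡.sym at40) (ℕₚ.+-monoʳ-≤ 14 short) , inv″

-- Running-time arithmetic.

module StepCounts where
  open ℕₚ.≤-Reasoning
  open +-*-Solver

  -- Twelve steps per weight, plus the entering and the halting jump. The slack of 11 n only brings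
  -- the constant up to that of the full program.
  weights-steps : ∀ {n} → 1 ℕ.≤ n → suc (n ℕ.* 12 ℕ.+ 1) ℕ.≤ 25 ℕ.* n
  weights-steps {n} 1≤n = begin
    suc (n ℕ.* 12 ℕ.+ 1)
      ≡⟨ solve 1 (λ n → con 1 :+ (n :* con 12 :+ con 1) := con 2 :+ con 12 :* n) ≡.refl n ⟩
    2 ℕ.+ 12 ℕ.* n
      ≤⟨ ℕₚ.+-monoˡ-≤ (12 ℕ.* n) (ℕₚ.*-monoʳ-≤ 2 1≤n) ⟩
    2 ℕ.* n ℕ.+ 12 ℕ.* n
      ≤⟨ ℕₚ.m≤m+n (2 ℕ.* n ℕ.+ 12 ℕ.* n) (11 ℕ.* n) ⟩
    2 ℕ.* n ℕ.+ 12 ℕ.* n ℕ.+ 11 ℕ.* n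
      ≡⟨ solve 1 (λ n → con 2 :* n :+ con 12 :* n :+ con 11 :* n := con 25 :* n) ≡.refl n ⟩
    25 ℕ.* n ∎

  -- Origin of 25 = 2 + 16 + 7: two jumps in all, 16 steps per key (2 + 4 around the dot product, 10
  -- for the greedy round) and 7 per coordinate, each charged to n d.
  instance-steps : ∀ {n d} → 1 ℕ.≤ n → 1 ℕ.≤ d →
    suc (n ℕ.* (2 ℕ.+ (d ℕ.* 7 ℕ.+ 4) ℕ.+ 10) ℕ.+ 1) ℕ.≤ 25 ℕ.* (n ℕ.* d)
  instance-steps {n} {d} 1≤n 1≤d = begin
    suc (n ℕ.* (2 ℕ.+ (d ℕ.* 7 ℕ.+ 4) ℕ.+ 10) ℕ.+ 1)
      ≡⟨ solve 2 (λ n d → con 1 :+ (n :* (con 2 :+ (d :* con 7 :+ con 4) :+ con 10) :+ con 1)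
           := con 2 :+ (con 16 :* n :+ con 7 :* (n :* d))) ≡.refl n d ⟩
    2 ℕ.+ (16 ℕ.* n ℕ.+ 7 ℕ.* (n ℕ.* d))
      ≤⟨ ℕₚ.+-mono-≤ (ℕₚ.*-monoʳ-≤ 2 1≤nd) (ℕₚ.+-monoˡ-≤ (7 ℕ.* (n ℕ.* d)) (ℕₚ.*-monoʳ-≤ 16 n≤nd)) ⟩
    2 ℕ.* (n ℕ.* d) ℕ.+ (16 ℕ.* (n ℕ.* d) ℕ.+ 7 ℕ.* (n ℕ.* d))
      ≡⟨ solve 1 (λ m → con 2 :* m :+ (con 16 :* m :+ con 7 :* m) := con 25 :* m) ≡.refl (n ℕ.* d) ⟩
    25 ℕ.* (n ℕ.* d) ∎
    where
    n≤nd : n ℕ.≤ n ℕ.* d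
    n≤nd = ℕₚ.m≤m*n n d {{ℕ.>-nonZero 1≤d}}
    1≤nd = ℕₚ.≤-trans 1≤n n≤nd

-- The two programs: weights given, and weights computed from the instance.

module ConcretePrograms (R : RealField) where
  open Programs R public
  open Rounds
  open StepCounts

  private
    -- A halted state is a fixed point of `step`, so the exact time t can be relaxed to any later u.
    outputs : ∀ {b n} {p : Program b} {t u} {v : Vector Carrier n} s → t ℕ.≤ u →
              Halted p (run p t s) → Rounds (pad v) n n (run p t s) →
              OutputsWithin p s u (signing v)
    outputs {p = p} {t} {u} {v} s t≤u halted inv =
      ≡.subst (λ s′ → Halted p s′ × (∀ i → arr s′ 0 (toℕ i) ≈ sgn (signing v i)))
        (≡.sym (run-idle p s t≤u halted))
        (halted , λ i → output inv (toℕ i) (Finₚ.toℕ<n i))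

  readWeight : Program arithmetic
  readWeight = load 1 1 2 ∷ jump 1 ∷ []

  weightsProgram : Program arithmetic
  weightsProgram = greedy readWeight

  module _ {n d} (I : Instance n d) (q : Vector Carrier d) where
    private
      w = pad (weight I q)

      Holds : Frame readWeight w n
      Holds k _ _ A = ∀ j → A 0 j ≡ w j

      weightRound : WeightRound readWeight w n Holds 2
      weightRound k (state _ J X A) k<n ≡.refl inv holds = ≡.refl , inv′ , holds ,
        reflexive (≡.trans (holds (J 2)) (≡.cong w (round inv)))
        where
        inv′ = record { count = count inv ; round = round inv ; total = total inv
                      ; zeroReg = zeroReg inv ; output = output inv }

    weightsProgram-outputs : OutputsWithin weightsProgram (weightsInput I q) (25 ℕ.* n)
                               (signing (weight I q))
    weightsProgram-outputs = outputs {t = suc (n ℕ.* 12 ℕ.+ 1)} (weightsInput I q) bound (proj₁ result) (proj₂ result)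
      where
      entered : State
      entered = step weightsProgram (weightsInput I q)

      result : let s′ = run weightsProgram (n ℕ.* 12 ℕ.+ 1) entered in
               Halted weightsProgram s′ × Rounds w n n s′
      result = greedy-outputs readWeight w n Holds 2 weightRound (ℕ.s≤s (ℕ.s≤s ℕ.z≤n)) (1≤n I) entered ≡.refl
        (record { count = ≡.refl ; round = ≡.refl ; total = refl ; zeroReg = refl ; output = λ _ () })
        (λ _ → ≡.refl)

      bound : suc (n ℕ.* 12 ℕ.+ 1) ℕ.≤ 25 ℕ.* n
      bound = weights-steps (1≤n I)

  -- Index register 3 is the column, 4 the position in the row-major keys.
  computeWeight : Program withExp
  computeWeight =
      clear 3
    ∷ zeroᵣ 6
    ∷ load 7 1 3
    ∷ load 8 2 4
    ∷ mul 7 7 8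
    ∷ add 6 6 7
    ∷ incr 3
    ∷ incr 4
    ∷ jumpLt 3 1 16
    ∷ expᵣ 1 6
    ∷ load 7 3 2
    ∷ mul 1 1 7
    ∷ jump 1
    ∷ []

  instanceProgram : Program withExp
  instanceProgram = greedy computeWeight

  pad-concat : ∀ {n d} (v : Vector (Vector Carrier d) n) i j →
               pad (concat v) (toℕ i ℕ.* d ℕ.+ toℕ j) ≡ v i j
  pad-concat {n} {d} v i j = ≡.trans (≡.cong (pad (concat v)) position)
    (≡.trans (pad-toℕ (concat v) (combine i j)) (≡.cong (λ (i , j) → v i j) (Finₚ.remQuot-combine i j)))
    where
    position : toℕ i ℕ.* d ℕ.+ toℕ j ≡ toℕ (combine i j)
    position = ≡.trans (≡.cong (ℕ._+ toℕ j) (ℕₚ.*-comm (toℕ i) d)) (≡.sym (Finₚ.toℕ-combine i j))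

  module _ {n d} (I : Instance n d) (q : Vector Carrier d) where
    private
      w = pad (weight I q)
      Q = pad q
      K = pad (concat (key I))
      V = pad (value I)

      Arrays : (ℕ → ℕ → Carrier) → Set
      Arrays A = (∀ j → A 0 j ≡ Q j) × (∀ j → A 1 j ≡ K j) × (∀ j → A 2 j ≡ V j)

      Holds : Frame computeWeight w n
      -- Register 4 is never reset: one increment per coordinate moves it from k d to (k + 1) d,
      -- which replaces the multiplication of indices that the machine does not offer.
      Holds k columns position A = columns ≡ d × position ≡ k ℕ.* d × Arrays A

      product : ℕ → ℕ → Carrier
      product k j = Q j * K (k ℕ.* d ℕ.+ j)

      record Columns (k j : ℕ) (s : State) : Set where
        field
          rounds   : Rounds w n k s
          columns  : idx s 1 ≡ d
          column   : idx s 3 ≡ j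
          position : idx s 4 ≡ k ℕ.* d ℕ.+ j
          dot      : reg s 6 ≈ partialSum (product k) j
          arrays   : Arrays (λ a → arr s (suc a))
      open Columns

      nextColumn : ℕ → ℕ → ℕ
      nextColumn j d = if j ℕ.<ᵇ d then 16 else 23

      oneColumn : ∀ k j s → pc s ≡ 16 → Columns k j s →
        let s′ = run instanceProgram 7 s in pc s′ ≡ nextColumn (suc j) d × Columns k (suc j) s′
      oneColumn k j (state _ J X A) ≡.refl inv =
        ≡.cong₂ nextColumn (≡.cong suc (column inv)) (columns inv) , record
        { rounds = record { count = count (rounds inv) ; round = round (rounds inv)
                          ; total = total (rounds inv) ; zeroReg = zeroReg (rounds inv)
                          ; output = output (rounds inv) }
        ; columns = columns inv
        ; column = ≡.cong suc (column inv)
        ; position = ≡.trans (≡.cong suc (position inv)) (≡.sym (ℕₚ.+-suc (k ℕ.* d) j))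
        ; dot = +-cong (dot inv) (*-cong
            (reflexive (≡.trans (proj₁ (arrays inv) (J 3)) (≡.cong Q (column inv))))
            (reflexive (≡.trans (proj₁ (proj₂ (arrays inv)) (J 4)) (≡.cong K (position inv)))))
        ; arrays = arrays inv }

      allColumns : ∀ m k j s → j ℕ.+ suc m ≡ d → pc s ≡ 16 → Columns k j s →
        let s′ = run instanceProgram (suc m ℕ.* 7) s in pc s′ ≡ 23 × Columns k d s′
      allColumns zero    k j s j+1≡d at16 inv =
        let at , inv′ = oneColumn k j s at16 inv
            1+j≡d = ≡.trans (≡.sym (ℕₚ.+-comm j 1)) j+1≡d in
        ≡.trans at (≡.cong (λ b → if b then 16 else 23) (≥⇒<ᵇ≡false (ℕₚ.≤-reflexive (≡.sym 1+j≡d))))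
        , ≡.subst (λ j → Columns k j (run instanceProgram 7 s)) 1+j≡d inv′
      allColumns (suc m) k j s j+≡d at16 inv =
        let at , inv′ = oneColumn k j s at16 inv
            1+j+≡d = ≡.trans (≡.sym (ℕₚ.+-suc j (suc m))) j+≡d
            1+j<d = ≡.subst (suc (suc j) ℕ.≤_) 1+j+≡d (ℕₚ.m<m+n (suc j) (ℕ.s≤s ℕ.z≤n)) in
        allColumns m k (suc j) (run instanceProgram 7 s) 1+j+≡d
          (≡.trans at (≡.cong (λ b → if b then 16 else 23) (<⇒<ᵇ≡true 1+j<d))) inv′

      begins : ∀ k s → pc s ≡ 14 → Rounds w n k s → framed computeWeight w n Holds k s →
        let s′ = run instanceProgram 2 s in pc s′ ≡ 16 × Columns k 0 s′
      begins k (state _ J X A) ≡.refl inv (columns≡ , position≡ , arrays≡) = ≡.refl , record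
        { rounds = record { count = count inv ; round = round inv ; total = total inv
                          ; zeroReg = zeroReg inv ; output = output inv }
        ; columns = columns≡
        ; column = ≡.refl
        ; position = ≡.trans position≡ (≡.sym (ℕₚ.+-identityʳ _))
        ; dot = refl
        ; arrays = arrays≡ }

      weight≈ : ∀ k → k ℕ.< n → exp (partialSum (product k) d) * V k ≈ w k
      weight≈ k k<n = ≡.subst (λ k → exp (partialSum (product k) d) * V k ≈ w k) (Finₚ.toℕ-fromℕ< k<n)
        (trans (*-cong (exp-cong dot≈) (reflexive (pad-toℕ (value I) i))) (reflexive (≡.sym (pad-toℕ (weight I q) i))))
        where
        i = fromℕ< k<n
        dot≈ : partialSum (product (toℕ i)) d ≈ q ∙ key I i
        dot≈ = trans (sym (sum≈partialSum (product (toℕ i)) d)) (sum-cong (λ j →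
          *-cong (reflexive (pad-toℕ q j)) (reflexive (pad-concat (key I) i j))))

      finishes : ∀ k s → k ℕ.< n → pc s ≡ 23 → Columns k d s →
        let s′ = run instanceProgram 4 s in
        pc s′ ≡ 1 × Rounds w n k s′ × framed computeWeight w n Holds (suc k) s′ × reg s′ 1 ≈ w k
      finishes k (state _ J X A) k<n ≡.refl inv = ≡.refl
        , record { count = count (rounds inv) ; round = round (rounds inv) ; total = total (rounds inv)
                 ; zeroReg = zeroReg (rounds inv) ; output = output (rounds inv) }
        , (columns inv , ≡.trans (position inv) (ℕₚ.+-comm (k ℕ.* d) d) , arrays inv)
        , trans (*-cong (exp-cong (dot inv))
                  (reflexive (≡.trans (proj₂ (proj₂ (arrays inv)) (J 2)) (≡.cong V (round (rounds inv))))))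
            (weight≈ k k<n)

      weightRound : WeightRound computeWeight w n Holds (2 ℕ.+ (d ℕ.* 7 ℕ.+ 4))
      weightRound k s k<n at14 inv holds =
        ≡.subst (λ s′ → pc s′ ≡ 1 × Rounds w n k s′ × framed computeWeight w n Holds (suc k) s′ × reg s′ 1 ≈ w k)
          (≡.sym (run-+ instanceProgram (d ℕ.* 7) 4 s₁))
          (finishes k (run instanceProgram (d ℕ.* 7) s₁) k<n (proj₁ summed) (proj₂ summed))
        where
        s₁ = run instanceProgram 2 s
        begun = begins k s at14 inv holds
        suc-pred-d : suc (ℕ.pred d) ≡ d
        suc-pred-d = ℕₚ.suc-pred d {{ℕ.>-nonZero (1≤d I)}}
        summed : let s′ = run instanceProgram (d ℕ.* 7) s₁ in pc s′ ≡ 23 × Columns k d s′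
        summed = ≡.subst (λ e → let s′ = run instanceProgram (e ℕ.* 7) s₁ in pc s′ ≡ 23 × Columns k d s′)
          suc-pred-d (allColumns (ℕ.pred d) k 0 s₁ suc-pred-d (proj₁ begun) (proj₂ begun))

    instanceProgram-outputs : OutputsWithin instanceProgram (instanceInput I q) (25 ℕ.* (n ℕ.* d))
                                (signing (weight I q))
    instanceProgram-outputs = outputs {t = suc (n ℕ.* (2 ℕ.+ (d ℕ.* 7 ℕ.+ 4) ℕ.+ 10) ℕ.+ 1)}
      (instanceInput I q) bound (proj₁ result) (proj₂ result)
      where
      entered : State
      entered = step instanceProgram (instanceInput I q)

      result : let s′ = run instanceProgram (n ℕ.* (2 ℕ.+ (d ℕ.* 7 ℕ.+ 4) ℕ.+ 10) ℕ.+ 1) entered in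
               Halted instanceProgram s′ × Rounds w n n s′
      result = greedy-outputs computeWeight w n Holds (2 ℕ.+ (d ℕ.* 7 ℕ.+ 4)) weightRound
        (ℕₚ.m≤m+n 13 13) (1≤n I) entered ≡.refl
        (record { count = ≡.refl ; round = ≡.refl ; total = refl ; zeroReg = refl ; output = λ _ () })
        (≡.refl , ≡.refl , (λ _ → ≡.refl) , (λ _ → ≡.refl) , (λ _ → ≡.refl))

      bound : suc (n ℕ.* (2 ℕ.+ (d ℕ.* 7 ℕ.+ 4) ℕ.+ 10) ℕ.+ 1) ℕ.≤ 25 ℕ.* (n ℕ.* d)
      bound = instance-steps (1≤n I) (1≤d I)

-- Sums over subsets, removal of indices and blocks.

module SubsetSums (R : RealField) where
  open ConcretePrograms R public

  sumOver-+ : ∀ {n} (T : Subset n) f g → sumOver T (λ i → f i + g i) ≈ sumOver T f + sumOver T g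
  sumOver-+ []          f g = sym (+-identityʳ 0#)
  sumOver-+ (true ∷ T)  f g = trans (+-congˡ (sumOver-+ T (λ i → f (suc i)) (λ i → g (suc i))))
    (solve 4 (λ a b c d → (a :+ b) :+ (c :+ d) := (a :+ c) :+ (b :+ d)) refl
      (f zero) (g zero) (sumOver T (λ i → f (suc i))) (sumOver T (λ i → g (suc i))))
  sumOver-+ (false ∷ T) f g = trans (+-congˡ (sumOver-+ T (λ i → f (suc i)) (λ i → g (suc i))))
    (solve 2 (λ c d → con (+ 0) :+ (c :+ d) := (con (+ 0) :+ c) :+ (con (+ 0) :+ d)) refl
      (sumOver T (λ i → f (suc i))) (sumOver T (λ i → g (suc i))))

  sumOver-* : ∀ {n} (T : Subset n) c f → sumOver T (λ i → c * f i) ≈ c * sumOver T f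
  sumOver-* []          c f = sym (zeroʳ c)
  sumOver-* (true ∷ T)  c f = trans (+-congˡ (sumOver-* T c (λ i → f (suc i)))) (sym (distribˡ c _ _))
  sumOver-* (false ∷ T) c f = trans (+-congˡ (sumOver-* T c (λ i → f (suc i))))
    (solve 2 (λ c s → con (+ 0) :+ c :* s := c :* (con (+ 0) :+ s)) refl c (sumOver T (λ i → f (suc i))))

  sumOver-⊤ : ∀ {n} f → sumOver {n} ⊤ f ≈ sum f
  sumOver-⊤ {zero}  f = refl
  sumOver-⊤ {suc n} f = +-congˡ (sumOver-⊤ (λ i → f (suc i)))

  card-⊤ : ∀ n → card {n} ⊤ ≡ n
  card-⊤ zero    = ≡.refl
  card-⊤ (suc n) = ≡.cong suc (card-⊤ n)

  sumOver-─ : ∀ {n} (T T′ : Subset n) f → T′ ⊆ T → sumOver T f ≈ sumOver (T ─ T′) f + sumOver T′ f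
  sumOver-─ []          []           f T′⊆T = sym (+-identityʳ 0#)
  sumOver-─ (a ∷ T) (false ∷ T′) f T′⊆T = trans (+-congˡ (sumOver-─ T T′ (λ i → f (suc i)) (drop-∷-⊆ T′⊆T)))
    (solve 3 (λ a c d → a :+ (c :+ d) := (a :+ c) :+ (con (+ 0) :+ d)) refl (if a then f zero else 0#)
      (sumOver (T ─ T′) (λ i → f (suc i))) (sumOver T′ (λ i → f (suc i))))
  sumOver-─ (true ∷ T)  (true ∷ T′)  f T′⊆T = trans (+-congˡ (sumOver-─ T T′ (λ i → f (suc i)) (drop-∷-⊆ T′⊆T)))
    (solve 3 (λ a c d → a :+ (c :+ d) := (con (+ 0) :+ c) :+ (a :+ d)) refl (f zero)
      (sumOver (T ─ T′) (λ i → f (suc i))) (sumOver T′ (λ i → f (suc i))))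
  sumOver-─ (false ∷ T) (true ∷ T′)  f T′⊆T with () ← T′⊆T here

  card-─ : ∀ {n} (T T′ : Subset n) → T′ ⊆ T → card T ≡ card (T ─ T′) ℕ.+ card T′
  card-─ []          []           T′⊆T = ≡.refl
  card-─ (true ∷ T)  (false ∷ T′) T′⊆T = ≡.cong suc (card-─ T T′ (drop-∷-⊆ T′⊆T))
  card-─ (false ∷ T) (false ∷ T′) T′⊆T = card-─ T T′ (drop-∷-⊆ T′⊆T)
  card-─ (true ∷ T)  (true ∷ T′)  T′⊆T =
    ≡.trans (≡.cong suc (card-─ T T′ (drop-∷-⊆ T′⊆T))) (≡.sym (ℕₚ.+-suc _ _))
  card-─ (false ∷ T) (true ∷ T′)  T′⊆T with () ← T′⊆T here

  remove : ∀ {n} → Subset n → Fin n → Subset n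
  remove T i = T Vec.[ i ]≔ false

  remove-⊆ : ∀ {n} (T : Subset n) i → remove T i ⊆ T
  remove-⊆ (_ ∷ T) zero    (there x∈T) = there x∈T
  remove-⊆ (_ ∷ T) (suc i) here        = here
  remove-⊆ (_ ∷ T) (suc i) (there x∈T) = there (remove-⊆ T i x∈T)

  sumOver-remove : ∀ {n} {T : Subset n} {i} f → i ∈ T → sumOver T f ≈ sumOver (remove T i) f + f i
  sumOver-remove {T = _ ∷ T} f here =
    solve 2 (λ a s → a :+ s := (con (+ 0) :+ s) :+ a) refl (f zero) (sumOver T (λ i → f (suc i)))
  sumOver-remove {T = _ ∷ T} f (there i∈T) =
    trans (+-congˡ (sumOver-remove (λ i → f (suc i)) i∈T)) (sym (+-assoc _ _ _))

  card-remove : ∀ {n} {T : Subset n} {i} → i ∈ T → card T ≡ suc (card (remove T i))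
  card-remove {T = _ ∷ T}     here        = ≡.refl
  card-remove {T = true ∷ T}  (there i∈T) = ≡.cong suc (card-remove i∈T)
  card-remove {T = false ∷ T} (there i∈T) = card-remove i∈T

  sumOver-nonpos : ∀ {n} (T : Subset n) {f} → (∀ i → i ∈ T → f i ≤ 0#) → sumOver T f ≤ 0#
  sumOver-nonpos []          f≤0 = ≤-refl
  sumOver-nonpos (true ∷ T)  f≤0 = ≤-respʳ-≈ (+-identityʳ 0#)
    (+-mono-≤ (f≤0 zero here) (sumOver-nonpos T (λ i i∈T → f≤0 (suc i) (there i∈T))))
  sumOver-nonpos (false ∷ T) f≤0 = ≤-respʳ-≈ (+-identityʳ 0#)
    (+-mono-≤ ≤-refl (sumOver-nonpos T (λ i i∈T → f≤0 (suc i) (there i∈T))))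

  1≤card⇒Nonempty : ∀ {n} (T : Subset n) → 1 ℕ.≤ card T → Nonempty T
  1≤card⇒Nonempty (true ∷ T)  1≤card = zero , here
  1≤card⇒Nonempty (false ∷ T) 1≤card = let i , i∈T = 1≤card⇒Nonempty T 1≤card in suc i , there i∈T

  -- Otherwise all members would be negative, and splitting off one of them would make the whole sum
  -- negative.
  nonneg-member : ∀ {n} (T : Subset n) f → 1 ℕ.≤ card T → 0# ≤ sumOver T f →
                  Σ[ i ∈ Fin n ] (i ∈ T × 0# ≤ f i)
  nonneg-member T f 1≤card 0≤sum with Finₚ.any? (λ i → (i ∈? T) ×-dec (0# ≤? f i))
  ... | yes member = member
  ... | no  none   = contradiction (begin
      0#                               ≤⟨ 0≤sum ⟩
      sumOver T f                      ≈⟨ sumOver-remove f i₀∈T ⟩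
      sumOver (remove T i₀) f + f i₀   ≤⟨ +-mono-≤ (sumOver-nonpos (remove T i₀)
                                            (λ i i∈ → <⇒≤ (negative i (remove-⊆ T i₀ i∈)))) ≤-refl ⟩
      0# + f i₀                        ≈⟨ +-identityˡ _ ⟩
      f i₀                             ∎) (<⇒≱ (negative i₀ i₀∈T))
    where
    negative : ∀ i → i ∈ T → f i < 0#
    negative i i∈T = ≰⇒> (λ 0≤fi → none (i , i∈T , 0≤fi))
    i₀ = proj₁ (1≤card⇒Nonempty T 1≤card)
    i₀∈T = proj₂ (1≤card⇒Nonempty T 1≤card)

  module _ {n} (u : Vector Carrier n) {M} (∣u∣≤M : ∀ i → ∣ u i ∣ ≤ M) where

    private
      -- Removing i adds - u i, whose sign is opposite to that of the sum, so `∣x+y∣≤b` applies.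
      removal : ∀ {T i} → ∣ sumOver T u ∣ ≤ M → i ∈ T → 0# ≤ sumOver T u * u i →
                ∣ sumOver (remove T i) u ∣ ≤ M
      removal {T} {i} ∣s∣≤M i∈T 0≤su = ≤-respˡ-≈ (∣∣-cong (begin-equality
          sumOver T u - u i                         ≈⟨ +-congʳ (sumOver-remove u i∈T) ⟩
          sumOver (remove T i) u + u i - u i        ≈⟨ solve 2 (λ s u → s :+ u :- u := s) refl _ (u i) ⟩
          sumOver (remove T i) u                    ∎))
        (∣x+y∣≤b ∣s∣≤M (≤-respˡ-≈ (sym (∣-x∣≈∣x∣ (u i))) (∣u∣≤M i))
          (0≤-x⇒x≤0 (≤-respʳ-≈ (solve 2 (λ s u → s :* u := :- (s :* :- u)) refl (sumOver T u) (u i)) 0≤su)))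

    Peeled : ℕ → Subset n → Set
    Peeled m T = Σ[ T′ ∈ Subset n ] (T′ ⊆ T × card T ≡ m ℕ.+ card T′ × ∣ sumOver T′ u ∣ ≤ M)

    -- Removing a member of the same sign as the sum keeps the sum within M.
    peelOne : ∀ T → 1 ℕ.≤ card T → ∣ sumOver T u ∣ ≤ M →
              Peeled 1 T
    peelOne T 1≤card ∣s∣≤M = [ nonneg , nonpos ]′ (total 0# (sumOver T u))
      where
      nonneg : 0# ≤ sumOver T u → Peeled 1 T
      nonneg 0≤s = let i , i∈T , 0≤ui = nonneg-member T u 1≤card 0≤s in
        remove T i , remove-⊆ T i , card-remove i∈T , removal ∣s∣≤M i∈T (*-nonneg 0≤s 0≤ui)

      nonpos : sumOver T u ≤ 0# → Peeled 1 T
      nonpos s≤0 =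
        let 0≤-s = ≤-respʳ-≈ (trans (solve 1 (λ s → :- s := :- con (+ 1) :* s) refl (sumOver T u))
                     (sym (sumOver-* T (- 1#) u))) (x≤0⇒0≤-x s≤0)
            i , i∈T , 0≤-ui = nonneg-member T (λ i → - 1# * u i) 1≤card 0≤-s in
        remove T i , remove-⊆ T i , card-remove i∈T , removal ∣s∣≤M i∈T
          (≤-respʳ-≈ (solve 2 (λ s u → :- s :* (:- con (+ 1) :* u) := s :* u) refl (sumOver T u) (u i))
            (*-nonneg (x≤0⇒0≤-x s≤0) 0≤-ui))

    peel : ∀ m T → m ℕ.≤ card T → ∣ sumOver T u ∣ ≤ M →
           Peeled m T
    peel zero    T m≤card ∣s∣≤M = T , (λ x∈T → x∈T) , ≡.refl , ∣s∣≤M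
    peel (suc m) T m≤card ∣s∣≤M =
      let T₁ , T₁⊆T , card₁ , ∣s₁∣≤M = peelOne T (ℕₚ.≤-trans (ℕ.s≤s ℕ.z≤n) m≤card) ∣s∣≤M
          T₂ , T₂⊆T₁ , card₂ , ∣s₂∣≤M = peel m T₁ (ℕₚ.≤-pred (≡.subst (suc m ℕ.≤_) card₁ m≤card)) ∣s₁∣≤M in
      T₂ , (λ x∈T₂ → T₁⊆T (T₂⊆T₁ x∈T₂)) , ≡.trans card₁ (≡.cong suc card₂) , ∣s₂∣≤M

    module _ (κ : Vector Carrier n) {m} (1≤m : 1 ℕ.≤ m) where

      Block : Subset n → Set
      Block S = m ℕ.≤ card S × card S ℕ.≤ m ℕ.+ m × ∣ sumOver S u ∣ ≤ M + M × fromℕ m ≤ sumOver S κ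

      -- Blocks of size m are peeled off T.  If such a block has less κ-mass
      -- than elements, the rest still has at least as much mass as elements.
      block : ∀ fuel T → card T ℕ.≤ fuel → m ℕ.≤ card T → ∣ sumOver T u ∣ ≤ M →
              fromℕ (card T) ≤ sumOver T κ → Σ[ S ∈ Subset n ] Block S
      -- The fuel bounds the recursion: every pass takes m ≥ 1 members away, and no set of at least
      -- m members has cardinality zero.
      block zero    T card≤0 m≤card _ _ = contradiction (ℕₚ.≤-trans 1≤m (ℕₚ.≤-trans m≤card card≤0)) λ ()
      block (suc fuel) T card≤fuel m≤card ∣s∣≤M card≤κ = try (card T ℕₚ.≤? m ℕ.+ m)
        where
        try : Dec (card T ℕ.≤ m ℕ.+ m) → Σ[ S ∈ Subset n ] Block S
        -- Below 2m a further peel could leave fewer than m members, so T itself is the block; its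
        -- mass is at least its cardinality by the invariant.
        try (yes card≤2m) = T , m≤card , card≤2m
          , ≤-trans ∣s∣≤M (≤-by-difference (≤-trans (0≤∣x∣ _) ∣s∣≤M) refl) , ≤-trans (fromℕ-mono m≤card) card≤κ
        try (no  card≰2m) = choice (fromℕ m ≤? sumOver B κ)
          where
          peeled = peel m T m≤card ∣s∣≤M
          T′ = proj₁ peeled
          T′⊆T : T′ ⊆ T
          T′⊆T = proj₁ (proj₂ peeled)
          card-T = proj₁ (proj₂ (proj₂ peeled))
          ∣s′∣≤M = proj₂ (proj₂ (proj₂ peeled))
          B = T ─ T′
          card-B : card B ≡ m
          card-B = ℕₚ.+-cancelʳ-≡ (card T′) (card B) m (≡.trans (≡.sym (card-─ T T′ T′⊆T)) card-T)

          choice : Dec (fromℕ m ≤ sumOver B κ) → Σ[ S ∈ Subset n ] Block S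
          choice (yes m≤κB) = B , ℕₚ.≤-reflexive (≡.sym card-B)
            , ≡.subst (ℕ._≤ m ℕ.+ m) (≡.sym card-B) (ℕₚ.m≤m+n m m)
            , (begin
                ∣ sumOver B u ∣                        ≈⟨ ∣∣-cong (solve 2 (λ b t → b := (b :+ t) :- t) refl _ (sumOver T′ u)) ⟩
                ∣ sumOver B u + sumOver T′ u - sumOver T′ u ∣
                                                       ≈⟨ ∣∣-cong (+-congʳ (sumOver-─ T T′ u T′⊆T)) ⟨
                ∣ sumOver T u - sumOver T′ u ∣         ≤⟨ ∣x+y∣≤∣x∣+∣y∣ _ _ ⟩
                ∣ sumOver T u ∣ + ∣ - sumOver T′ u ∣   ≤⟨ +-mono-≤ ∣s∣≤M (≤-respˡ-≈ (sym (∣-x∣≈∣x∣ _)) ∣s′∣≤M) ⟩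
                M + M                                  ∎)
            , m≤κB
          choice (no  m≰κB) = block fuel T′
            (ℕₚ.≤-pred (ℕₚ.≤-trans (ℕₚ.≤-trans (ℕₚ.+-monoˡ-≤ (card T′) 1≤m) (ℕₚ.≤-reflexive (≡.sym card-T))) card≤fuel))
            (ℕₚ.+-cancelˡ-≤ m m (card T′) (≡.subst (m ℕ.+ m ℕ.≤_) card-T (ℕₚ.<⇒≤ (ℕₚ.≰⇒> card≰2m))))
            ∣s′∣≤M
            (begin
              fromℕ (card T′)
                ≈⟨ solve 2 (λ m t → t := m :+ t :- m) refl (fromℕ m) (fromℕ (card T′)) ⟩
              fromℕ m + fromℕ (card T′) - fromℕ m
                ≈⟨ +-congʳ (fromℕ-+ m (card T′)) ⟨
              fromℕ (m ℕ.+ card T′) - fromℕ m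
                ≡⟨ ≡.cong (λ k → fromℕ k - fromℕ m) card-T ⟨
              fromℕ (card T) - fromℕ m
                ≤⟨ +-mono-≤ card≤κ (-‿antimono (<⇒≤ (≰⇒> m≰κB))) ⟩
              sumOver T κ - sumOver B κ
                ≈⟨ +-congʳ (sumOver-─ T T′ κ T′⊆T) ⟩
              sumOver B κ + sumOver T′ κ - sumOver B κ
                ≈⟨ solve 2 (λ b t → b :+ t :- b := t) refl (sumOver B κ) (sumOver T′ κ) ⟩
              sumOver T′ κ ∎)

-- From a block to a subset approximating attention.

module SubsetApproximation (R : RealField) where
  open SubsetSums R public

  ∣x/y∣≤z : ∀ {x y z} → 0# < y → ∣ x ∣ ≤ z * y → ∣ x / y ∣ ≤ z
  ∣x/y∣≤z {x} {y} {z} 0<y ∣x∣≤zy = ∣x∣≤y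
    (x≤y*z⇒x/z≤y 0<y (≤-trans (x≤∣x∣ x) ∣x∣≤zy))
    (≤-respˡ-≈ (solve 2 (λ x i → :- x :* i := :- (x :* i)) refl x (y ⁻¹))
      (x≤y*z⇒x/z≤y 0<y (≤-trans (-x≤∣x∣ x) ∣x∣≤zy)))

  0<x≤n⇒1≤n : ∀ {x} n → 0# < x → x ≤ fromℕ n → 1 ℕ.≤ n
  0<x≤n⇒1≤n zero    0<x x≤0 = contradiction x≤0 (<⇒≱ 0<x)
  0<x≤n⇒1≤n (suc n) 0<x x≤n = ℕ.s≤s ℕ.z≤n

  -- Isolates what the approximation uses of attention: positive kernels bounded by e, weights
  -- dominated by them, and total mass at least n.
  module WeightedAverage {n} (κ w : Vector Carrier n) {e} (1≤n : 1 ℕ.≤ n)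
    (0<κ : ∀ i → 0# < κ i) (κ≤e : ∀ i → κ i ≤ e) (0<e : 0# < e)
    (∣w∣≤κ : ∀ i → ∣ w i ∣ ≤ κ i) (n≤sum-κ : fromℕ n ≤ sum κ) where

    average : Subset n → Carrier
    average S = sumOver S w / sumOver S κ

    private
      W K μ : Carrier
      W = sumOver ⊤ w
      K = sumOver ⊤ κ
      μ = average ⊤

      n≤K : fromℕ n ≤ K
      n≤K = ≤-respʳ-≈ (sym (sumOver-⊤ κ)) n≤sum-κ

      0<K : 0# < K
      0<K = <-≤-trans (0<fromℕ 1≤n) n≤K

      ∣μ∣≤1 : ∣ μ ∣ ≤ 1#
      ∣μ∣≤1 = ∣x/y∣≤z 0<K (begin
        ∣ W ∣                    ≈⟨ ∣∣-cong (sumOver-⊤ w) ⟩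
        ∣ sum w ∣                ≤⟨ ∣sum∣≤sum∣∣ w ⟩
        sum (λ i → ∣ w i ∣)      ≤⟨ sum-mono-≤ ∣w∣≤κ ⟩
        sum κ                    ≈⟨ sumOver-⊤ κ ⟨
        K                        ≈⟨ *-identityˡ K ⟨
        1# * K                   ∎)

      u : Vector Carrier n
      u i = w i + (- μ) * κ i

      sumOver-u : ∀ S → sumOver S u ≈ sumOver S w - μ * sumOver S κ
      sumOver-u S = trans (sumOver-+ S w (λ i → (- μ) * κ i)) (+-congˡ (trans (sumOver-* S (- μ) κ)
        (solve 2 (λ m k → :- m :* k := :- (m :* k)) refl μ (sumOver S κ))))

      ∣u∣≤2e : ∀ i → ∣ u i ∣ ≤ e + e
      ∣u∣≤2e i = begin
        ∣ u i ∣                     ≤⟨ ∣x+y∣≤∣x∣+∣y∣ (w i) ((- μ) * κ i) ⟩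
        ∣ w i ∣ + ∣ (- μ) * κ i ∣   ≤⟨ +-mono-≤ (≤-trans (∣w∣≤κ i) (κ≤e i)) (begin
          ∣ (- μ) * κ i ∣             ≤⟨ ∣x*y∣≤∣x∣*∣y∣ (- μ) (κ i) ⟩
          ∣ - μ ∣ * ∣ κ i ∣           ≤⟨ *-monoˡ-≤ (0≤∣x∣ (κ i)) (≤-respˡ-≈ (sym (∣-x∣≈∣x∣ μ)) ∣μ∣≤1) ⟩
          1# * ∣ κ i ∣                ≈⟨ *-identityˡ _ ⟩
          ∣ κ i ∣                     ≈⟨ 0≤x⇒∣x∣≈x (<⇒≤ (0<κ i)) ⟩
          κ i                         ≤⟨ κ≤e i ⟩
          e                           ∎) ⟩
        e + e                       ∎

      ∣sumOver-⊤-u∣≤2e : ∣ sumOver ⊤ u ∣ ≤ e + e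
      ∣sumOver-⊤-u∣≤2e = begin
        ∣ sumOver ⊤ u ∣   ≈⟨ ∣∣-cong (trans (sumOver-u ⊤) (trans (+-congˡ (-‿cong (x/y*y≈x W (0<⇒≉0 0<K)))) (-‿inverseʳ W))) ⟩
        ∣ 0# ∣            ≈⟨ 0≤x⇒∣x∣≈x ≤-refl ⟩
        0#                ≤⟨ 0≤x+y (<⇒≤ 0<e) (<⇒≤ 0<e) ⟩
        e + e             ∎

      -- Dividing Σ u over S by the mass of S gives exactly the deviation of the average from μ.
      average-error : ∀ S {ε} → 0# < sumOver S κ → ∣ sumOver S u ∣ ≤ ε * sumOver S κ →
                   ∣ average S - μ ∣ ≤ ε
      average-error S {ε} 0<κS ∣u∣≤εκ = ≤-respˡ-≈ (∣∣-cong (begin-equality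
        sumOver S u / k                 ≈⟨ *-congʳ (sumOver-u S) ⟩
        (sumOver S w - μ * k) * k ⁻¹    ≈⟨ solve 4 (λ w m k i → (w :- m :* k) :* i := w :* i :- m :* (k :* i)) refl (sumOver S w) μ k (k ⁻¹) ⟩
        average S - μ * (k * k ⁻¹)     ≈⟨ +-congˡ (-‿cong (trans (*-congˡ (⁻¹-inverseʳ (0<⇒≉0 0<κS))) (*-identityʳ μ))) ⟩
        average S - μ                  ∎)) (∣x/y∣≤z 0<κS ∣u∣≤εκ)
        where k = sumOver S κ

    module _ {ε} (0<ε : 0# < ε) where
      private
        x : Carrier
        -- A block has ∣Σ u∣ ≤ 2 · 2e and mass at least m, hence error at most 4e / m; this is at
        -- most ε once m ≥ 4e / ε.
        x = fromℕ 4 * e / ε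

        0<x : 0# < x
        0<x = 0<x*y (0<x*y (0<fromℕ-suc 3) 0<e) (0<x⇒0<x⁻¹ 0<ε)

        rounded = ceiling (<⇒≤ 0<x)
        m = proj₁ rounded
        x≤m : x ≤ fromℕ m
        x≤m = proj₁ (proj₂ rounded)

        1≤m : 1 ℕ.≤ m
        1≤m = 0<x≤n⇒1≤n m 0<x x≤m

        -- Since m ≤ x + 1, 2m is at most 8e/ε + 2; the difference 16e/ε + 1 to the stated bound is
        -- nonnegative.
        small : ∀ k → k ℕ.≤ m ℕ.+ m → fromℕ k ≤ fromℕ 24 * e / ε + fromℕ 3
        small k k≤2m = begin
          fromℕ k                       ≤⟨ fromℕ-mono k≤2m ⟩
          fromℕ (m ℕ.+ m)               ≈⟨ fromℕ-+ m m ⟩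
          fromℕ m + fromℕ m             ≤⟨ +-mono-≤ (proj₂ (proj₂ rounded)) (proj₂ (proj₂ rounded)) ⟩
          (x + 1#) + (x + 1#)           ≤⟨ ≤-by-difference (0≤x+y 0≤rest 0≤1) (begin-equality
            fromℕ 24 * e / ε + fromℕ 3
              ≈⟨ +-congʳ (*-congʳ (*-congʳ 24≈4+4+16)) ⟩
            (fromℕ 4 + (fromℕ 4 + fromℕ 16)) * e / ε + fromℕ 3
              ≈⟨ solve 4 (λ a b e i → (a :+ (a :+ b)) :* e :* i :+ (con (+ 1) :+ (con (+ 1) :+ (con (+ 1) :+ con (+ 0))))
                   := (a :* e :* i :+ con (+ 1)) :+ (a :* e :* i :+ con (+ 1)) :+ (b :* e :* i :+ con (+ 1)))
                   refl (fromℕ 4) (fromℕ 16) e (ε ⁻¹) ⟩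
            (x + 1#) + (x + 1#) + (fromℕ 16 * e / ε + 1#) ∎) ⟩
          fromℕ 24 * e / ε + fromℕ 3    ∎
          where
          0≤rest : 0# ≤ fromℕ 16 * e / ε
          0≤rest = *-nonneg (*-nonneg (0≤fromℕ 16) (<⇒≤ 0<e)) (0<x⇒0≤x⁻¹ 0<ε)
          24≈4+4+16 : fromℕ 24 ≈ fromℕ 4 + (fromℕ 4 + fromℕ 16)
          24≈4+4+16 = trans (fromℕ-+ 4 20) (+-congˡ (fromℕ-+ 4 16))

        4e≤ε*m : (e + e) + (e + e) ≤ ε * fromℕ m
        4e≤ε*m = begin
          (e + e) + (e + e)
            ≈⟨ solve 1 (λ e → (e :+ e) :+ (e :+ e) :=
                 (con (+ 1) :+ (con (+ 1) :+ (con (+ 1) :+ (con (+ 1) :+ con (+ 0))))) :* e) refl e ⟩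
          fromℕ 4 * e     ≈⟨ x/y*y≈x (fromℕ 4 * e) (0<⇒≉0 0<ε) ⟨
          x * ε           ≈⟨ *-comm x ε ⟩
          ε * x           ≤⟨ *-monoʳ-≤ (<⇒≤ 0<ε) x≤m ⟩
          ε * fromℕ m     ∎

        Approximating : Subset n → Set
        Approximating S = Nonempty S × fromℕ (card S) ≤ fromℕ 24 * e / ε + fromℕ 3
                        × ∣ average S - average ⊤ ∣ ≤ ε

      approximating-subset : Σ[ S ∈ Subset n ] Approximating S
      approximating-subset = choice (m ℕₚ.≤? n)
        where
        choice : Dec (m ℕ.≤ n) → Σ[ S ∈ Subset n ] Approximating S
        -- With fewer than m keys the full set is already small enough, and its error is zero.
        choice (no m≰n) = ⊤
          , 1≤card⇒Nonempty ⊤ (ℕₚ.≤-trans 1≤n (ℕₚ.≤-reflexive (≡.sym (card-⊤ n))))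
          , small (card {n} ⊤) (ℕₚ.≤-trans (ℕₚ.≤-reflexive (card-⊤ n))
              (ℕₚ.≤-trans (ℕₚ.<⇒≤ (ℕₚ.≰⇒> m≰n)) (ℕₚ.m≤m+n m m)))
          , (begin
              ∣ μ - μ ∣   ≈⟨ ∣∣-cong (-‿inverseʳ μ) ⟩
              ∣ 0# ∣      ≈⟨ 0≤x⇒∣x∣≈x ≤-refl ⟩
              0#          ≤⟨ <⇒≤ 0<ε ⟩
              ε           ∎)
        choice (yes m≤n) = S , 1≤card⇒Nonempty S (ℕₚ.≤-trans 1≤m m≤card) , small (card S) card≤2m
          , average-error S (<-≤-trans (0<fromℕ 1≤m) m≤κS) (begin
              ∣ sumOver S u ∣          ≤⟨ ∣uS∣≤4e ⟩
              (e + e) + (e + e)        ≤⟨ 4e≤ε*m ⟩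
              ε * fromℕ m              ≤⟨ *-monoʳ-≤ (<⇒≤ 0<ε) m≤κS ⟩
              ε * sumOver S κ          ∎)
          where
          found : Σ[ S ∈ Subset n ] Block u ∣u∣≤2e κ 1≤m S
          found = block u ∣u∣≤2e κ 1≤m n ⊤ (ℕₚ.≤-reflexive (card-⊤ n))
            (≡.subst (m ℕ.≤_) (≡.sym (card-⊤ n)) m≤n) ∣sumOver-⊤-u∣≤2e
            (≤-respˡ-≈ (reflexive (≡.cong fromℕ (≡.sym (card-⊤ n)))) n≤K)
          S = proj₁ found
          m≤card = proj₁ (proj₂ found)
          card≤2m = proj₁ (proj₂ (proj₂ found))
          ∣uS∣≤4e = proj₁ (proj₂ (proj₂ (proj₂ found)))
          m≤κS = proj₂ (proj₂ (proj₂ (proj₂ found)))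

  module _ {n d} (I : Instance n d) {ρ} (q : Vector Carrier d) (‖q‖≤ρ : ‖ q ‖ ≤ ρ) where
    private
      κ w : Vector Carrier n
      κ = kernel I q
      w = weight I q

    n≤sum-kernel : fromℕ n ≤ sum κ
    n≤sum-kernel = begin
      fromℕ n                                          ≈⟨ trans (sym (*-identityʳ _)) (sym (sum-const n 1#)) ⟩
      sum {n} (λ _ → 1#)                               ≈⟨ +-identityʳ _ ⟨
      sum {n} (λ _ → 1#) + 0#                          ≈⟨ +-congˡ dots≈0 ⟨
      sum {n} (λ _ → 1#) + sum (λ i → q ∙ key I i)     ≈⟨ ∑-distrib-+ (λ _ → 1#) (λ i → q ∙ key I i) ⟨
      sum (λ i → 1# + q ∙ key I i)                     ≤⟨ sum-mono-≤ (λ i → 1+x≤exp[x] (q ∙ key I i)) ⟩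
      sum κ                                            ∎
      where
      keys≈0 : ∀ j → sum (λ i → key I i j) ≈ 0#
      keys≈0 j = begin-equality
        S                                  ≈⟨ x/y*y≈x S n≉0 ⟨
        S / fromℕ n * fromℕ n              ≈⟨ solve 3 (λ s i n → s :* i :* n := con (+ 1) :* i :* s :* n) refl S (fromℕ n ⁻¹) (fromℕ n) ⟩
        1# / fromℕ n * S * fromℕ n         ≈⟨ *-congʳ (centred I j) ⟩
        0# * fromℕ n                       ≈⟨ zeroˡ _ ⟩
        0#                                 ∎
        where
        S = sum (λ i → key I i j)
        n≉0 = 0<⇒≉0 (0<fromℕ (1≤n I))

      dots≈0 : sum (λ i → q ∙ key I i) ≈ 0#
      dots≈0 = begin-equality
        sum (λ i → sum (λ j → q j * key I i j))   ≈⟨ ∑-comm (λ i j → q j * key I i j) ⟩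
        sum (λ j → sum (λ i → q j * key I i j))   ≈⟨ sum-cong (λ j → *-distribˡ-sum (q j) (λ i → key I i j)) ⟨
        sum (λ j → q j * sum (λ i → key I i j))   ≈⟨ sum-cong (λ j → trans (*-congˡ (keys≈0 j)) (zeroʳ (q j))) ⟩
        sum {d} (λ j → 0#)                        ≈⟨ trans (sum-const d 0#) (zeroʳ _) ⟩
        0#                                        ∎

    ∣weight∣≤kernel : ∀ i → ∣ w i ∣ ≤ κ i
    ∣weight∣≤kernel i = begin
      ∣ κ i * value I i ∣          ≤⟨ ∣x*y∣≤∣x∣*∣y∣ (κ i) (value I i) ⟩
      ∣ κ i ∣ * ∣ value I i ∣      ≤⟨ *-monoʳ-≤ (0≤∣x∣ (κ i)) (∣value∣≤1 I i) ⟩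
      ∣ κ i ∣ * 1#                 ≈⟨ *-identityʳ _ ⟩
      ∣ κ i ∣                      ≈⟨ 0≤x⇒∣x∣≈x (<⇒≤ (0<exp (q ∙ key I i))) ⟩
      κ i                          ∎

    approximating-subset : ∀ {ε} → 0# < ε →
      Σ[ S ∈ Subset n ] (Nonempty S × fromℕ (card S) ≤ fromℕ 24 * exp ρ / ε + fromℕ 3
                         × ∣ Attn I S q - Attn I ⊤ q ∣ ≤ ε)
    approximating-subset = WeightedAverage.approximating-subset κ w (1≤n I) (λ i → 0<exp (q ∙ key I i))
      (kernel≤exp[ρ] I q ‖q‖≤ρ) (0<exp ρ) ∣weight∣≤kernel n≤sum-kernel

-- The lower bound for one signing over the whole ball.

module WholeBall (R : RealField) where
  open SubsetApproximation R public

  partialSum-vanishing : ∀ f {m n} → m ℕ.≤′ n → (∀ k → m ℕ.≤ k → f k ≈ 0#) →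
                         partialSum f n ≈ partialSum f m
  partialSum-vanishing f (ℕ.≤′-reflexive ≡.refl) f≈0 = refl
  partialSum-vanishing f (ℕ.≤′-step m≤n)         f≈0 =
    trans (+-cong (partialSum-vanishing f m≤n f≈0) (f≈0 _ (ℕₚ.≤′⇒≤ m≤n))) (+-identityʳ _)

  pad-inside : ∀ {n k} (k<n : k ℕ.< n) (v : Vector Carrier n) → pad v k ≡ v (fromℕ< k<n)
  pad-inside {n} {k} k<n v =
    ≡.trans (≡.cong (pad v) (≡.sym (Finₚ.toℕ-fromℕ< k<n))) (pad-toℕ v (fromℕ< k<n))

  pad-outside : ∀ {n k} → n ℕ.≤ k → (v : Vector Carrier n) → pad v k ≡ 0#
  pad-outside {n} {k} n≤k v with k ℕₚ.<? n
  ... | yes k<n = contradiction n≤k (ℕₚ.<⇒≱ k<n)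
  ... | no  _   = ≡.refl

  extend : ∀ {r} d → Vector Carrier r → Vector Carrier d
  extend d v j = pad v (toℕ j)

  -- Zero padding embeds ℝʳ isometrically, which reduces every dimension d ≥ r to d = r.
  extend-∙ : ∀ {r d} → r ℕ.≤ d → (x y : Vector Carrier r) → extend d x ∙ extend d y ≈ x ∙ y
  extend-∙ {r} {d} r≤d x y = begin-equality
    extend d x ∙ extend d y   ≈⟨ sum≈partialSum f d ⟩
    partialSum f d            ≈⟨ partialSum-vanishing f (ℕₚ.≤⇒≤′ r≤d)
                                   (λ k r≤k → trans (*-congʳ (reflexive (pad-outside r≤k x))) (zeroˡ _)) ⟩
    partialSum f r            ≈⟨ sum≈partialSum f r ⟨
    sum {r} (λ j → f (toℕ j)) ≈⟨ sum-cong (λ j → *-cong (reflexive (pad-toℕ x j)) (reflexive (pad-toℕ y j))) ⟩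
    x ∙ y                     ∎
    where
    f : ℕ → Carrier
    f k = pad x k * pad y k

  δ : ∀ {n} → Fin n → Fin n → Carrier
  δ i j = if does (i Finₚ.≟ j) then 1# else 0#

  δ-sym : ∀ {n} (i j : Fin n) → δ i j ≡ δ j i
  δ-sym zero    zero    = ≡.refl
  δ-sym zero    (suc j) = ≡.refl
  δ-sym (suc i) zero    = ≡.refl
  δ-sym (suc i) (suc j) = δ-sym i j

  δ-∙ : ∀ {n} (i : Fin n) x → δ i ∙ x ≈ x i
  δ-∙ {suc n} zero x = begin-equality
    1# * x zero + sum (λ j → 0# * x (suc j))   ≈⟨ +-cong (*-identityˡ _) (sum-cong (λ j → zeroˡ (x (suc j)))) ⟩
    x zero + sum {n} (λ j → 0#)                ≈⟨ +-congˡ (trans (sum-const n 0#) (zeroʳ _)) ⟩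
    x zero + 0#                                ≈⟨ +-identityʳ _ ⟩
    x zero                                     ∎
  δ-∙ (suc i) x = trans (+-cong (zeroˡ _) (δ-∙ i (λ j → x (suc j)))) (+-identityˡ _)

  sum-δ : ∀ {n} (i : Fin n) → sum (δ i) ≈ 1#
  sum-δ i = trans (sum-cong (λ j → sym (*-identityʳ (δ i j)))) (δ-∙ i (λ _ → 1#))

  module _ {r} (1≤r : 1 ℕ.≤ r) where
    private
      ι : Carrier
      ι = fromℕ r ⁻¹

      rι≈1 : fromℕ r * ι ≈ 1#
      rι≈1 = ⁻¹-inverseʳ (0<⇒≉0 (0<fromℕ 1≤r))

      0≤ι : 0# ≤ ι
      0≤ι = 0<x⇒0≤x⁻¹ (0<fromℕ 1≤r)

    mean : Vector Carrier r → Carrier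
    mean x = ι * sum x

    -- The orthogonal projection of the i-th basis vector onto the hyperplane of vectors with
    -- coordinate sum zero.
    centredBasis : Fin r → Vector Carrier r
    centredBasis i j = δ i j - ι

    centredBasis-∙ : ∀ i x → centredBasis i ∙ x ≈ x i - mean x
    centredBasis-∙ i x = begin-equality
      sum (λ j → (δ i j - ι) * x j)
        ≈⟨ sum-cong (λ j → solve 3 (λ d i x → (d :- i) :* x := d :* x :- i :* x) refl (δ i j) ι (x j)) ⟩
      sum (λ j → δ i j * x j - ι * x j)
        ≈⟨ sum-‿- (λ j → δ i j * x j) (λ j → ι * x j) ⟩
      δ i ∙ x - sum (λ j → ι * x j)
        ≈⟨ +-cong (δ-∙ i x) (-‿cong (sym (*-distribˡ-sum ι x))) ⟩
      x i - mean x ∎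

    sum-centredBasis : ∀ i → sum (centredBasis i) ≈ 0#
    sum-centredBasis i = begin-equality
      sum (λ j → δ i j - ι)           ≈⟨ sum-‿- (δ i) (λ _ → ι) ⟩
      sum (δ i) - sum {r} (λ _ → ι)   ≈⟨ +-cong (sum-δ i) (-‿cong (trans (sum-const r ι) rι≈1)) ⟩
      1# - 1#                         ≈⟨ -‿inverseʳ 1# ⟩
      0#                              ∎

    -- The vector is its own projection: its mean is zero, so its square norm is its own i-th
    -- coordinate, 1 - 1/r.
    centredBasis-norm : ∀ i → centredBasis i ∙ centredBasis i ≤ 1#
    centredBasis-norm i = begin
      centredBasis i ∙ centredBasis i         ≈⟨ centredBasis-∙ i (centredBasis i) ⟩
      δ i i - ι - mean (centredBasis i)       ≈⟨ +-congˡ (-‿cong (trans (*-congˡ (sum-centredBasis i)) (zeroʳ ι))) ⟩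
      δ i i - ι - 0#                          ≤⟨ ≤-by-difference 0≤ι
                                                   (solve 2 (λ d i → d := d :- i :- con (+ 0) :+ i) refl (δ i i) ι) ⟩
      δ i i                                   ≤⟨ δ≤1 i i ⟩
      1#                                      ∎
      where
      δ≤1 : ∀ {n} (i j : Fin n) → δ i j ≤ 1#
      δ≤1 i j with i Finₚ.≟ j
      ... | yes _ = ≤-refl
      ... | no  _ = 0≤1

    basisInstance : ∀ {d} → r ℕ.≤ d → Instance r d
    basisInstance {d} r≤d = record
      { 1≤n = 1≤r
      ; 1≤d = ℕₚ.≤-trans 1≤r r≤d
      ; key = λ i → extend d (centredBasis i)
      ; value = λ _ → 1#
      ; centred = λ j → trans (*-congˡ (column (toℕ j))) (zeroʳ _)
      ; ‖key‖≤1 = λ i → √x≤y (0≤x∙x (extend d (centredBasis i))) 0≤1 (≤-resp (sym (extend-∙ r≤d (centredBasis i) (centredBasis i)))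
                    (sym (*-identityˡ 1#)) (centredBasis-norm i))
      ; ∣value∣≤1 = λ _ → ≤-reflexive (0≤x⇒∣x∣≈x 0≤1)
      }
      where
      column : ∀ k → sum (λ i → pad (centredBasis i) k) ≈ 0#
      column k = choice (k ℕₚ.<? r)
        where
        choice : Dec (k ℕ.< r) → sum (λ i → pad (centredBasis i) k) ≈ 0#
        -- By the symmetry of `δ`, column k of the key matrix equals row k, whose sum vanishes.
        -- Columns beyond r are padding.
        choice (yes k<r) = trans
          (sum-cong (λ i → trans (reflexive (pad-inside k<r (centredBasis i)))
            (+-congʳ (reflexive (δ-sym i (fromℕ< k<r))))))
          (sum-centredBasis (fromℕ< k<r))
        choice (no k≮r) = trans
          (sum-cong (λ i → reflexive (pad-outside (ℕₚ.≮⇒≥ k≮r) (centredBasis i))))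
          (trans (sum-const r 0#) (zeroʳ _))

    -- Signs as reals, so that one estimate covers both σ and its negation.
    IsSign : Carrier → Set
    IsSign x = (x ≈ 1#) ⊎ (x ≈ - 1#)

    private
      -‿one : ∀ x → x * - 1# ≈ - x
      -‿one = solve 1 (λ x → x :* :- con (+ 1) := :- x) refl

      h : Carrier
      h = half 1#

      0≤h : 0# ≤ h
      0≤h = <⇒≤ (0<half 0<1)

      -- The factor (1 + x)/2 is the indicator of x = 1. There the bound is the tangent line of exp;
      -- at x = -1 it is - exp(...) ≥ -1 for a nonpositive exponent. Being affine in x, the bound
      -- sums to an expression in the mean alone.
      signed-term : ∀ {x c m} → 0# ≤ c → 0# ≤ m → IsSign x →
                    x + (1# + x) * (h * (c * (1# - m))) ≤ x * exp (c * (x - m))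
      signed-term {x} {c} {m} 0≤c 0≤m (inj₁ x≈1) = begin
        x + (1# + x) * (h * (c * (1# - m)))
          ≈⟨ +-cong x≈1 (*-congʳ (+-congˡ x≈1)) ⟩
        1# + (1# + 1#) * (h * (c * (1# - m)))
          ≈⟨ solve 3 (λ h c m → con (+ 1) :+ (con (+ 1) :+ con (+ 1)) :* (h :* (c :* (con (+ 1) :- m)))
               := con (+ 1) :+ (h :+ h) :* (c :* (con (+ 1) :- m))) refl h c m ⟩
        1# + (h + h) * (c * (1# - m))
          ≈⟨ +-congˡ (*-congʳ (half+half 1#)) ⟩
        1# + 1# * (c * (1# - m))
          ≈⟨ +-congˡ (*-identityˡ (c * (1# - m))) ⟩
        1# + c * (1# - m)
          ≤⟨ 1+x≤exp[x] (c * (1# - m)) ⟩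
        exp (c * (1# - m))
          ≈⟨ exp-cong (*-congˡ (+-congʳ x≈1)) ⟨
        exp (c * (x - m))
          ≈⟨ *-identityˡ (exp (c * (x - m))) ⟨
        1# * exp (c * (x - m))
          ≈⟨ *-congʳ x≈1 ⟨
        x * exp (c * (x - m)) ∎
      signed-term {x} {c} {m} 0≤c 0≤m (inj₂ x≈-1) = begin
        x + (1# + x) * (h * (c * (1# - m)))
          ≈⟨ +-cong x≈-1 (*-congʳ (+-congˡ x≈-1)) ⟩
        - 1# + (1# - 1#) * (h * (c * (1# - m)))
          ≈⟨ solve 1 (λ t → :- con (+ 1) :+ (con (+ 1) :- con (+ 1)) :* t := :- con (+ 1)) refl (h * (c * (1# - m))) ⟩
        - 1#
          ≤⟨ -‿antimono (0≤x⇒exp[-x]≤1 (*-nonneg 0≤c (0≤x+y 0≤1 0≤m))) ⟩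
        - exp (- (c * (1# + m)))
          ≈⟨ -‿cong (exp-cong (trans (solve 2 (λ c m → :- (c :* (con (+ 1) :+ m)) := c :* (:- con (+ 1) :- m)) refl c m)
               (*-congˡ (+-congʳ (sym x≈-1))))) ⟩
        - exp (c * (x - m))
          ≈⟨ -‿one (exp (c * (x - m))) ⟨
        exp (c * (x - m)) * - 1#
          ≈⟨ *-comm (exp (c * (x - m))) (- 1#) ⟩
        - 1# * exp (c * (x - m))
          ≈⟨ *-congʳ x≈-1 ⟨
        x * exp (c * (x - m)) ∎

      sign≤1 : ∀ {x} → IsSign x → x ≤ 1#
      sign≤1 (inj₁ x≈1)  = ≤-reflexive x≈1
      sign≤1 (inj₂ x≈-1) = ≤-trans (≤-reflexive x≈-1)
        (≤-by-difference (0≤x+y 0≤1 0≤1) (solve 0 (con (+ 1) := :- con (+ 1) :+ (con (+ 1) :+ con (+ 1))) refl))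

      sign² : ∀ {x} → IsSign x → x * x ≈ 1#
      sign² (inj₁ x≈1)  = trans (*-cong x≈1 x≈1) (*-identityˡ 1#)
      sign² (inj₂ x≈-1) = trans (*-cong x≈-1 x≈-1) (solve 0 (:- con (+ 1) :* :- con (+ 1) := con (+ 1)) refl)

    -- With m the mean of the signs x, the bound of signed-term sums to
    -- r (m + c (1 - m²) / 2), which is at least r c / 2 for 0 ≤ m, c ≤ 1.
    signed-sum-lower : ∀ {x : Vector Carrier r} {c} → 0# ≤ c → c ≤ 1# → (∀ i → IsSign (x i)) → 0# ≤ sum x →
      fromℕ r * (c * half 1#) ≤ sum (λ i → x i * exp (c * (x i - mean x)))
    signed-sum-lower {x} {c} 0≤c c≤1 signs 0≤Σx = begin
      fromℕ r * (c * h)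
        -- The surplus over r c h is r m (1 - h c m), nonnegative because h, c and m lie between 0
        -- and 1.
        ≤⟨ ≤-by-difference (*-nonneg (0≤fromℕ r) (*-nonneg 0≤m (x≤y⇒0≤y-x hcm≤1)))
             (solve 4 (λ r c h m → r :* m :+ r :* (con (+ 1) :+ m) :* (h :* (c :* (con (+ 1) :- m)))
               := r :* (c :* h) :+ r :* (m :* (con (+ 1) :- h :* (c :* m)))) refl (fromℕ r) c h m) ⟩
      fromℕ r * m + fromℕ r * (1# + m) * t
        ≈⟨ +-cong rm≈Σx (*-congʳ (trans (solve 2 (λ r m → r :* (con (+ 1) :+ m) := r :+ r :* m) refl (fromℕ r) m)
             (+-congˡ rm≈Σx))) ⟩
      sum x + (fromℕ r + sum x) * t
        ≈⟨ +-congˡ (*-congʳ (+-congʳ (trans (sym (*-identityʳ _)) (sym (sum-const r 1#))))) ⟩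
      sum x + (sum {r} (λ _ → 1#) + sum x) * t
        ≈⟨ +-congˡ (*-congʳ (∑-distrib-+ (λ _ → 1#) x)) ⟨
      sum x + sum (λ i → 1# + x i) * t
        ≈⟨ +-congˡ (*-distribʳ-sum t (λ i → 1# + x i)) ⟩
      sum x + sum (λ i → (1# + x i) * t)
        ≈⟨ ∑-distrib-+ x (λ i → (1# + x i) * t) ⟨
      sum (λ i → x i + (1# + x i) * t)
        ≤⟨ sum-mono-≤ (λ i → signed-term 0≤c 0≤m (signs i)) ⟩
      sum (λ i → x i * exp (c * (x i - m))) ∎
      where
      m = mean x
      t = h * (c * (1# - m))
      0≤m : 0# ≤ m
      0≤m = *-nonneg 0≤ι 0≤Σx
      rm≈Σx : fromℕ r * m ≈ sum x
      rm≈Σx = trans (sym (*-assoc _ _ _)) (trans (*-congʳ rι≈1) (*-identityˡ _))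
      m≤1 : m ≤ 1#
      m≤1 = ≤-trans (*-monoʳ-≤ 0≤ι (sum-mono-≤ (λ i → sign≤1 (signs i))))
        (≤-reflexive (trans (*-congˡ (trans (sum-const r 1#) (*-identityʳ _))) (trans (*-comm _ _) rι≈1)))
      h≤1 : h ≤ 1#
      h≤1 = ≤-by-difference 0≤h (sym (half+half 1#))
      hcm≤1 : h * (c * m) ≤ 1#
      hcm≤1 = ≤-respʳ-≈ (trans (*-identityˡ _) (*-identityˡ 1#))
        (*-mono-≤ (*-nonneg 0≤c 0≤m) 0≤1 h≤1 (*-mono-≤ 0≤m 0≤1 c≤1 m≤1))

    module _ {d} (r≤d : r ℕ.≤ d) {ρ} (0<ρ : 0# < ρ) (ρ≤√r : ρ ≤ √ (fromℕ r)) where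
      private
        I : Instance r d
        I = basisInstance r≤d

        s c : Carrier
        s = √ (fromℕ r)
        -- A sign vector has norm √r, so the scale ρ/√r puts the query on the sphere of radius ρ; ρ
        -- ≤ √r gives c ≤ 1.
        c = ρ / s

        0<s : 0# < s
        0<s = <-≤-trans 0<ρ ρ≤√r

        0≤c : 0# ≤ c
        0≤c = *-nonneg (<⇒≤ 0<ρ) (0<x⇒0≤x⁻¹ 0<s)

        c≤1 : c ≤ 1#
        c≤1 = x≤y*z⇒x/z≤y 0<s (≤-respʳ-≈ (sym (*-identityˡ s)) ρ≤√r)

        cs≈ρ : c * s ≈ ρ
        cs≈ρ = x/y*y≈x ρ (0<⇒≉0 0<s)

        ss≈r : s * s ≈ fromℕ r
        ss≈r = √x*√x≈x (0≤fromℕ r)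

        query : Vector Carrier r → Vector Carrier d
        query x = extend d (λ j → c * x j)

        ‖query‖≤ρ : ∀ {x} → (∀ i → IsSign (x i)) → ‖ query x ‖ ≤ ρ
        ‖query‖≤ρ {x} signs = √x≤y (0≤x∙x (query x)) (<⇒≤ 0<ρ) (≤-reflexive (begin-equality
          query x ∙ query x             ≈⟨ extend-∙ r≤d (λ j → c * x j) (λ j → c * x j) ⟩
          sum (λ j → c * x j * (c * x j))
            ≈⟨ sum-cong (λ j → trans (solve 2 (λ c x → c :* x :* (c :* x) := c :* c :* (x :* x)) refl c (x j))
                 (trans (*-congˡ (sign² (signs j))) (*-identityʳ _))) ⟩
          sum {r} (λ j → c * c)         ≈⟨ sum-const r (c * c) ⟩
          fromℕ r * (c * c)             ≈⟨ *-congʳ ss≈r ⟨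
          s * s * (c * c)               ≈⟨ solve 2 (λ s c → s :* s :* (c :* c) := c :* s :* (c :* s)) refl s c ⟩
          c * s * (c * s)               ≈⟨ *-cong cs≈ρ cs≈ρ ⟩
          ρ * ρ                         ∎))

        query-∙ : ∀ x i → query x ∙ key I i ≈ c * (x i - mean x)
        query-∙ x i = begin-equality
          query x ∙ key I i                     ≈⟨ extend-∙ r≤d (λ j → c * x j) (centredBasis i) ⟩
          sum (λ j → c * x j * centredBasis i j)
            ≈⟨ sum-cong (λ j → solve 3 (λ c x k → c :* x :* k := c :* (k :* x)) refl c (x j) (centredBasis i j)) ⟩
          sum (λ j → c * (centredBasis i j * x j)) ≈⟨ *-distribˡ-sum c (λ j → centredBasis i j * x j) ⟨
          c * (centredBasis i ∙ x)              ≈⟨ *-congˡ (centredBasis-∙ i x) ⟩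
          c * (x i - mean x)                    ∎

        -- Here r c / 2 = ρ √r / 2, and the passage from 1/2 to 1/e is 2 = 1 + 1 ≤ e.
        target≤ : ρ * s / exp 1# ≤ fromℕ r * (c * h)
        target≤ = x≤y*z⇒x/z≤y (0<exp 1#) (begin
          ρ * s                                ≈⟨ *-congʳ cs≈ρ ⟨
          c * s * s                            ≈⟨ *-assoc c s s ⟩
          c * (s * s)                          ≈⟨ *-congˡ ss≈r ⟩
          c * fromℕ r                          ≈⟨ *-identityʳ _ ⟨
          c * fromℕ r * 1#                     ≈⟨ *-congˡ (half+half 1#) ⟨
          c * fromℕ r * (h + h)                ≈⟨ solve 3 (λ c r h → c :* r :* (h :+ h) := r :* (c :* h) :* (con (+ 1) :+ con (+ 1))) refl c (fromℕ r) h ⟩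
          fromℕ r * (c * h) * (1# + 1#)        ≤⟨ *-monoʳ-≤ (*-nonneg (0≤fromℕ r) (*-nonneg 0≤c 0≤h)) (1+x≤exp[x] 1#) ⟩
          fromℕ r * (c * h) * exp 1#           ∎)

        signed-kernel-sum : ∀ {x} → (∀ i → IsSign (x i)) → 0# ≤ sum x →
          ρ * s / exp 1# ≤ sum (λ i → x i * kernel I (query x) i)
        signed-kernel-sum {x} signs 0≤Σx = ≤-trans target≤ (≤-trans
          (signed-sum-lower {x} {c} 0≤c c≤1 signs 0≤Σx)
          (≤-reflexive (sum-cong (λ i → *-congˡ (sym (exp-cong (query-∙ x i)))))))

        sgn-IsSign : ∀ σ → IsSign (sgn σ)
        sgn-IsSign Sign.+ = inj₁ refl
        sgn-IsSign Sign.- = inj₂ refl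

        -sgn-IsSign : ∀ σ → IsSign (- sgn σ)
        -sgn-IsSign Sign.+ = inj₂ refl
        -sgn-IsSign Sign.- = inj₁ (solve 0 (:- (:- con (+ 1)) := con (+ 1)) refl)

        sum-neg : ∀ {n} (f : Vector Carrier n) → sum (λ i → - f i) ≈ - sum f
        sum-neg {n} f = begin-equality
          sum (λ i → - f i)          ≈⟨ sum-cong (λ i → sym (+-identityˡ (- f i))) ⟩
          sum (λ i → 0# - f i)       ≈⟨ sum-‿- (λ _ → 0#) f ⟩
          sum {n} (λ _ → 0#) - sum f ≈⟨ +-congʳ (trans (sum-const n 0#) (zeroʳ _)) ⟩
          0# - sum f                 ≈⟨ +-identityˡ _ ⟩
          - sum f                    ∎

      large-query : ∀ (σ : Fin r → Sign) →
        Σ[ q ∈ Vector Carrier d ] (‖ q ‖ ≤ ρ × ρ * √ (fromℕ r) / exp 1# ≤ ∣ signedSum σ (kernel I q) ∣)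
      large-query σ = [ majority , minority ]′ (total 0# (sum x))
        where
        x : Vector Carrier r
        x i = sgn (σ i)

        Large : Set
        Large = Σ[ q ∈ Vector Carrier d ] (‖ q ‖ ≤ ρ × ρ * √ (fromℕ r) / exp 1# ≤ ∣ signedSum σ (kernel I q) ∣)

        majority : 0# ≤ sum x → Large
        majority 0≤Σx = query x , ‖query‖≤ρ (λ i → sgn-IsSign (σ i))
          , ≤-trans (signed-kernel-sum (λ i → sgn-IsSign (σ i)) 0≤Σx) (x≤∣x∣ (signedSum σ (kernel I (query x))))

        minority : sum x ≤ 0# → Large
        -- For y = -σ the estimate bounds the negated signed sum of σ, and the absolute value
        -- absorbs the sign.
        minority Σx≤0 = query y , ‖query‖≤ρ (λ i → -sgn-IsSign (σ i))
          , ≤-trans (signed-kernel-sum (λ i → -sgn-IsSign (σ i)) (≤-respʳ-≈ (sym (sum-neg x)) (x≤0⇒0≤-x Σx≤0)))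
              (≤-trans (≤-reflexive sum≈) (-x≤∣x∣ (signedSum σ (kernel I (query y)))))
          where
          y : Vector Carrier r
          y i = - x i
          κ : Vector Carrier r
          κ = kernel I (query y)
          sum≈ : sum (λ i → y i * κ i) ≈ - signedSum σ κ
          sum≈ = trans (sum-cong (λ i → solve 2 (λ x k → :- x :* k := :- (x :* k)) refl (x i) (κ i)))
                   (sum-neg (λ i → x i * κ i))

      -- The supremum has to be shown to exist: the image is nonempty by `large-query` and bounded
      -- by r e^ρ, as each of the r kernels is at most e^ρ on the ball.
      ballSupremum : ∀ (σ : Fin r → Sign) → Σ[ S ∈ Carrier ]
        ( IsSup (BallImage ρ (λ q → ∣ signedSum σ (kernel I q) ∣)) S
        × ρ * √ (fromℕ r) / exp 1# ≤ S )
      ballSupremum σ = S , proj₂ supremum , ≤-trans large (proj₁ (proj₂ supremum) _ image)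
        where
        f : Vector Carrier d → Carrier
        f q = ∣ signedSum σ (kernel I q) ∣
        q₀ = proj₁ (large-query σ)
        large = proj₂ (proj₂ (large-query σ))
        image : BallImage ρ f (f q₀)
        image = q₀ , proj₁ (proj₂ (large-query σ)) , refl

        ∣sgn∣≤1 : ∀ τ → ∣ sgn τ ∣ ≤ 1#
        ∣sgn∣≤1 Sign.+ = ≤-reflexive (0≤x⇒∣x∣≈x 0≤1)
        ∣sgn∣≤1 Sign.- = ≤-reflexive (trans (∣-x∣≈∣x∣ 1#) (0≤x⇒∣x∣≈x 0≤1))

        bounded : ∀ y → BallImage ρ f y → y ≤ fromℕ r * exp ρ
        bounded y (q , ‖q‖≤ρ , y≈fq) = begin
          y                                      ≈⟨ y≈fq ⟩
          f q                                    ≤⟨ ∣sum∣≤sum∣∣ (λ i → sgn (σ i) * kernel I q i) ⟩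
          sum (λ i → ∣ sgn (σ i) * kernel I q i ∣) ≤⟨ sum-mono-≤ term≤ ⟩
          sum {r} (λ i → exp ρ)                  ≈⟨ sum-const r (exp ρ) ⟩
          fromℕ r * exp ρ                        ∎
          where
          term≤ : ∀ i → ∣ sgn (σ i) * kernel I q i ∣ ≤ exp ρ
          term≤ i = begin
            ∣ sgn (σ i) * kernel I q i ∣        ≤⟨ ∣x*y∣≤∣x∣*∣y∣ (sgn (σ i)) (kernel I q i) ⟩
            ∣ sgn (σ i) ∣ * ∣ kernel I q i ∣    ≤⟨ *-monoˡ-≤ (0≤∣x∣ (kernel I q i)) (∣sgn∣≤1 (σ i)) ⟩
            1# * ∣ kernel I q i ∣               ≈⟨ *-identityˡ ∣ kernel I q i ∣ ⟩
            ∣ kernel I q i ∣                    ≈⟨ 0≤x⇒∣x∣≈x (<⇒≤ (0<exp (q ∙ key I i))) ⟩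
            kernel I q i                        ≤⟨ kernel≤exp[ρ] I q ‖q‖≤ρ i ⟩
            exp ρ                               ∎

        supremum = complete (BallImage ρ f) (f q₀ , image) (fromℕ r * exp ρ , bounded)
        S = proj₁ supremum

proposition1p5 : (R : RealField) → let open Attention R in
    -- (i), signings: one arithmetic program and one full program, with a common time constant
    (Σ[ p ∈ Program arithmetic ] Σ[ p′ ∈ Program withExp ] Σ[ C ∈ ℕ ]
      (∀ {n d} (I : Instance n d) (ρ : Carrier) (q : Vector Carrier d) → ‖ q ‖ ≤ ρ →
        Σ[ σ ∈ (Fin n → Sign) ]
          ( ∣ signedSum σ (weight I q) ∣ ≤ exp ρ
          × OutputsWithin p (weightsInput I q) (C ℕ.* n) σ
          × OutputsWithin p′ (instanceInput I q) (C ℕ.* (n ℕ.* d)) σ )))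
    -- (i), subsets
  × (∀ {n d} (I : Instance n d) (ρ : Carrier) (q : Vector Carrier d) → ‖ q ‖ ≤ ρ →
      ∀ ε → 0# < ε → ε ≤ 1# →
      Σ[ S ∈ Subset n ]
        ( Nonempty S
        × fromℕ (card S) ≤ fromℕ 24 * exp ρ / ε + fromℕ 3
        × ∣ Attn I S q - Attn I ⊤ q ∣ ≤ ε ))
    -- (ii)
  × (∀ r d → 2 ℕ.≤ r → r ℕ.≤ d → ∀ ρ → 0# < ρ → ρ ≤ √ (fromℕ r) →
      Σ[ I ∈ Instance r d ]
        ( (∀ i → value I i ≈ 1#)
        × (∀ (σ : Fin r → Sign) →
            Σ[ s ∈ Carrier ]
              ( IsSup (BallImage ρ (λ q → ∣ signedSum σ (kernel I q) ∣)) s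
              × ρ * √ (fromℕ r) / exp 1# ≤ s ))))
    -- the case ρ = 1: a whole-ball signing costs Ω(√d) ...
  × (Σ[ c ∈ Carrier ] (0# < c × (∀ d → 2 ℕ.≤ d →
      Σ[ n ∈ ℕ ] Σ[ I ∈ Instance n d ]
        ( (∀ i → value I i ≈ 1#)
        × (∀ (σ : Fin n → Sign) →
            Σ[ s ∈ Carrier ]
              ( IsSup (BallImage 1# (λ q → ∣ signedSum σ (kernel I q) ∣)) s
              × c * √ (fromℕ d) ≤ s ))))))
    -- ... whereas a single query costs O(1)
  × (Σ[ C ∈ Carrier ] (∀ {n d} (I : Instance n d) (q : Vector Carrier d) → ‖ q ‖ ≤ 1# →
      Σ[ σ ∈ (Fin n → Sign) ] ∣ signedSum σ (weight I q) ∣ ≤ C))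
proposition1p5 R =
    ( weightsProgram , instanceProgram , 25 , λ I ρ q ‖q‖≤ρ →
      signing (weight I q)
      , ∣signedSum-weight∣≤exp[ρ] I q ‖q‖≤ρ
      , weightsProgram-outputs I q
      , instanceProgram-outputs I q )
  , (λ I ρ q ‖q‖≤ρ ε 0<ε _ → approximating-subset I q ‖q‖≤ρ 0<ε)
  , (λ r d 2≤r r≤d ρ 0<ρ ρ≤√r →
      basisInstance (ℕₚ.<⇒≤ 2≤r) r≤d , (λ _ → refl) , ballSupremum (ℕₚ.<⇒≤ 2≤r) r≤d 0<ρ ρ≤√r)
  -- At ρ = 1 take r = d keys; the condition on ρ becomes 1 ≤ √d, and the constant of the
  -- square-root bound is 1/e.
  , ( exp 1# ⁻¹ , 0<x⇒0<x⁻¹ (0<exp 1#) , λ d 2≤d →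
      let 1≤d = ℕₚ.<⇒≤ 2≤d
          1≤√d = 1≤√ (≤-respˡ-≈ (+-identityʳ 1#) (fromℕ-mono 1≤d)) in
      d , basisInstance 1≤d ℕₚ.≤-refl , (λ _ → refl) , λ σ →
      let s , isSup , lower = ballSupremum 1≤d ℕₚ.≤-refl 0<1 1≤√d σ in
      s , isSup , ≤-respˡ-≈
        (solve 2 (λ a i → con (+ 1) :* a :* i := i :* a) refl (√ (fromℕ d)) (exp 1# ⁻¹)) lower )
  , ( exp 1# , λ I q ‖q‖≤1 → signing (weight I q) , ∣signedSum-weight∣≤exp[ρ] I q ‖q‖≤1 )
  where open WholeBall R
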